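{- For every nonnegative integer $n$, \begin{align*} \overline{a}_5(20n+6) &= 20\,\overline{b}_5(10n),\\ \overline{a}_5(20n+14) &= 20\,\overline{b}_5(10n+4). \end{align*}
   Context: For $j\ge1$ let $f_j:=\prod_{k\ge 1}(1-q^{jk})$ (for $|q|<1$, or as a formal power series). Let $\varphi(-q):=\sum_{n=-\infty}^{\infty}(-1)^n q^{n^2}=f_1^2/f_2$ and $\psi(-q):=\sum_{n=0}^{\infty}(-q)^{n(n+1)/2}=f_1f_4/f_2$, so that $\varphi(-q^5)=f_5^2/f_{10}$ and $\psi(-q^5)=f_5f_{20}/f_{10}$. The integers $\overline{a}_5(n)$ and $\overline{b}_5(n)$ are defined by $$\sum_{n=0}^\infty \overline{a}_5(n)q^n=\frac{\varphi^5(-q^5)}{\varphi(-q)}=1+2q+4q^2+8q^3+14q^4+14q^5+20q^6+24q^7+\cdots,$$ $$\sum_{n=0}^\infty \overline{b}_5(n)q^n=\frac{\psi^5(-q^5)}{\psi(-q)}=1+q+q^2+2q^3+3q^4-q^5+2q^7-2q^9+6q^{10}+\cdots .$$ -}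

module Defs where

open import Data.Bool using (if_then_else_)
open import Data.Fin using (Fin; zero; suc; toℕ)
open import Data.Integer using (ℤ; +_; -[1+_]; 0ℤ; 1ℤ; -1ℤ; ∣_∣; _⊖_; _+_; _-_; _*_; _^_)
open import Data.Integer.Properties as ℤ using (+-*-semiring)
open import Data.Nat as ℕ using (ℕ; zero; suc; NonZero; _∸_; _≟_)
open import Data.Nat.Divisibility using (_∣?_; divides)
open import Data.Vec using (Vec; []; _∷_; head; lookup; tabulate)
open import Relation.Binary.PropositionalEquality
open import Relation.Nullary using (yes; no; does)

open import Algebra.Properties.AbelianGroup ℤ.+-0-abelianGroup using (//-rightDividesˡ)
open import Algebra.Properties.Semiring.Sum +-*-semiring
  using (sum-syntax; sum-cong-≗)

-- Formal power series Σ_n f(n) qⁿ with integer coefficients.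
PowerSeries : Set
PowerSeries = ℕ → ℤ

_·q^_ : ℤ → ℕ → PowerSeries
(c ·q^ e) m = if does (m ≟ e) then c else 0ℤ

infixl 7 _⊛_ _÷_
infixr 8 _^ˢ_

_⊛_ : PowerSeries → PowerSeries → PowerSeries
(f ⊛ g) n = ∑[ i < suc n ] (f (toℕ i) * g (n ∸ toℕ i))

_^ˢ_ : PowerSeries → ℕ → PowerSeries
f ^ˢ zero  = 1ℤ ·q^ 0
f ^ˢ suc k = f ⊛ f ^ˢ k

-- The substitution q ↦ q^d.
_⟨q^_⟩ : PowerSeries → (d : ℕ) → .{{NonZero d}} → PowerSeries
(f ⟨q^ d ⟩) n with d ∣? n
... | yes (divides k _) = f k
... | no  _             = 0ℤ

-- The first n coefficients of f / g, highest degree first, assuming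
-- that g has constant term 1: h(n) = f(n) - Σ_{1≤i≤n} g(i) h(n-i).
quotients : PowerSeries → PowerSeries → (n : ℕ) → Vec ℤ n
quotients f g zero    = []
quotients f g (suc n) = next (quotients f g n)
  where
  next : Vec ℤ n → Vec ℤ (suc n)
  next hs = (f n - ∑[ i < n ] (g (suc (toℕ i)) * lookup hs i)) ∷ hs

-- The quotient f / g; meaningful only if g has constant term 1 (see ÷-correct).
_÷_ : PowerSeries → PowerSeries → PowerSeries
(f ÷ g) n = head (quotients f g (suc n))

lookup-quotients : ∀ f g n (i : Fin n) →
                   lookup (quotients f g n) i ≡ (f ÷ g) (n ∸ suc (toℕ i))
lookup-quotients f g (suc n) zero    = refl
lookup-quotients f g (suc n) (suc i) = lookup-quotients f g n i

÷-correct : ∀ f g → g 0 ≡ 1ℤ → (g ⊛ (f ÷ g)) ≗ f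
÷-correct f g g₀≡1 n = begin
  g 0 * (f n - s) + s′  ≡⟨ cong (λ c → c * (f n - s) + s′) g₀≡1 ⟩
  1ℤ * (f n - s) + s′   ≡⟨ cong (_+ s′) (ℤ.*-identityˡ (f n - s)) ⟩
  (f n - s) + s′        ≡⟨ cong (λ t → (f n - t) + s′) s≡s′ ⟩
  (f n - s′) + s′       ≡⟨ //-rightDividesˡ s′ (f n) ⟩
  f n                   ∎
  where
  open ≡-Reasoning
  s s′ : ℤ
  s  = ∑[ i < n ] (g (suc (toℕ i)) * lookup (quotients f g n) i)
  s′ = ∑[ i < n ] (g (suc (toℕ i)) * (f ÷ g) (n ∸ suc (toℕ i)))
  s≡s′ : s ≡ s′
  s≡s′ = sum-cong-≗ λ i → cong (g (suc (toℕ i)) *_) (lookup-quotients f g n i)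

-- φ(-q) = Σ_{k∈ℤ} (-1)^k q^(k²).  Only k with |k| ≤ k² = m contribute to
-- the coefficient of q^m, so k = i - m runs over -m, …, m.
φ[-q] : PowerSeries
φ[-q] m = ∑[ i < suc (2 ℕ.* m) ] term (toℕ i ⊖ m) m
  where
  term : ℤ → PowerSeries
  term k = (-1ℤ ^ ∣ k ∣) ·q^ (∣ k ∣ ℕ.^ 2)

-- ψ(-q) = Σ_{k≥0} (-q)^(k(k+1)/2).  Only k ≤ k(k+1)/2 = m contribute to
-- the coefficient of q^m.
ψ[-q] : PowerSeries
ψ[-q] m = ∑[ i < suc m ] term (toℕ i) m
  where
  triangular : ℕ → ℕ
  triangular k = k ℕ.* suc k ℕ./ 2
  term : ℕ → PowerSeries
  term k = (-1ℤ ^ triangular k) ·q^ triangular k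

φ[-q]₀≡1 : φ[-q] 0 ≡ 1ℤ
φ[-q]₀≡1 = refl

ψ[-q]₀≡1 : ψ[-q] 0 ≡ 1ℤ
ψ[-q]₀≡1 = refl

a̅₅ : ℕ → ℤ
a̅₅ = (φ[-q] ⟨q^ 5 ⟩) ^ˢ 5 ÷ φ[-q]

b̅₅ : ℕ → ℤ
b̅₅ = (ψ[-q] ⟨q^ 5 ⟩) ^ˢ 5 ÷ ψ[-q]

_ : tabulate {n = 8} (λ i → a̅₅ (toℕ i)) ≡
    + 1 ∷ + 2 ∷ + 4 ∷ + 8 ∷ + 14 ∷ + 14 ∷ + 20 ∷ + 24 ∷ []
_ = refl

_ : tabulate {n = 11} (λ i → b̅₅ (toℕ i)) ≡
    + 1 ∷ + 1 ∷ + 1 ∷ + 2 ∷ + 3 ∷ -[1+ 0 ] ∷ + 0 ∷ + 2 ∷ + 0 ∷ -[1+ 1 ] ∷ + 6 ∷ []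
_ = refl

{-# OPTIONS --safe #-}
module Submission where

-- Write p, P, r, Q for φ(q), φ(-q), φ(q⁵), φ(-q⁵).  Cutting ℤ² into the cosets of the
-- sublattices spanned by (c, 1) and (1, -c), for c = 1 and 2, gives product identities
-- of theta series, such as pP = φ(-q²)² and p² - r² = 4qMN with M = Σ q^(5x²+4x) and
-- N = Σ q^(5x²+2x), and these imply two polynomial relations K = L = 0 among p, P, r, Q.
-- Modulo K and L, both A = Σ a̅₅(2n)qⁿ and B = q³ψ(-q⁵)⁵/ψ(-q) are rational functions
-- of p, P, r, Q, with odd parts those of (5p³r - 11pr³)/2 and (p³r - 3pr³)/8.
-- The exponents occurring in pr³ are squares modulo 5, so at odd n ≡ ±2 (mod 5)
-- the coefficient of A is 20 times the coefficient of B.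

open import Defs
open import Algebra.Bundles using (CommutativeRing)
import Algebra.Solver.Ring
open import Algebra.Solver.Ring.AlmostCommutativeRing using (fromCommutativeRing; _-Raw-AlmostCommutative⟶_)
open import Algebra.Structures using (IsCommutativeRing)
open import Data.Bool using (true; false)
open import Data.Empty using (⊥-elim)
open import Data.Fin using (Fin; zero; suc; toℕ; opposite)
import Data.Fin.Permutation as Permutation
import Data.Fin.Properties as Fin
open import Data.Integer as ℤ using (ℤ; +_; -[1+_]; 0ℤ; 1ℤ; -1ℤ; ∣_∣)
import Data.Integer.Properties as ℤ
open import Data.Integer.Solver using (module +-*-Solver)
open import Data.Maybe using (map)
open import Data.Nat as ℕ using (ℕ; zero; suc; NonZero; _∸_; z≤n; s≤s)
open import Data.Nat.Divisibility using (_∣_; _∣?_; divides; ∣m∣n⇒∣m+n; ∣-refl)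
open import Data.Nat.DivMod using (m*n/n≡m; m%n<n; %-distribˡ-*; [m+kn]%n≡m%n)
import Data.Nat.Properties as ℕ
import Data.Nat.Solver as ℕ-Solver
open import Data.Product using (_×_; _,_; ∃; proj₁; proj₂)
open import Data.Sum using (_⊎_; inj₁; inj₂)
open import Data.Vec using (Vec; []; _∷_; lookup)
open import Data.Vec.Relation.Binary.Pointwise.Inductive as Pointwise using (Pointwise; []; _∷_)
open import Function using (_∘_; flip)
open import Level using (Level)
open import Relation.Binary.PropositionalEquality
open import Relation.Nullary using (Dec; yes; no; does; ¬_)
open import Relation.Nullary.Decidable.Core using (dec⇒maybe)

open import Algebra.Properties.Semiring.Sum ℤ.+-*-semiring
  using (sum-syntax; sum-cong-≗; ∑-distrib-+; *-distribˡ-sum; ∑-comm; ∑-permute; sum-replicate-zero)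

-- `L` comes from a descent in q: an identity all of whose entries are series in q² may be read with
-- q in place of q². By `K`, the square of pQ + Pr is a polynomial in pP and rQ, which are series in
-- q², so descent evaluates the square of the even part of φ(q)φ(-q⁵). The map q ↦ -q exchanges this
-- even part with that of φ(q)φ(q⁵), because x² + 5y² = 2n forces n ≡ y (mod 2). A second evaluation
-- of the sum of the two squares then yields `L`.
--
-- `K` and `L` alone do not suffice: they also vanish on the lines p = tr, P = tQ with t² = 1 or 5.
-- On these lines Pr - pQ vanishes too, but as a power series it is not zero, and there are no zero
-- divisors, so it can be divided out.
--
-- Rational formulas are stated with denominators multiplied out and then cancelled. Square roots
-- are taken by comparing two equal squares, the lowest coefficient of the sum of the two roots
-- excluding the opposite sign.

module Series where

  open import Data.Integer using (_+_; _-_; _*_; -_; _^_)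

  -- The ring of formal power series.

  infixl 6 _⊕_
  infix  8 ⊖_

  -- A wrapper of _≗_ from which Agda can infer the two series.
  infix 4 _≋_

  record _≋_ (f g : PowerSeries) : Set where
    constructor pointwise
    field at : f ≗ g

  open _≋_ public

  _⊕_ : PowerSeries → PowerSeries → PowerSeries
  (f ⊕ g) n = f n + g n

  ⊖_ : PowerSeries → PowerSeries
  (⊖ f) n = - f n

  0ˢ : PowerSeries
  0ˢ _ = 0ℤ

  const : ℤ → PowerSeries
  const c = c ·q^ 0

  tail : PowerSeries → PowerSeries
  tail f n = f (suc n)

  ⊛-cong : ∀ {f f′ g g′} → f ≗ f′ → g ≗ g′ → f ⊛ g ≗ f′ ⊛ g′
  ⊛-cong f≗f′ g≗g′ n = sum-cong-≗ {suc n} λ i → cong₂ _*_ (f≗f′ (toℕ i)) (g≗g′ (n ∸ toℕ i))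

  ⊛-zeroˡ : ∀ f → 0ˢ ⊛ f ≗ 0ˢ
  ⊛-zeroˡ f n = sum-replicate-zero (suc n)

  ⊛-distribʳ-⊕ : ∀ h f g → (f ⊕ g) ⊛ h ≗ f ⊛ h ⊕ g ⊛ h
  ⊛-distribʳ-⊕ h f g n = trans
    (sum-cong-≗ {suc n} λ i → ℤ.*-distribʳ-+ (h (n ∸ toℕ i)) (f (toℕ i)) (g (toℕ i)))
    (∑-distrib-+ {suc n} (λ i → f (toℕ i) * h (n ∸ toℕ i)) λ i → g (toℕ i) * h (n ∸ toℕ i))

  ⊛-scaleˡ : ∀ c f g → (λ i → c * f i) ⊛ g ≗ λ n → c * (f ⊛ g) n
  ⊛-scaleˡ c f g n = trans
    (sum-cong-≗ {suc n} λ i → ℤ.*-assoc c (f (toℕ i)) (g (n ∸ toℕ i)))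
    (sym (*-distribˡ-sum {suc n} c λ i → f (toℕ i) * g (n ∸ toℕ i)))

  -- By computation `_⊛_` splits off the first term of the convolution; splitting off the last one
  -- as well makes commutativity an induction on the degree.
  ⊛-suc′ : ∀ f g n → (f ⊛ g) (suc n) ≡ (f ⊛ tail g) n + f (suc n) * g 0
  ⊛-suc′ f g zero = solve 4 (λ f₀ g₁ f₁ g₀ →
    f₀ :* g₁ :+ (f₁ :* g₀ :+ con 0ℤ) := f₀ :* g₁ :+ con 0ℤ :+ f₁ :* g₀) refl (f 0) (g 1) (f 1) (g 0)
    where open +-*-Solver
  ⊛-suc′ f g (suc n) = trans
    (cong (λ t → f 0 * g (suc (suc n)) + t) (⊛-suc′ (tail f) g n))
    (sym (ℤ.+-assoc (f 0 * g (suc (suc n))) _ _))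

  ⊛-comm : ∀ f g → f ⊛ g ≗ g ⊛ f
  ⊛-comm f g zero    = cong (_+ 0ℤ) (ℤ.*-comm (f 0) (g 0))
  ⊛-comm f g (suc n) = begin
    (f ⊛ g) (suc n)                    ≡⟨ ⊛-suc′ f g n ⟩
    (f ⊛ tail g) n + f (suc n) * g 0   ≡⟨ cong₂ _+_ (⊛-comm f (tail g) n) (ℤ.*-comm (f (suc n)) (g 0)) ⟩
    (tail g ⊛ f) n + g 0 * f (suc n)   ≡⟨ ℤ.+-comm _ (g 0 * f (suc n)) ⟩
    (g ⊛ f) (suc n)                    ∎
    where open ≡-Reasoning

  ⊛-assoc : ∀ f g h → (f ⊛ g) ⊛ h ≗ f ⊛ (g ⊛ h)
  ⊛-assoc f g h zero = solve 3 (λ a b c →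
    (a :* b :+ con 0ℤ) :* c :+ con 0ℤ := a :* (b :* c :+ con 0ℤ) :+ con 0ℤ) refl (f 0) (g 0) (h 0)
    where open +-*-Solver
  ⊛-assoc f g h (suc n) = begin
    (f 0 * g 0 + 0ℤ) * h (suc n) + (tail (f ⊛ g) ⊛ h) n
      ≡⟨ cong (λ t → (f 0 * g 0 + 0ℤ) * h (suc n) + t) (⊛-distribʳ-⊕ h (λ i → f 0 * tail g i) (tail f ⊛ g) n) ⟩
    (f 0 * g 0 + 0ℤ) * h (suc n) + (((λ i → f 0 * tail g i) ⊛ h) n + ((tail f ⊛ g) ⊛ h) n)
      ≡⟨ cong₂ (λ s t → (f 0 * g 0 + 0ℤ) * h (suc n) + (s + t)) (⊛-scaleˡ (f 0) (tail g) h n) (⊛-assoc (tail f) g h n) ⟩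
    (f 0 * g 0 + 0ℤ) * h (suc n) + (f 0 * (tail g ⊛ h) n + (tail f ⊛ (g ⊛ h)) n)
      ≡⟨ solve 5 (λ a b c s t → (a :* b :+ con 0ℤ) :* c :+ (a :* s :+ t) := a :* (b :* c :+ s) :+ t)
           refl (f 0) (g 0) (h (suc n)) _ _ ⟩
    f 0 * (g 0 * h (suc n) + (tail g ⊛ h) n) + (tail f ⊛ (g ⊛ h)) n ∎
    where
    open ≡-Reasoning
    open +-*-Solver

  const-⊛ : ∀ c f n → (const c ⊛ f) n ≡ c * f n
  const-⊛ c f zero    = ℤ.+-identityʳ (c * f 0)
  const-⊛ c f (suc n) = trans (cong (λ t → c * f (suc n) + t) (⊛-zeroˡ f n)) (ℤ.+-identityʳ _)

  ⊛-identityˡ : ∀ f → const 1ℤ ⊛ f ≗ f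
  ⊛-identityˡ f n = trans (const-⊛ 1ℤ f n) (ℤ.*-identityˡ (f n))

  -- Multiplication is sealed off, so that the type checker does not unfold
  -- nested convolutions when it compares ring expressions.
  infixl 7 _✶_

  opaque
    _✶_ : PowerSeries → PowerSeries → PowerSeries
    _✶_ = _⊛_

    ✶-isCommutativeRing : IsCommutativeRing _≋_ _⊕_ _✶_ ⊖_ 0ˢ (const 1ℤ)
    ✶-isCommutativeRing = record
      { isRing = record
        { +-isAbelianGroup = record
          { isGroup = record
            { isMonoid = record
              { isSemigroup = record
                { isMagma = record
                  { isEquivalence = record
                    { refl  = pointwise λ _ → refl
                    ; sym   = λ f≋g → pointwise λ n → sym (at f≋g n)
                    ; trans = λ f≋g g≋h → pointwise λ n → trans (at f≋g n) (at g≋h n)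
                    }
                  ; ∙-cong = λ f≋f′ g≋g′ → pointwise λ n → cong₂ _+_ (at f≋f′ n) (at g≋g′ n)
                  }
                ; assoc = λ f g h → pointwise λ n → ℤ.+-assoc (f n) (g n) (h n)
                }
              ; identity = (λ f → pointwise λ n → ℤ.+-identityˡ (f n)) , λ f → pointwise λ n → ℤ.+-identityʳ (f n)
              }
            ; inverse = (λ f → pointwise λ n → ℤ.+-inverseˡ (f n)) , λ f → pointwise λ n → ℤ.+-inverseʳ (f n)
            ; ⁻¹-cong = λ f≋g → pointwise λ n → cong -_ (at f≋g n)
            }
          ; comm = λ f g → pointwise λ n → ℤ.+-comm (f n) (g n)
          }
        ; *-cong           = λ f≋f′ g≋g′ → pointwise (⊛-cong (at f≋f′) (at g≋g′))
        ; *-assoc          = λ f g h → pointwise (⊛-assoc f g h)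
        ; *-identity       = (λ f → pointwise (⊛-identityˡ f))
                             , λ f → pointwise λ n → trans (⊛-comm f (const 1ℤ) n) (⊛-identityˡ f n)
        ; distrib          = (λ h f g → pointwise λ n → trans (⊛-comm h (f ⊕ g) n)
                               (trans (⊛-distribʳ-⊕ h f g n) (cong₂ _+_ (⊛-comm f h n) (⊛-comm g h n))))
                             , λ h f g → pointwise (⊛-distribʳ-⊕ h f g)
        }
      ; *-comm = λ f g → pointwise (⊛-comm f g)
      }

  powerSeriesRing : CommutativeRing _ _
  powerSeriesRing = record { isCommutativeRing = ✶-isCommutativeRing }

  module Ring = CommutativeRing powerSeriesRing

  x : PowerSeries
  x = 1ℤ ·q^ 1

  x⊛-suc : ∀ f n → (x ⊛ f) (suc n) ≡ f n
  x⊛-suc f n = trans (ℤ.+-identityˡ _) (⊛-identityˡ f n)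

  ⊛-split : ∀ f → f ≗ const (f 0) ⊕ x ⊛ tail f
  ⊛-split f zero    = sym (ℤ.+-identityʳ (f 0))
  ⊛-split f (suc n) = sym (trans (ℤ.+-identityˡ _) (x⊛-suc (tail f) n))

  -- Here `k` is the order of `f`. The zeros below it are removed one `tail` at a time; once `f 0`
  -- is nonzero, coefficient n of the product is `f 0 * g n` plus terms in earlier coefficients of
  -- `g`, and strong induction applies.
  ⊛-cancelˡ-0 : ∀ k f g → (∀ i → i ℕ.< k → f i ≡ 0ℤ) → f k ≢ 0ℤ → f ⊛ g ≗ 0ˢ → g ≗ 0ˢ
  ⊛-cancelˡ-0 (suc k) f g low lead fg≗0 = ⊛-cancelˡ-0 k (tail f) g (λ i i<k → low (suc i) (s≤s i<k)) lead λ n → begin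
    (tail f ⊛ g) n                        ≡⟨ ℤ.+-identityˡ _ ⟨
    0ℤ * g (suc n) + (tail f ⊛ g) n       ≡⟨ cong (λ c → c * g (suc n) + (tail f ⊛ g) n) (low 0 (s≤s z≤n)) ⟨
    f 0 * g (suc n) + (tail f ⊛ g) n      ≡⟨ fg≗0 (suc n) ⟩
    0ℤ                                    ∎
    where open ≡-Reasoning
  ⊛-cancelˡ-0 zero f g low f₀≢0 fg≗0 n = vanish (suc n) n ℕ.≤-refl
    where
    open ≡-Reasoning
    vanish : ∀ N n → n ℕ.< N → g n ≡ 0ℤ
    vanish (suc N) n (s≤s n≤N) with ℤ.i*j≡0⇒i≡0∨j≡0 (f 0) f₀gₙ≡0
      where
      f₀gₙ≡0 : f 0 * g n ≡ 0ℤ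
      f₀gₙ≡0 = begin
        f 0 * g n                                     ≡⟨ ℤ.+-identityʳ _ ⟨
        f 0 * g n + 0ℤ                                ≡⟨ cong (λ t → f 0 * g n + t) (sum-replicate-zero n) ⟨
        f 0 * g n + ∑[ i < n ] 0ℤ                     ≡⟨ cong (λ t → f 0 * g n + t) (sum-cong-≗ {n} λ i → sym (trans
                                                           (cong (f (suc (toℕ i)) *_) (vanish N (n ∸ suc (toℕ i)) (later i)))
                                                           (ℤ.*-zeroʳ (f (suc (toℕ i)))))) ⟩
        (f ⊛ g) n                                     ≡⟨ fg≗0 n ⟩
        0ℤ                                            ∎
        where
        later : (i : Fin n) → n ∸ suc (toℕ i) ℕ.< N
        later i = ℕ.<-≤-trans (ℕ.∸-monoʳ-< {n} {suc (toℕ i)} {0} (s≤s z≤n) (Data.Fin.Properties.toℕ<n i)) n≤N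
          where import Data.Fin.Properties
    ... | inj₁ f₀≡0 = ⊥-elim (f₀≢0 f₀≡0)
    ... | inj₂ gₙ≡0 = gₙ≡0

  -- The substitutions q ↦ -q and q ↦ q^d.

  neg : PowerSeries → PowerSeries
  neg f n = -1ℤ ^ n * f n

  neg-cong : ∀ {f g} → f ≗ g → neg f ≗ neg g
  neg-cong f≗g n = cong (-1ℤ ^ n *_) (f≗g n)

  neg-⊕ : ∀ f g → neg (f ⊕ g) ≗ neg f ⊕ neg g
  neg-⊕ f g n = ℤ.*-distribˡ-+ (-1ℤ ^ n) (f n) (g n)

  neg-⊖ : ∀ f → neg (⊖ f) ≗ ⊖ neg f
  neg-⊖ f n = sym (ℤ.neg-distribʳ-* (-1ℤ ^ n) (f n))

  neg-⊛ : ∀ f g → neg (f ⊛ g) ≗ neg f ⊛ neg g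
  neg-⊛ f g zero    = solve 2 (λ a b → con 1ℤ :* (a :* b :+ con 0ℤ) := con 1ℤ :* a :* (con 1ℤ :* b) :+ con 0ℤ) refl (f 0) (g 0)
    where open +-*-Solver
  neg-⊛ f g (suc n) = begin
    -1ℤ * -1ℤ ^ n * (f 0 * g (suc n) + (tail f ⊛ g) n)
      ≡⟨ solve 4 (λ s a b c → con -1ℤ :* s :* (a :* b :+ c) := con 1ℤ :* a :* (con -1ℤ :* s :* b) :+ con -1ℤ :* (s :* c))
           refl (-1ℤ ^ n) (f 0) (g (suc n)) _ ⟩
    1ℤ * f 0 * (-1ℤ * -1ℤ ^ n * g (suc n)) + -1ℤ * neg (tail f ⊛ g) n
      ≡⟨ cong (λ t → 1ℤ * f 0 * neg g (suc n) + -1ℤ * t) (neg-⊛ (tail f) g n) ⟩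
    1ℤ * f 0 * neg g (suc n) + -1ℤ * (neg (tail f) ⊛ neg g) n
      ≡⟨ cong (λ t → 1ℤ * f 0 * neg g (suc n) + t) (⊛-scaleˡ -1ℤ (neg (tail f)) (neg g) n) ⟨
    1ℤ * f 0 * neg g (suc n) + ((λ i → -1ℤ * neg (tail f) i) ⊛ neg g) n
      ≡⟨ cong (λ t → 1ℤ * f 0 * neg g (suc n) + t)
           (⊛-cong {g = neg g} (λ i → sym (ℤ.*-assoc -1ℤ (-1ℤ ^ i) (f (suc i)))) (λ _ → refl) n) ⟩
    (neg f ⊛ neg g) (suc n) ∎
    where
    open ≡-Reasoning
    open +-*-Solver

  -1²ⁿ≡1 : ∀ n → -1ℤ ^ (n ℕ.+ n) ≡ 1ℤ
  -1²ⁿ≡1 n = trans (ℤ.^-distribˡ-+-* -1ℤ n n) (square n)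
    where
    square : ∀ n → -1ℤ ^ n * -1ℤ ^ n ≡ 1ℤ
    square zero    = refl
    square (suc n) = trans (solve 1 (λ s → con -1ℤ :* s :* (con -1ℤ :* s) := s :* s) refl (-1ℤ ^ n)) (square n)
      where open +-*-Solver

  neg-involutive : ∀ f → neg (neg f) ≗ f
  neg-involutive f n = begin
    -1ℤ ^ n * (-1ℤ ^ n * f n)   ≡⟨ ℤ.*-assoc (-1ℤ ^ n) (-1ℤ ^ n) (f n) ⟨
    -1ℤ ^ n * -1ℤ ^ n * f n     ≡⟨ cong (_* f n) (trans (sym (ℤ.^-distribˡ-+-* -1ℤ n n)) (-1²ⁿ≡1 n)) ⟩
    1ℤ * f n                    ≡⟨ ℤ.*-identityˡ (f n) ⟩
    f n                         ∎
    where open ≡-Reasoning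

  module _ {d : ℕ} .{{_ : NonZero d}} where

    stretch-* : ∀ f k → (f ⟨q^ d ⟩) (k ℕ.* d) ≡ f k
    stretch-* f k with d ∣? k ℕ.* d
    ... | yes (divides j kd≡jd) = cong f (sym (ℕ.*-cancelʳ-≡ k j d kd≡jd))
    ... | no  d∤kd              = ⊥-elim (d∤kd (divides k refl))

    stretch-∤ : ∀ f {n} → ¬ d ∣ n → (f ⟨q^ d ⟩) n ≡ 0ℤ
    stretch-∤ f {n} d∤n with d ∣? n
    ... | yes d∣n = ⊥-elim (d∤n d∣n)
    ... | no  _   = refl

    -- Lets a series built in some other way be recognised as a stretched one from its values at
    -- multiples of `d` and elsewhere, without following the divisibility test inside `_⟨q^_⟩`.
    stretch-unique : ∀ f {h} → (∀ k → h (k ℕ.* d) ≡ f k) → (∀ {n} → ¬ d ∣ n → h n ≡ 0ℤ) → h ≗ f ⟨q^ d ⟩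
    stretch-unique f h-* h-∤ n with d ∣? n
    ... | yes (divides k refl) = h-* k
    ... | no  d∤n              = h-∤ d∤n

    stretch-cong : ∀ {f g} → f ≗ g → f ⟨q^ d ⟩ ≗ g ⟨q^ d ⟩
    stretch-cong f≗g n with d ∣? n
    ... | yes (divides k _) = f≗g k
    ... | no  _             = refl

    stretch-injective : ∀ {f g} → f ⟨q^ d ⟩ ≗ g ⟨q^ d ⟩ → f ≗ g
    stretch-injective {f} {g} eq k = trans (sym (stretch-* f k)) (trans (eq (k ℕ.* d)) (stretch-* g k))

    stretch-⊕ : ∀ f g → (f ⊕ g) ⟨q^ d ⟩ ≗ f ⟨q^ d ⟩ ⊕ g ⟨q^ d ⟩
    stretch-⊕ f g n with d ∣? n
    ... | yes _ = refl
    ... | no  _ = refl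

    stretch-⊖ : ∀ f → (⊖ f) ⟨q^ d ⟩ ≗ ⊖ f ⟨q^ d ⟩
    stretch-⊖ f n with d ∣? n
    ... | yes _ = refl
    ... | no  _ = refl

  ^-⊛-< : ∀ c a f {n} → n ℕ.< a → ((c ·q^ a) ⊛ f) n ≡ 0ℤ
  ^-⊛-< c (suc a) f {zero}  _         = refl
  ^-⊛-< c (suc a) f {suc n} (s≤s n<a) = trans (ℤ.+-identityˡ _) (^-⊛-< c a f n<a)

  ^-⊛-+ : ∀ c a f m → ((c ·q^ a) ⊛ f) (a ℕ.+ m) ≡ c * f m
  ^-⊛-+ c zero    f m = const-⊛ c f m
  ^-⊛-+ c (suc a) f m = trans (ℤ.+-identityˡ _) (^-⊛-+ c a f m)

  ^-scale : ∀ c d b n → c * (d ·q^ b) n ≡ ((c * d) ·q^ b) n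
  ^-scale c d b n with does (n ℕ.≟ b)
  ... | true  = refl
  ... | false = ℤ.*-zeroʳ c

  ^-⊛-^ : ∀ c a d b → (c ·q^ a) ⊛ (d ·q^ b) ≗ (c * d) ·q^ (a ℕ.+ b)
  ^-⊛-^ c zero    d b n       = trans (const-⊛ c (d ·q^ b) n) (^-scale c d b n)
  ^-⊛-^ c (suc a) d b zero    = refl
  ^-⊛-^ c (suc a) d b (suc n) = trans (ℤ.+-identityˡ _) (^-⊛-^ c a d b n)

  module _ {d : ℕ} .{{_ : NonZero d}} where

    stretch-const : ∀ c → const c ⟨q^ d ⟩ ≗ const c
    stretch-const c n = sym (stretch-unique (const c) on-* off-* n)
      where
      on-* : ∀ k → const c (k ℕ.* d) ≡ const c k
      on-* zero    = refl
      on-* (suc k) = above (ℕ.<-≤-trans (ℕ.>-nonZero⁻¹ d) (ℕ.m≤m+n d (k ℕ.* d)))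
        where
        above : ∀ {n} → 0 ℕ.< n → const c n ≡ 0ℤ
        above (s≤s _) = refl
      off-* : ∀ {n} → ¬ d ∣ n → const c n ≡ 0ℤ
      off-* {zero}  d∤0 = ⊥-elim (d∤0 (divides 0 refl))
      off-* {suc n} _   = refl

    stretch-x⊛ : ∀ f → (x ⊛ f) ⟨q^ d ⟩ ≗ (1ℤ ·q^ d) ⊛ f ⟨q^ d ⟩
    stretch-x⊛ f n = sym (stretch-unique (x ⊛ f) on-* off-* n)
      where
      on-* : ∀ k → ((1ℤ ·q^ d) ⊛ f ⟨q^ d ⟩) (k ℕ.* d) ≡ (x ⊛ f) k
      on-* zero    = ^-⊛-< 1ℤ d (f ⟨q^ d ⟩) (ℕ.>-nonZero⁻¹ d)
      on-* (suc k) = begin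
        ((1ℤ ·q^ d) ⊛ f ⟨q^ d ⟩) (d ℕ.+ k ℕ.* d)   ≡⟨ ^-⊛-+ 1ℤ d (f ⟨q^ d ⟩) (k ℕ.* d) ⟩
        1ℤ * (f ⟨q^ d ⟩) (k ℕ.* d)                 ≡⟨ ℤ.*-identityˡ _ ⟩
        (f ⟨q^ d ⟩) (k ℕ.* d)                      ≡⟨ stretch-* f k ⟩
        f k                                        ≡⟨ x⊛-suc f k ⟨
        (x ⊛ f) (suc k)                            ∎
        where open ≡-Reasoning
      off-* : ∀ {n} → ¬ d ∣ n → ((1ℤ ·q^ d) ⊛ f ⟨q^ d ⟩) n ≡ 0ℤ
      off-* {n} d∤n with n ℕ.<? d
      ... | yes n<d = ^-⊛-< 1ℤ d (f ⟨q^ d ⟩) n<d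
      ... | no  n≮d = begin
        ((1ℤ ·q^ d) ⊛ f ⟨q^ d ⟩) n                  ≡⟨ cong ((1ℤ ·q^ d) ⊛ f ⟨q^ d ⟩) d+m≡n ⟨
        ((1ℤ ·q^ d) ⊛ f ⟨q^ d ⟩) (d ℕ.+ (n ∸ d))    ≡⟨ ^-⊛-+ 1ℤ d (f ⟨q^ d ⟩) (n ∸ d) ⟩
        1ℤ * (f ⟨q^ d ⟩) (n ∸ d)                    ≡⟨ ℤ.*-identityˡ _ ⟩
        (f ⟨q^ d ⟩) (n ∸ d)                         ≡⟨ stretch-∤ f (λ d∣m → d∤n (subst (d ∣_) d+m≡n (∣m∣n⇒∣m+n ∣-refl d∣m))) ⟩
        0ℤ                                          ∎
        where
        open ≡-Reasoning
        d+m≡n : d ℕ.+ (n ∸ d) ≡ n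
        d+m≡n = ℕ.m+[n∸m]≡n (ℕ.≮⇒≥ n≮d)

    opaque
      unfolding _✶_

      -- Writing f as f₀ + q · `tail f` shows that both sides obey the recursion h(f) = f₀ · g(q^d)
      -- + q^d · h(`tail f`); these are `lhs` and `rhs`. Since `d` is positive, the factor q^d
      -- lowers the degree, so the sides agree by strong induction.
      stretch-✶ : ∀ f g → (f ✶ g) ⟨q^ d ⟩ ≋ f ⟨q^ d ⟩ ✶ g ⟨q^ d ⟩
      stretch-✶ f g = pointwise λ n → below (suc n) f g n ℕ.≤-refl
        where
        open Ring using (+-cong; +-congˡ; *-congʳ; *-assoc; distribʳ)
        infixr 2 _⨾_
        _⨾_ : ∀ {f g h} → f ≋ g → g ≋ h → f ≋ h
        _⨾_ = Ring.trans
        X : PowerSeries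
        X = 1ℤ ·q^ d
        split : ∀ f → f ⟨q^ d ⟩ ≋ const (f 0) ⊕ X ⊛ tail f ⟨q^ d ⟩
        split f = pointwise (stretch-cong (⊛-split f))
                  ⨾ pointwise (stretch-⊕ (const (f 0)) (x ⊛ tail f))
                  ⨾ +-cong (pointwise (stretch-const (f 0))) (pointwise (stretch-x⊛ (tail f)))
        scaled : ∀ c g → (const c ⊛ g) ⟨q^ d ⟩ ≗ const c ⊛ g ⟨q^ d ⟩
        scaled c g n = trans (stretch-cong (const-⊛ c g) n) (trans coefficient (sym (const-⊛ c (g ⟨q^ d ⟩) n)))
          where
          coefficient : ((λ i → c * g i) ⟨q^ d ⟩) n ≡ c * (g ⟨q^ d ⟩) n
          coefficient with d ∣? n
          ... | yes _ = refl
          ... | no  _ = sym (ℤ.*-zeroʳ c)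
        lhs : ∀ f g → (f ⊛ g) ⟨q^ d ⟩ ≋ const (f 0) ⊛ g ⟨q^ d ⟩ ⊕ X ⊛ (tail f ⊛ g) ⟨q^ d ⟩
        lhs f g = pointwise (stretch-cong (at (*-congʳ {g} (pointwise (⊛-split f))
                                               ⨾ distribʳ g (const (f 0)) (x ⊛ tail f)
                                               ⨾ +-congˡ {const (f 0) ⊛ g} (*-assoc x (tail f) g))))
                  ⨾ pointwise (stretch-⊕ (const (f 0) ⊛ g) (x ⊛ (tail f ⊛ g)))
                  ⨾ +-cong (pointwise (scaled (f 0) g)) (pointwise (stretch-x⊛ (tail f ⊛ g)))
        rhs : ∀ f g → f ⟨q^ d ⟩ ⊛ g ⟨q^ d ⟩ ≋ const (f 0) ⊛ g ⟨q^ d ⟩ ⊕ X ⊛ (tail f ⟨q^ d ⟩ ⊛ g ⟨q^ d ⟩)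
        rhs f g = *-congʳ {g ⟨q^ d ⟩} (split f)
                  ⨾ distribʳ (g ⟨q^ d ⟩) (const (f 0)) (X ⊛ tail f ⟨q^ d ⟩)
                  ⨾ +-congˡ {const (f 0) ⊛ g ⟨q^ d ⟩} (*-assoc X (tail f ⟨q^ d ⟩) (g ⟨q^ d ⟩))
        below : ∀ N f g n → n ℕ.< N → ((f ⊛ g) ⟨q^ d ⟩) n ≡ (f ⟨q^ d ⟩ ⊛ g ⟨q^ d ⟩) n
        below (suc N) f g n (s≤s n≤N) =
          trans (at (lhs f g) n) (trans (cong (λ t → (const (f 0) ⊛ g ⟨q^ d ⟩) n + t) rest) (sym (at (rhs f g) n)))
          where
          l r : PowerSeries
          l = (tail f ⊛ g) ⟨q^ d ⟩
          r = tail f ⟨q^ d ⟩ ⊛ g ⟨q^ d ⟩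
          rest : (X ⊛ l) n ≡ (X ⊛ r) n
          rest with n ℕ.<? d
          ... | yes n<d = trans (^-⊛-< 1ℤ d l n<d) (sym (^-⊛-< 1ℤ d r n<d))
          ... | no  n≮d = subst (λ n → (X ⊛ l) n ≡ (X ⊛ r) n) (ℕ.m+[n∸m]≡n (ℕ.≮⇒≥ n≮d))
            (trans (^-⊛-+ 1ℤ d l (n ∸ d))
              (trans (cong (1ℤ *_) (below N (tail f) g (n ∸ d) n∸d<N)) (sym (^-⊛-+ 1ℤ d r (n ∸ d)))))
            where
            n∸d<N : n ∸ d ℕ.< N
            n∸d<N = ℕ.<-≤-trans (ℕ.∸-monoʳ-< (ℕ.>-nonZero⁻¹ d) (ℕ.≮⇒≥ n≮d)) n≤N

  neg-stretch² : ∀ f → neg (f ⟨q^ 2 ⟩) ≗ f ⟨q^ 2 ⟩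
  neg-stretch² f = stretch-unique f
    (λ k → trans (cong₂ _*_ (trans (cong (-1ℤ ^_) (2k k)) (-1²ⁿ≡1 k)) (stretch-* f k)) (ℤ.*-identityˡ (f k)))
    λ {n} 2∤n → trans (cong (-1ℤ ^ n *_) (stretch-∤ f 2∤n)) (ℤ.*-zeroʳ (-1ℤ ^ n))
    where
    2k : ∀ k → k ℕ.* 2 ≡ k ℕ.+ k
    2k k = trans (ℕ.*-comm k 2) (cong (k ℕ.+_) (ℕ.+-identityʳ k))

  even : PowerSeries → PowerSeries
  even f k = f (k ℕ.* 2)

  stretch²-even : ∀ f → const (+ 2) ⊛ even f ⟨q^ 2 ⟩ ≗ f ⊕ neg f
  stretch²-even f n = trans (const-⊛ (+ 2) (even f ⟨q^ 2 ⟩) n) (helper (2 ∣? n))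
    where
    open ≡-Reasoning
    odd : ∀ n → ¬ 2 ∣ n → -1ℤ ^ n ≡ -1ℤ
    odd zero          2∤0 = ⊥-elim (2∤0 (divides 0 refl))
    odd (suc zero)    _   = refl
    odd (suc (suc n)) 2∤n = trans (sym (ℤ.*-assoc -1ℤ -1ℤ (-1ℤ ^ n)))
      (trans (ℤ.*-identityˡ (-1ℤ ^ n)) (odd n λ 2∣n → 2∤n (∣m∣n⇒∣m+n ∣-refl 2∣n)))
    helper : Dec (2 ∣ n) → + 2 * (even f ⟨q^ 2 ⟩) n ≡ f n + neg f n
    helper (yes (divides k refl)) = begin
      + 2 * (even f ⟨q^ 2 ⟩) (k ℕ.* 2)           ≡⟨ cong (+ 2 *_) (stretch-* (even f) k) ⟩
      + 2 * f (k ℕ.* 2)                          ≡⟨ solve 1 (λ a → con (+ 2) :* a := a :+ con 1ℤ :* a) refl (f (k ℕ.* 2)) ⟩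
      f (k ℕ.* 2) + 1ℤ * f (k ℕ.* 2)             ≡⟨ cong (λ s → f (k ℕ.* 2) + s * f (k ℕ.* 2))
                                                      (trans (cong (-1ℤ ^_) (trans (ℕ.*-comm k 2) (cong (k ℕ.+_) (ℕ.+-identityʳ k)))) (-1²ⁿ≡1 k)) ⟨
      f (k ℕ.* 2) + -1ℤ ^ (k ℕ.* 2) * f (k ℕ.* 2) ∎
      where open +-*-Solver
    helper (no 2∤n) = begin
      + 2 * (even f ⟨q^ 2 ⟩) n   ≡⟨ cong (+ 2 *_) (stretch-∤ (even f) 2∤n) ⟩
      0ℤ                         ≡⟨ solve 1 (λ a → con 0ℤ := a :+ con -1ℤ :* a) refl (f n) ⟩
      f n + -1ℤ * f n            ≡⟨ cong (λ s → f n + s * f n) (odd n 2∤n) ⟨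
      f n + -1ℤ ^ n * f n        ∎
      where open +-*-Solver

open Series

-- Finitely supported sums over ℤ and ℤ².

module LatticeSums where

  open import Data.Integer using (_+_; _-_; _*_; -_; _^_)

  ∑-cong : ∀ n {f g : ℕ → ℤ} → (∀ i → i ℕ.< n → f i ≡ g i) → ∑[ i < n ] f (toℕ i) ≡ ∑[ i < n ] g (toℕ i)
  ∑-cong n f≗g = sum-cong-≗ {n} λ i → f≗g (toℕ i) (Fin.toℕ<n i)

  ∑-zero : ∀ n {t : Fin n → ℤ} → (∀ i → t i ≡ 0ℤ) → ∑[ i < n ] t i ≡ 0ℤ
  ∑-zero n t≗0 = trans (sum-cong-≗ {n} t≗0) (sum-replicate-zero n)

  ∑-extend : ∀ {B B′} (f : ℕ → ℤ) → B ℕ.≤ B′ → (∀ n → B ℕ.≤ n → f n ≡ 0ℤ) →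
             ∑[ i < B′ ] f (toℕ i) ≡ ∑[ i < B ] f (toℕ i)
  ∑-extend {B′ = B′} f z≤n f≗0 = ∑-zero B′ λ i → f≗0 (toℕ i) z≤n
  ∑-extend f (s≤s B≤B′) f≗0 = cong (λ t → f 0 + t) (∑-extend (f ∘ suc) B≤B′ λ n B≤n → f≗0 (suc n) (s≤s B≤n))

  ∑-++ : ∀ a b (f : ℕ → ℤ) → ∑[ i < a ℕ.+ b ] f (toℕ i) ≡ ∑[ i < a ] f (toℕ i) + ∑[ i < b ] f (a ℕ.+ toℕ i)
  ∑-++ zero    b f = sym (ℤ.+-identityˡ _)
  ∑-++ (suc a) b f = trans (cong (λ t → f 0 + t) (∑-++ a b (f ∘ suc))) (sym (ℤ.+-assoc (f 0) _ _))

  ∑-blocks : ∀ d B (f : ℕ → ℤ) → ∑[ i < B ℕ.* d ] f (toℕ i) ≡ ∑[ m < B ] ∑[ k < d ] f (toℕ m ℕ.* d ℕ.+ toℕ k)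
  ∑-blocks d zero    f = refl
  ∑-blocks d (suc B) f = begin
    ∑[ i < d ℕ.+ B ℕ.* d ] f (toℕ i)
      ≡⟨ ∑-++ d (B ℕ.* d) f ⟩
    ∑[ k < d ] f (toℕ k) + ∑[ i < B ℕ.* d ] f (d ℕ.+ toℕ i)
      ≡⟨ cong (λ t → ∑[ k < d ] f (toℕ k) + t) (∑-blocks d B (f ∘ (d ℕ.+_))) ⟩
    ∑[ k < d ] f (toℕ k) + ∑[ m < B ] ∑[ k < d ] f (d ℕ.+ (toℕ m ℕ.* d ℕ.+ toℕ k))
      ≡⟨ cong (λ t → ∑[ k < d ] f (toℕ k) + t) (sum-cong-≗ {B} λ m → sum-cong-≗ {d} λ k →
           cong f (sym (ℕ.+-assoc d (toℕ m ℕ.* d) (toℕ k)))) ⟩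
    ∑[ m < suc B ] ∑[ k < d ] f (toℕ m ℕ.* d ℕ.+ toℕ k) ∎
    where open ≡-Reasoning

  -- The sum over -B ≤ x < B.
  ∑ℤ : ℕ → (ℤ → ℤ) → ℤ
  ∑ℤ B F = ∑[ n < B ] F (+ toℕ n) + ∑[ n < B ] F -[1+ toℕ n ]

  ∑ℤ-cong : ∀ B {F G : ℤ → ℤ} → F ≗ G → ∑ℤ B F ≡ ∑ℤ B G
  ∑ℤ-cong B F≗G = cong₂ _+_ (sum-cong-≗ {B} λ n → F≗G (+ toℕ n)) (sum-cong-≗ {B} λ n → F≗G -[1+ toℕ n ])

  ∑ℤ-zero : ∀ B {F : ℤ → ℤ} → (∀ x → F x ≡ 0ℤ) → ∑ℤ B F ≡ 0ℤ
  ∑ℤ-zero B F≗0 = cong₂ _+_ (∑-zero B λ n → F≗0 (+ toℕ n)) (∑-zero B λ n → F≗0 -[1+ toℕ n ])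

  ∑ℤ-+ : ∀ B (F G : ℤ → ℤ) → ∑ℤ B (λ x → F x + G x) ≡ ∑ℤ B F + ∑ℤ B G
  ∑ℤ-+ B F G = trans
    (cong₂ _+_ (∑-distrib-+ {B} (λ n → F (+ toℕ n)) (λ n → G (+ toℕ n)))
               (∑-distrib-+ {B} (λ n → F -[1+ toℕ n ]) (λ n → G -[1+ toℕ n ])))
    (solve 4 (λ a b c d → (a :+ b) :+ (c :+ d) := (a :+ c) :+ (b :+ d)) refl
      (∑[ n < B ] F (+ toℕ n)) (∑[ n < B ] G (+ toℕ n)) (∑[ n < B ] F -[1+ toℕ n ]) (∑[ n < B ] G -[1+ toℕ n ]))
    where open +-*-Solver

  ∑ℤ-∑-comm : ∀ B n (F : ℤ → Fin n → ℤ) → ∑ℤ B (λ x → ∑[ i < n ] F x i) ≡ ∑[ i < n ] ∑ℤ B (λ x → F x i)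
  ∑ℤ-∑-comm B n F = trans
    (cong₂ _+_ (∑-comm {B} {n} (F ∘ +_ ∘ toℕ)) (∑-comm {B} {n} (F ∘ -[1+_] ∘ toℕ)))
    (sym (∑-distrib-+ {n} (λ i → ∑[ m < B ] F (+ toℕ m) i) (λ i → ∑[ m < B ] F -[1+ toℕ m ] i)))

  ∑ℤ-comm : ∀ B (F : ℤ → ℤ → ℤ) → ∑ℤ B (λ x → ∑ℤ B (F x)) ≡ ∑ℤ B (λ y → ∑ℤ B (λ x → F x y))
  ∑ℤ-comm B F = trans (∑ℤ-+ B (λ x → ∑[ n < B ] F x (+ toℕ n)) (λ x → ∑[ n < B ] F x -[1+ toℕ n ]))
    (cong₂ _+_ (∑ℤ-∑-comm B B (λ x n → F x (+ toℕ n))) (∑ℤ-∑-comm B B (λ x n → F x -[1+ toℕ n ])))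

  ∑ℤ-scale : ∀ B c (F : ℤ → ℤ) → ∑ℤ B (λ x → c * F x) ≡ c * ∑ℤ B F
  ∑ℤ-scale B c F = trans
    (sym (cong₂ _+_ (*-distribˡ-sum {B} c (λ n → F (+ toℕ n))) (*-distribˡ-sum {B} c (λ n → F -[1+ toℕ n ]))))
    (sym (ℤ.*-distribˡ-+ c (∑[ n < B ] F (+ toℕ n)) (∑[ n < B ] F -[1+ toℕ n ])))

  infix 4 _sums_

  -- The window is part of the evidence and not of the type, so that sums over ℤ can be translated,
  -- reflected and regrouped without fixing a common window in advance.
  record _sums_ (F : ℤ → ℤ) (s : ℤ) : Set where
    constructor sums-to
    field
      bound   : ℕ
      vanish  : ∀ x → bound ℕ.≤ ∣ x ∣ → F x ≡ 0ℤ
      ∑-bound : ∑ℤ bound F ≡ s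

    -- The two halves may have different lengths because a translation lengthens one of them and
    -- shortens the other.
    ∑-halves : ∀ {B B′} → bound ℕ.≤ B → bound ℕ.≤ B′ → ∑[ n < B ] F (+ toℕ n) + ∑[ n < B′ ] F -[1+ toℕ n ] ≡ s
    ∑-halves b≤B b≤B′ = trans
      (cong₂ _+_ (∑-extend (F ∘ +_) b≤B λ n b≤n → vanish (+ n) b≤n)
                 (∑-extend (F ∘ -[1+_]) b≤B′ λ n b≤n → vanish -[1+ n ] (ℕ.m≤n⇒m≤1+n b≤n)))
      ∑-bound

    ∑-above : ∀ {B} → bound ℕ.≤ B → ∑ℤ B F ≡ s
    ∑-above b≤B = ∑-halves b≤B b≤B

  open _sums_

  private variable
    F G : ℤ → ℤ
    s t : ℤ

  sums-unique : F sums s → F sums t → s ≡ t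
  sums-unique p q = trans (sym (∑-above p (ℕ.m≤m⊔n (bound p) (bound q)))) (∑-above q (ℕ.m≤n⊔m (bound p) (bound q)))

  sums-cong : F ≗ G → F sums s → G sums s
  sums-cong F≗G p = sums-to (bound p) (λ x b≤x → trans (sym (F≗G x)) (vanish p x b≤x))
    (trans (sym (∑ℤ-cong (bound p) F≗G)) (∑-bound p))

  sums-zero : (∀ x → F x ≡ 0ℤ) → F sums 0ℤ
  sums-zero F≗0 = sums-to 0 (λ x _ → F≗0 x) refl

  sums-+ : F sums s → G sums t → (λ x → F x + G x) sums (s + t)
  sums-+ {F = F} {G = G} p q = sums-to B
    (λ x B≤x → cong₂ _+_ (vanish p x (ℕ.m⊔n≤o⇒m≤o (bound p) (bound q) B≤x)) (vanish q x (ℕ.m⊔n≤o⇒n≤o (bound p) (bound q) B≤x)))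
    (trans (∑ℤ-+ B F G) (cong₂ _+_ (∑-above p (ℕ.m≤m⊔n (bound p) (bound q))) (∑-above q (ℕ.m≤n⊔m (bound p) (bound q)))))
    where
    B : ℕ
    B = bound p ℕ.⊔ bound q

  sums-scale : ∀ c → F sums s → (λ x → c * F x) sums (c * s)
  sums-scale {F} c p = sums-to (bound p) (λ x b≤x → trans (cong (c *_) (vanish p x b≤x)) (ℤ.*-zeroʳ c))
    (trans (∑ℤ-scale (bound p) c F) (cong (c *_) (∑-bound p)))

  sums-∑ : ∀ {n} {F : ℤ → Fin n → ℤ} {s : Fin n → ℤ} → (∀ i → (λ x → F x i) sums s i) →
           (λ x → ∑[ i < n ] F x i) sums (∑[ i < n ] s i)
  sums-∑ {zero}  p = sums-zero λ _ → refl
  sums-∑ {suc n} p = sums-+ (p zero) (sums-∑ (p ∘ suc))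

  -- This reflection exchanges the two constructors of ℤ and therefore maps every window -B ≤ x < B
  -- to itself, which negation does not.
  ~_ : ℤ → ℤ
  ~ (+ n)    = -[1+ n ]
  ~ -[1+ n ] = + n

  ~≡-1- : ∀ x → ~ x ≡ -1ℤ - x
  ~≡-1- (+ zero)  = refl
  ~≡-1- (+ suc n) = refl
  ~≡-1- -[1+ n ]  = sym (ℤ.⊖-≥ (s≤s (z≤n {n})))

  sums-~ : F sums s → (F ∘ ~_) sums s
  sums-~ {F} p = sums-to (suc (bound p))
    (λ { (+ n)    b<n → vanish p -[1+ n ] (ℕ.<⇒≤ (ℕ.m≤n⇒m≤1+n b<n))
       ; -[1+ n ] b<n → vanish p (+ n) (ℕ.≤-pred b<n) })
    (trans (ℤ.+-comm (∑[ n < suc (bound p) ] F -[1+ toℕ n ]) _) (∑-above p (ℕ.n≤1+n (bound p))))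

  sums-suc : F sums s → (F ∘ ℤ.suc) sums s
  sums-suc {F} {s} p = sums-to (suc b)
    (λ { (+ n)          b<n → vanish p (+ suc n) (ℕ.<⇒≤ (ℕ.m≤n⇒m≤1+n b<n))
       ; -[1+ zero ]    b<n → vanish p 0ℤ (ℕ.≤-pred b<n)
       ; -[1+ suc n ]   b<n → vanish p -[1+ n ] (ℕ.≤-pred b<n) })
    (begin
      P + (F 0ℤ + N)   ≡⟨ solve 3 (λ a b c → a :+ (b :+ c) := b :+ a :+ c) refl P (F 0ℤ) N ⟩
      F 0ℤ + P + N     ≡⟨ ∑-halves p {suc (suc b)} {b} (ℕ.m≤n⇒m≤1+n (ℕ.n≤1+n b)) ℕ.≤-refl ⟩
      s                ∎)
    where
    open ≡-Reasoning
    open +-*-Solver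
    b : ℕ
    b = bound p
    P N : ℤ
    P = ∑[ n < suc b ] F (+ suc (toℕ n))
    N = ∑[ n < b ] F -[1+ toℕ n ]

  -- Translation by -1 is translation by 1 conjugated by the reflection.
  sums-pred : F sums s → (F ∘ ℤ.pred) sums s
  sums-pred {F} p = sums-cong (λ x → cong F (~suc~ x)) (sums-~ (sums-suc (sums-~ p)))
    where
    ~suc~ : ∀ x → ~ (ℤ.suc (~ x)) ≡ ℤ.pred x
    ~suc~ (+ zero)   = refl
    ~suc~ (+ suc n)  = refl
    ~suc~ -[1+ n ]   = refl

  sums-shift : ∀ c → F sums s → (λ x → F (x + c)) sums s
  sums-shift {F} (+ zero)  p = sums-cong (λ x → cong F (sym (ℤ.+-identityʳ x))) p
  sums-shift {F} (+ suc n) p = sums-cong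
    (λ x → cong F (solve 2 (λ x n → con 1ℤ :+ x :+ n := x :+ (con 1ℤ :+ n)) refl x (+ n)))
    (sums-suc (sums-shift (+ n) p))
    where open +-*-Solver
  sums-shift {F} -[1+ zero ]  p = sums-cong (λ x → cong F (ℤ.+-comm -1ℤ x)) (sums-pred p)
  sums-shift {F} -[1+ suc n ] p = sums-cong
    (λ x → cong F (solve 2 (λ x n → con -1ℤ :+ x :+ n := x :+ (con -1ℤ :+ n)) refl x -[1+ n ]))
    (sums-pred (sums-shift -[1+ n ] p))
    where open +-*-Solver

  sums-split : ∀ d → F sums s → (λ m → ∑[ k < suc d ] F (m * + suc d + + toℕ k)) sums s
  sums-split {F} {s} d p = sums-to B
    (λ m B≤m → ∑-zero (suc d) λ k → vanish p (m * + suc d + + toℕ k) (ℕ.≤-trans B≤m (∣m∣≤ m (toℕ k) (Fin.toℕ<n k))))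
    (begin
      ∑[ m < B ] ∑[ k < suc d ] F (+ toℕ m * + suc d + + toℕ k) + ∑[ m < B ] ∑[ k < suc d ] F (-[1+ toℕ m ] * + suc d + + toℕ k)
        ≡⟨ cong₂ _+_
             (sum-cong-≗ {B} λ m → sum-cong-≗ {suc d} λ k → cong F (nonnegative (toℕ m) (toℕ k)))
             -- On the negative side the residues run backwards: with d - k in place of k, block
             -- `-[1+ m ]` consists of the numbers `-[1+ m * suc d + k ]`.
             (sum-cong-≗ {B} λ m → trans (∑-permute {n = suc d} (λ k → F (-[1+ toℕ m ] * + suc d + + toℕ k)) Permutation.reverse)
               (sum-cong-≗ {suc d} λ k → cong F (negative (toℕ m) k))) ⟩
      ∑[ m < B ] ∑[ k < suc d ] F (+ (toℕ m ℕ.* suc d ℕ.+ toℕ k)) + ∑[ m < B ] ∑[ k < suc d ] F -[1+ toℕ m ℕ.* suc d ℕ.+ toℕ k ]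
        ≡⟨ cong₂ _+_ (∑-blocks (suc d) B (F ∘ +_)) (∑-blocks (suc d) B (F ∘ -[1+_])) ⟨
      ∑ℤ (B ℕ.* suc d) F
        ≡⟨ ∑-above p (ℕ.m≤m*n B (suc d)) ⟩
      s ∎)
    where
    open ≡-Reasoning
    B : ℕ
    B = bound p
    nonnegative : ∀ m k → + m * + suc d + + k ≡ + (m ℕ.* suc d ℕ.+ k)
    nonnegative m k = trans (cong (_+ + k) (sym (ℤ.pos-* m (suc d)))) (sym (ℤ.pos-+ (m ℕ.* suc d) k))
    complement : ∀ m k j → k ℕ.+ j ≡ d → -[1+ m ] * + suc d + + j ≡ -[1+ m ℕ.* suc d ℕ.+ k ]
    complement m k j refl = begin
      - (1ℤ + + m) * (1ℤ + + (k ℕ.+ j)) + + j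
        ≡⟨ cong (λ t → - (1ℤ + + m) * (1ℤ + t) + + j) (ℤ.pos-+ k j) ⟩
      - (1ℤ + + m) * (1ℤ + (+ k + + j)) + + j
        ≡⟨ solve 3 (λ m k j → :- (con 1ℤ :+ m) :* (con 1ℤ :+ (k :+ j)) :+ j := :- (con 1ℤ :+ (m :* (con 1ℤ :+ (k :+ j)) :+ k)))
             refl (+ m) (+ k) (+ j) ⟩
      - (1ℤ + (+ m * (1ℤ + (+ k + + j)) + + k))
        ≡⟨ cong (λ t → - (1ℤ + (+ m * (1ℤ + t) + + k))) (ℤ.pos-+ k j) ⟨
      - (1ℤ + (+ m * + suc (k ℕ.+ j) + + k))
        ≡⟨ cong (λ t → - (1ℤ + t)) (nonnegative m k) ⟩
      -[1+ m ℕ.* suc (k ℕ.+ j) ℕ.+ k ] ∎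
      where open +-*-Solver
    negative : ∀ m k → -[1+ m ] * + suc d + + toℕ (opposite k) ≡ -[1+ m ℕ.* suc d ℕ.+ toℕ k ]
    negative m k = complement m (toℕ k) (toℕ (opposite k))
      (trans (cong (toℕ k ℕ.+_) (Fin.opposite-prop k)) (ℕ.m+[n∸m]≡n (ℕ.≤-pred (Fin.toℕ<n k))))
    ∣m∣≤ : ∀ m k → k ℕ.< suc d → ∣ m ∣ ℕ.≤ ∣ m * + suc d + + k ∣
    ∣m∣≤ (+ m) k _ = subst (m ℕ.≤_) (cong ∣_∣ (sym (nonnegative m k))) (ℕ.m≤n⇒m≤n+o k (ℕ.m≤m*n m (suc d)))
    ∣m∣≤ -[1+ m ] k (s≤s k≤d) = subst (suc m ℕ.≤_) (cong ∣_∣ (sym (complement m (d ∸ k) k (ℕ.m∸n+n≡m k≤d))))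
      (s≤s (ℕ.m≤n⇒m≤n+o (d ∸ k) (ℕ.m≤m*n m (suc d))))

  infix 4 _sums₂_

  -- An iterated sum whose inner variable is the second one. The order is part of the notion;
  -- exchanging it takes a bounded support, see `fubini`.
  record _sums₂_ (F : ℤ → ℤ → ℤ) (s : ℤ) : Set where
    field
      rows  : ℤ → ℤ
      inner : ∀ x → F x sums rows x
      outer : rows sums s

  open _sums₂_

  sums₂-unique : ∀ {F G : ℤ → ℤ → ℤ} {s t} → (∀ x y → F x y ≡ G x y) → F sums₂ s → G sums₂ t → s ≡ t
  sums₂-unique F≗G p q = sums-unique
    (sums-cong (λ x → sums-unique (sums-cong (F≗G x) (inner p x)) (inner q x)) (outer p)) (outer q)

  sums₂-∑ : ∀ {n} {F : Fin n → ℤ → ℤ → ℤ} {s : Fin n → ℤ} → (∀ i → F i sums₂ s i) →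
            (λ x y → ∑[ i < n ] F i x y) sums₂ (∑[ i < n ] s i)
  sums₂-∑ {n} p = record
    { rows  = λ x → ∑[ i < n ] rows (p i) x
    ; inner = λ x → sums-∑ λ i → inner (p i) x
    ; outer = sums-∑ λ i → outer (p i)
    }

  SupportedIn : ℕ → (ℤ → ℤ → ℤ) → Set
  SupportedIn B F = ∀ x y → B ℕ.≤ ∣ x ∣ ⊎ B ℕ.≤ ∣ y ∣ → F x y ≡ 0ℤ

  fubini : ∀ {F : ℤ → ℤ → ℤ} {B s} → SupportedIn B F → F sums₂ s → flip F sums₂ s
  fubini {F} {B} {s} box p = record
    { rows  = columns
    ; inner = λ y → sums-to B (λ x B≤x → box x y (inj₁ B≤x)) refl
    ; outer = sums-to B (λ y B≤y → ∑ℤ-zero B λ x → box x y (inj₂ B≤y)) (begin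
        ∑ℤ B columns                  ≡⟨ ∑ℤ-comm B F ⟨
        ∑ℤ B (λ x → ∑ℤ B (F x))       ≡⟨ ∑ℤ-cong B row≡ ⟩
        ∑ℤ B (rows p)                 ≡⟨ sums-unique (sums-to B rows-vanish refl) (outer p) ⟩
        s                             ∎)
    }
    where
    open ≡-Reasoning
    columns : ℤ → ℤ
    columns y = ∑ℤ B (λ x → F x y)
    row≡ : ∀ x → ∑ℤ B (F x) ≡ rows p x
    row≡ x = sums-unique (sums-to B (λ y B≤y → box x y (inj₂ B≤y)) refl) (inner p x)
    rows-vanish : ∀ x → B ℕ.≤ ∣ x ∣ → rows p x ≡ 0ℤ
    rows-vanish x B≤x = trans (sym (row≡ x)) (∑ℤ-zero B λ y → box x y (inj₁ B≤x))

  -- The vectors (c, 1) and (1, -c) span a sublattice of index c² + 1 in ℤ²,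
  -- with coset representatives (k, 0).
  sums₂-sublattice : ∀ c {F : ℤ → ℤ → ℤ} {B s} → SupportedIn B F → F sums₂ s →
    (λ m n → ∑[ k < suc (c ℕ.* c) ] F (+ c * n + m + + toℕ k) (n - + c * m)) sums₂ s
  sums₂-sublattice c {F} {B} {s} box p = record
    { rows  = λ m → ∑[ k < d ] rows sheared (m * + d + + toℕ k)
    ; inner = λ m → sums-cong (λ n → sum-cong-≗ {d} λ k → cong₂ F (abscissa m n (+ toℕ k)) (ordinate m n))
                      (sums-shift (- (+ c * m)) (sums-∑ {d} λ k → inner sheared (m * + d + + toℕ k)))
    ; outer = sums-split (c ℕ.* c) (outer sheared)
    }
    where
    open +-*-Solver
    d : ℕ
    d = suc (c ℕ.* c)
    transposed : flip F sums₂ s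
    transposed = fubini box p
    -- The new coordinate is v = x - cy. At x = cn + m + k, y = n - cm it equals (c² + 1)m + k, so
    -- `m` and `k` are quotient and remainder of v, and `n` is y translated by cm.
    sheared : (λ v y → F (v + + c * y) y) sums₂ s
    sheared = fubini {B = B ℕ.+ c ℕ.* B} box′ (record
      { rows  = rows transposed
      ; inner = λ y → sums-shift (+ c * y) (inner transposed y)
      ; outer = outer transposed
      })
      where
      -- Because |v| ≤ |x| + c|y|, a point with |v| ≥ B + cB and |y| < B has |x| ≥ B.
      box′ : SupportedIn (B ℕ.+ c ℕ.* B) (λ y v → F (v + + c * y) y)
      box′ y v (inj₁ B≤y) = box _ y (inj₂ (ℕ.m+n≤o⇒m≤o B B≤y))
      box′ y v (inj₂ B≤v) with B ℕ.≤? ∣ y ∣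
      ... | yes B≤y = box _ y (inj₂ B≤y)
      ... | no  B≰y = box _ y (inj₁ (ℕ.+-cancelʳ-≤ (c ℕ.* B) B _ (begin
        B ℕ.+ c ℕ.* B                              ≤⟨ B≤v ⟩
        ∣ v ∣                                      ≡⟨ cong ∣_∣ (solve 2 (λ v w → v := v :+ w :- w) refl v (+ c * y)) ⟩
        ∣ v + + c * y - + c * y ∣                  ≤⟨ ℤ.∣i-j∣≤∣i∣+∣j∣ (v + + c * y) (+ c * y) ⟩
        ∣ v + + c * y ∣ ℕ.+ ∣ + c * y ∣            ≡⟨ cong (∣ v + + c * y ∣ ℕ.+_) (ℤ.abs-* (+ c) y) ⟩
        ∣ v + + c * y ∣ ℕ.+ c ℕ.* ∣ y ∣            ≤⟨ ℕ.+-monoʳ-≤ ∣ v + + c * y ∣ (ℕ.*-monoʳ-≤ c (ℕ.<⇒≤ (ℕ.≰⇒> B≰y))) ⟩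
        ∣ v + + c * y ∣ ℕ.+ c ℕ.* B                ∎)))
        where open ℕ.≤-Reasoning
    ordinate : ∀ m n → n + - (+ c * m) ≡ n - + c * m
    ordinate m n = refl
    abscissa : ∀ m n k → m * + d + k + + c * (n + - (+ c * m)) ≡ + c * n + m + k
    abscissa m n k = trans
      (cong (λ t → m * (1ℤ + t) + k + + c * (n + - (+ c * m))) (ℤ.pos-* c c))
      (solve 4 (λ c m n k → m :* (con 1ℤ :+ c :* c) :+ k :+ c :* (n :+ :- (c :* m)) := c :* n :+ m :+ k) refl (+ c) m n k)

  sums₂-scale : ∀ {F : ℤ → ℤ → ℤ} {s} c → F sums₂ s → (λ x y → c * F x y) sums₂ (c * s)
  sums₂-scale c p = record
    { rows  = λ x → c * rows p x
    ; inner = λ x → sums-scale c (inner p x)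
    ; outer = sums-scale c (outer p)
    }

open LatticeSums

-- Theta series and products of two of them.

module ThetaSeries where

  open import Data.Integer using (_+_; _-_; _*_; -_; _^_)

  open _sums_
  open _sums₂_

  ·q^-≢ : ∀ c {e n} → n ≢ e → (c ·q^ e) n ≡ 0ℤ
  ·q^-≢ c {e} {n} n≢e with n ℕ.≡ᵇ e in eq
  ... | false = refl
  ... | true  = ⊥-elim (n≢e (ℕ.≡ᵇ⇒≡ n e (subst Data.Bool.T (sym eq) _)))

  ·q^-≡ : ∀ c e → (c ·q^ e) e ≡ c
  ·q^-≡ c zero    = refl
  ·q^-≡ c (suc e) = ·q^-≡ c e

  -- f = Σ_{x∈ℤ} w(x) q^e(x).
  record IsTheta (w : ℤ → ℤ) (e : ℤ → ℕ) (f : PowerSeries) : Set where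
    constructor theta-sums
    field coefficient : ∀ n → (λ x → (w x ·q^ e x) n) sums f n

  open IsTheta

  private variable
    w w₁ w₂ : ℤ → ℤ
    e e₁ e₂ : ℤ → ℕ
    f g : PowerSeries

  theta-unique : w₁ ≗ w₂ → e₁ ≗ e₂ → IsTheta w₁ e₁ f → IsTheta w₂ e₂ g → f ≋ g
  theta-unique w₁≗w₂ e₁≗e₂ p q = pointwise λ n → sums-unique
    (sums-cong (λ x → cong₂ (λ c e → (c ·q^ e) n) (w₁≗w₂ x) (e₁≗e₂ x)) (coefficient p n)) (coefficient q n)

  theta-cong : w₁ ≗ w₂ → e₁ ≗ e₂ → IsTheta w₁ e₁ f → IsTheta w₂ e₂ f
  theta-cong w₁≗w₂ e₁≗e₂ p = theta-sums λ n →
    sums-cong (λ x → cong₂ (λ c e → (c ·q^ e) n) (w₁≗w₂ x) (e₁≗e₂ x)) (coefficient p n)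

  theta-series : IsTheta w e f → f ≋ g → IsTheta w e g
  theta-series {w} {e} p f≋g = theta-sums λ n → subst ((λ x → (w x ·q^ e x) n) sums_) (at f≋g n) (coefficient p n)

  theta-~ : IsTheta w e f → IsTheta (w ∘ ~_) (e ∘ ~_) f
  theta-~ p = theta-sums λ n → sums-~ (coefficient p n)

  theta-suc : IsTheta w e f → IsTheta (w ∘ ℤ.suc) (e ∘ ℤ.suc) f
  theta-suc p = theta-sums λ n → sums-suc (coefficient p n)

  theta-x⊛ : IsTheta w e f → IsTheta w (suc ∘ e) (x ⊛ f)
  theta-x⊛ {f = f} p = theta-sums λ where
    zero    → sums-zero λ _ → refl
    (suc n) → subst (_ sums_) (sym (x⊛-suc f n)) (coefficient p n)

  theta-neg : IsTheta w e f → IsTheta (λ x → -1ℤ ^ e x * w x) e (neg f)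
  theta-neg {w} {e} p = theta-sums λ n → sums-cong (sign n) (sums-scale (-1ℤ ^ n) (coefficient p n))
    where
    sign : ∀ n x → -1ℤ ^ n * (w x ·q^ e x) n ≡ ((-1ℤ ^ e x * w x) ·q^ e x) n
    sign n x with n ℕ.≟ e x
    ... | yes refl = trans (cong (-1ℤ ^ n *_) (·q^-≡ (w x) n)) (sym (·q^-≡ (-1ℤ ^ n * w x) n))
    ... | no  n≢e  = trans (cong (-1ℤ ^ n *_) (·q^-≢ (w x) n≢e))
                       (trans (ℤ.*-zeroʳ (-1ℤ ^ n)) (sym (·q^-≢ (-1ℤ ^ e x * w x) n≢e)))

  theta-stretch : ∀ d .{{_ : NonZero d}} → IsTheta w e f → IsTheta w (λ x → d ℕ.* e x) (f ⟨q^ d ⟩)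
  theta-stretch {w} {e} {f} d p = theta-sums λ n → stretched n (d ∣? n)
    where
    stretched : ∀ n → Dec (d ∣ n) → (λ x → (w x ·q^ (d ℕ.* e x)) n) sums (f ⟨q^ d ⟩) n
    stretched n (yes (divides k refl)) = subst (_ sums_) (sym (stretch-* {d} f k))
      (sums-cong same (coefficient p k))
      where
      same : ∀ x → (w x ·q^ e x) k ≡ (w x ·q^ (d ℕ.* e x)) (k ℕ.* d)
      same x with k ℕ.≟ e x
      ... | yes refl = trans (·q^-≡ (w x) k) (sym (trans (cong (w x ·q^ (d ℕ.* k)) (ℕ.*-comm k d)) (·q^-≡ (w x) (d ℕ.* k))))
      ... | no  k≢e  = trans (·q^-≢ (w x) k≢e) (sym (·q^-≢ (w x) λ kd≡de → k≢e (ℕ.*-cancelʳ-≡ k (e x) d (trans kd≡de (ℕ.*-comm d (e x))))))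
    stretched n (no d∤n) = subst (_ sums_) (sym (stretch-∤ {d} f d∤n))
      (sums-zero λ x → ·q^-≢ (w x) λ n≡de → d∤n (divides (e x) (trans n≡de (ℕ.*-comm d (e x)))))

  theta-⊛ : IsTheta w₁ e₁ f → IsTheta w₂ e₂ g →
            ∀ n → (λ x y → ((w₁ x * w₂ y) ·q^ (e₁ x ℕ.+ e₂ y)) n) sums₂ (f ⊛ g) n
  theta-⊛ {w₁ = w₁} {e₁ = e₁} {f = f} {w₂ = w₂} {e₂ = e₂} {g = g} p q n = record
    { rows  = λ x → ((w₁ x ·q^ e₁ x) ⊛ g) n
    ; inner = λ x → sums-cong (λ y → ^-⊛-^ (w₁ x) (e₁ x) (w₂ y) (e₂ y) n)
        (sums-∑ {suc n} λ i → sums-scale ((w₁ x ·q^ e₁ x) (toℕ i)) (coefficient q (n ∸ toℕ i)))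
    ; outer = sums-∑ {suc n} λ i → sums-cong (λ x → ℤ.*-comm (g (n ∸ toℕ i)) ((w₁ x ·q^ e₁ x) (toℕ i)))
        (subst (_ sums_) (ℤ.*-comm (g (n ∸ toℕ i)) (f (toℕ i)))
          (sums-scale (g (n ∸ toℕ i)) (coefficient p (toℕ i))))
    }

  -- Guarantees that only finitely many x contribute to a given coefficient. The successor admits
  -- exponents such as x(x+1)/2, which vanish at x = -1.
  Proper : (ℤ → ℕ) → Set
  Proper e = ∀ x → ∣ x ∣ ℕ.≤ suc (e x)

  theta-⊛-supported : Proper e₁ → Proper e₂ → ∀ n →
                      SupportedIn (suc (suc n)) (λ x y → ((w₁ x * w₂ y) ·q^ (e₁ x ℕ.+ e₂ y)) n)
  theta-⊛-supported {e₁ = e₁} {e₂ = e₂} {w₁ = w₁} {w₂ = w₂} proper₁ proper₂ n x y (inj₁ n<x) = ·q^-≢ (w₁ x * w₂ y) {e₁ x ℕ.+ e₂ y} {n} λ { refl →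
    ℕ.<-irrefl refl (ℕ.≤-trans (s≤s (s≤s (ℕ.m≤m+n (e₁ x) (e₂ y)))) (ℕ.≤-trans n<x (proper₁ x))) }
  theta-⊛-supported {e₁ = e₁} {e₂ = e₂} {w₁ = w₁} {w₂ = w₂} proper₁ proper₂ n x y (inj₂ n<y) = ·q^-≢ (w₁ x * w₂ y) {e₁ x ℕ.+ e₂ y} {n} λ { refl →
    ℕ.<-irrefl refl (ℕ.≤-trans (s≤s (s≤s (ℕ.m≤n+m (e₂ y) (e₁ x)))) (ℕ.≤-trans n<y (proper₂ y))) }

  record Theta : Set where
    constructor theta
    field
      {weight}   : ℤ → ℤ
      {exponent} : ℤ → ℕ
      {series}   : PowerSeries
      isTheta    : IsTheta weight exponent series

  open Theta

  -- The vectors (c, 1) and (1, -c) are orthogonal of equal length, so a sum of two quadratic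
  -- exponents with the same leading coefficient has no mixed term mn on any coset. Once the weights
  -- separate as well, each coset contributes a product of two theta series.
  theta-product : ∀ c → Proper e₁ → Proper e₂ → IsTheta w₁ e₁ f → IsTheta w₂ e₂ g →
    (U V : Fin (suc (c ℕ.* c)) → Theta) →
    (∀ k m n → w₁ (+ c * n + m + + toℕ k) * w₂ (n - + c * m) ≡ weight (U k) m * weight (V k) n) →
    (∀ k m n → e₁ (+ c * n + m + + toℕ k) ℕ.+ e₂ (n - + c * m) ≡ exponent (U k) m ℕ.+ exponent (V k) n) →
    ∀ N → (f ⊛ g) N ≡ ∑[ k < suc (c ℕ.* c) ] (series (U k) ⊛ series (V k)) N
  theta-product {e₁ = e₁} {e₂ = e₂} {w₁ = w₁} {w₂ = w₂} c proper₁ proper₂ p q U V weights exponents N = sums₂-unique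
    (λ m n → sum-cong-≗ {suc (c ℕ.* c)} λ k → cong₂ (λ a b → (a ·q^ b) N) (weights k m n) (exponents k m n))
    (sums₂-sublattice c (theta-⊛-supported {w₁ = w₁} {w₂ = w₂} proper₁ proper₂ N) (theta-⊛ p q N))
    (sums₂-∑ {suc (c ℕ.* c)} λ k → theta-⊛ (isTheta (U k)) (isTheta (V k)) N)

open ThetaSeries

-- The particular theta series and their product identities.

module ThetaIdentities where

  open import Data.Integer using (_+_; _-_; _*_; -_; _^_; _⊖_)
  open _sums_
  open IsTheta

  thetaSeries : (ℤ → ℤ) → (ℤ → ℕ) → PowerSeries
  thetaSeries w e n = ∑ℤ (suc (suc n)) λ x → (w x ·q^ e x) n

  thetaSeries-isTheta : ∀ w e → Proper e → IsTheta w e (thetaSeries w e)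
  thetaSeries-isTheta w e proper = theta-sums λ n → sums-to (suc (suc n))
    (λ x n<x → ·q^-≢ (w x) {e x} {n} λ { refl → ℕ.<-irrefl refl (ℕ.≤-trans n<x (proper x)) }) refl

  sgn : ℤ → ℤ
  sgn x = -1ℤ ^ ∣ x ∣

  sgn-suc : ∀ x → sgn (ℤ.suc x) ≡ -1ℤ * sgn x
  sgn-suc (+ n)        = refl
  sgn-suc -[1+ zero ]  = refl
  sgn-suc -[1+ suc n ] = solve 1 (λ s → s := con -1ℤ :* (con -1ℤ :* s)) refl (-1ℤ ^ suc n)
    where open +-*-Solver

  sgn-~ : ∀ x → sgn (~ x) ≡ -1ℤ * sgn x
  sgn-~ (+ n)    = refl
  sgn-~ -[1+ n ] = solve 1 (λ s → s := con -1ℤ :* (con -1ℤ :* s)) refl (-1ℤ ^ n)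
    where open +-*-Solver

  sgn-neg : ∀ x → sgn (- x) ≡ sgn x
  sgn-neg x = cong (-1ℤ ^_) (ℤ.∣-i∣≡∣i∣ x)

  sgn-+ℕ : ∀ n x → sgn (+ n + x) ≡ -1ℤ ^ n * sgn x
  sgn-+ℕ zero    x = trans (cong sgn (ℤ.+-identityˡ x)) (sym (ℤ.*-identityˡ (sgn x)))
  sgn-+ℕ (suc n) x = begin
    sgn (+ suc n + x)            ≡⟨ cong sgn (ℤ.+-assoc 1ℤ (+ n) x) ⟩
    sgn (ℤ.suc (+ n + x))        ≡⟨ sgn-suc (+ n + x) ⟩
    -1ℤ * sgn (+ n + x)          ≡⟨ cong (-1ℤ *_) (sgn-+ℕ n x) ⟩
    -1ℤ * (-1ℤ ^ n * sgn x)      ≡⟨ ℤ.*-assoc -1ℤ (-1ℤ ^ n) (sgn x) ⟨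
    -1ℤ ^ suc n * sgn x          ∎
    where open ≡-Reasoning

  sgn-+ : ∀ x y → sgn (x + y) ≡ sgn x * sgn y
  sgn-+ (+ n)    y = sgn-+ℕ n y
  sgn-+ -[1+ n ] y = begin
    sgn (- (+ suc n) + y)      ≡⟨ sgn-neg (- (+ suc n) + y) ⟨
    sgn (- (- (+ suc n) + y))  ≡⟨ cong sgn (solve 2 (λ a b → :- (:- a :+ b) := a :+ :- b) refl (+ suc n) y) ⟩
    sgn (+ suc n + - y)        ≡⟨ sgn-+ℕ (suc n) (- y) ⟩
    -1ℤ ^ suc n * sgn (- y)    ≡⟨ cong (-1ℤ ^ suc n *_) (sgn-neg y) ⟩
    -1ℤ ^ suc n * sgn y        ∎
    where
    open ≡-Reasoning
    open +-*-Solver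

  square pronic triangle : ℤ → ℕ
  square x = ∣ x ∣ ℕ.* ∣ x ∣

  pronic (+ n)    = n ℕ.* suc n
  pronic -[1+ n ] = n ℕ.* suc n

  triangular : ℕ → ℕ
  triangular n = n ℕ.* suc n ℕ./ 2

  triangle (+ n)    = triangular n
  triangle -[1+ n ] = triangular n

  triangular-double : ∀ n → triangular n ℕ.* 2 ≡ n ℕ.* suc n
  triangular-double n = trans (cong (λ t → t ℕ./ 2 ℕ.* 2) (sym (half-double n)))
    (trans (cong (ℕ._* 2) (m*n/n≡m (half n) 2)) (half-double n))
    where
    half : ℕ → ℕ
    half zero    = 0
    half (suc n) = half n ℕ.+ suc n
    half-double : ∀ n → half n ℕ.* 2 ≡ n ℕ.* suc n
    half-double zero    = refl
    half-double (suc n) = begin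
      (half n ℕ.+ suc n) ℕ.* 2            ≡⟨ ℕ.*-distribʳ-+ 2 (half n) (suc n) ⟩
      half n ℕ.* 2 ℕ.+ suc n ℕ.* 2        ≡⟨ cong (ℕ._+ suc n ℕ.* 2) (half-double n) ⟩
      n ℕ.* suc n ℕ.+ suc n ℕ.* 2         ≡⟨ solve 1 (λ n → n :* (con 1 :+ n) :+ (con 1 :+ n) :* con 2 := (con 1 :+ n) :* (con 2 :+ n)) refl n ⟩
      suc n ℕ.* suc (suc n)               ∎
      where
      open ≡-Reasoning
      open ℕ-Solver.+-*-Solver

  n≤triangular : ∀ n → n ℕ.≤ triangular n
  n≤triangular zero    = z≤n
  n≤triangular (suc n) = ℕ.*-cancelʳ-≤ (suc n) (triangular (suc n)) 2 (subst (suc n ℕ.* 2 ℕ.≤_) (sym (triangular-double (suc n)))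
    (ℕ.*-monoʳ-≤ (suc n) (s≤s (s≤s z≤n))))

  +square : ∀ x → + square x ≡ x * x
  +square x = trans (ℤ.pos-* ∣ x ∣ ∣ x ∣) (square-abs x)
    where
    square-abs : ∀ x → + ∣ x ∣ * + ∣ x ∣ ≡ x * x
    square-abs (+ n)    = refl
    square-abs -[1+ n ] = refl

  +pronic : ∀ x → + pronic x ≡ x * (1ℤ + x)
  +pronic (+ n)    = ℤ.pos-* n (suc n)
  +pronic -[1+ n ] = trans (ℤ.pos-* n (suc n)) (solve 1 (λ n → n :* (con 1ℤ :+ n) := :- (con 1ℤ :+ n) :* (con 1ℤ :+ :- (con 1ℤ :+ n))) refl (+ n))
    where open +-*-Solver

  2triangle : ∀ x → 2 ℕ.* triangle x ≡ pronic x
  2triangle (+ n)    = trans (ℕ.*-comm 2 (triangular n)) (triangular-double n)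
  2triangle -[1+ n ] = trans (ℕ.*-comm 2 (triangular n)) (triangular-double n)

  pronic-~ : ∀ x → pronic (~ x) ≡ pronic x
  pronic-~ (+ n)    = refl
  pronic-~ -[1+ n ] = refl

  ∣x∣≤square : ∀ x → ∣ x ∣ ℕ.≤ square x
  ∣x∣≤square x with ∣ x ∣
  ... | zero  = z≤n
  ... | suc n = ℕ.m≤m*n (suc n) (suc n)

  proper-square : Proper square
  proper-square x = ℕ.m≤n⇒m≤1+n (∣x∣≤square x)

  proper-triangle : Proper triangle
  proper-triangle (+ n)    = ℕ.m≤n⇒m≤1+n (n≤triangular n)
  proper-triangle -[1+ n ] = s≤s (n≤triangular n)

  proper-pronic : Proper pronic
  proper-pronic x = ℕ.≤-trans (proper-triangle x)
    (s≤s (subst (triangle x ℕ.≤_) (2triangle x) (ℕ.m≤m+n (triangle x) (triangle x ℕ.+ 0))))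

  proper-mono : ∀ {e e′} → Proper e → (∀ x → e x ℕ.≤ e′ x) → Proper e′
  proper-mono proper e≤e′ x = ℕ.≤-trans (proper x) (s≤s (e≤e′ x))

  -- 5x² + 4x and 5x² + 2x.
  e₄ e₂ : ℤ → ℕ
  e₄ x = square x ℕ.+ 4 ℕ.* pronic x
  e₂ x = 3 ℕ.* square x ℕ.+ 2 ℕ.* pronic x

  proper-e₄ : Proper e₄
  proper-e₄ = proper-mono proper-square λ x → ℕ.m≤m+n (square x) _

  proper-e₂ : Proper e₂
  proper-e₂ = proper-mono proper-square λ x → ℕ.m≤n⇒m≤n+o _ (ℕ.m≤m+n (square x) _)

  +e₄ : ∀ x → + e₄ x ≡ x * x + + 4 * (x * (1ℤ + x))
  +e₄ x = trans (ℤ.pos-+ (square x) (4 ℕ.* pronic x))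
    (cong₂ _+_ (+square x) (trans (ℤ.pos-* 4 (pronic x)) (cong (+ 4 *_) (+pronic x))))

  +e₂ : ∀ x → + e₂ x ≡ + 3 * (x * x) + + 2 * (x * (1ℤ + x))
  +e₂ x = trans (ℤ.pos-+ (3 ℕ.* square x) (2 ℕ.* pronic x))
    (cong₂ _+_ (trans (ℤ.pos-* 3 (square x)) (cong (+ 3 *_) (+square x)))
               (trans (ℤ.pos-* 2 (pronic x)) (cong (+ 2 *_) (+pronic x))))

  -- Read as ((-1)^n)^n = (-1)^n, which is immediate in each of the cases (-1)^n = -1 and (-1)^n =
  -- 1.
  -1^square : ∀ x → -1ℤ ^ square x ≡ sgn x
  -1^square x = power ∣ x ∣
    where
    power : ∀ n → -1ℤ ^ (n ℕ.* n) ≡ -1ℤ ^ n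
    power n = trans (sym (ℤ.^-*-assoc -1ℤ n n)) (helper n)
      where
      fixed : ∀ n → (-1ℤ) ^ n ≡ -1ℤ ⊎ -1ℤ ^ n ≡ 1ℤ
      fixed zero    = inj₂ refl
      fixed (suc n) with fixed n
      ... | inj₁ eq = inj₂ (cong (-1ℤ *_) eq)
      ... | inj₂ eq = inj₁ (cong (-1ℤ *_) eq)
      ones : ∀ n → 1ℤ ^ n ≡ 1ℤ
      ones = ℤ.^-zeroˡ
      helper : ∀ n → (-1ℤ ^ n) ^ n ≡ -1ℤ ^ n
      helper n with fixed n
      ... | inj₁ eq = cong (_^ n) eq
      ... | inj₂ eq = trans (cong (_^ n) eq) (trans (ones n) (sym eq))

  one : ℤ → ℤ
  one _ = 1ℤ

  -- Ψ is the two-sided sum Σ_{x∈ℤ} q^(x(x+1)/2), twice the one-sided ψ(q).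
  p P r Q ψ Ψ : PowerSeries
  P = φ[-q]
  p = neg P
  Q = P ⟨q^ 5 ⟩
  r = p ⟨q^ 5 ⟩
  ψ = neg ψ[-q]
  Ψ = const (+ 2) ⊛ ψ

  P-theta : IsTheta sgn square P
  P-theta = theta-sums λ m → sums-to (suc m) (vanishing m) (sym (begin
    φ[-q] m
      ≡⟨ sum-cong-≗ {suc (2 ℕ.* m)} (λ i → cong (λ e → (sgn (toℕ i ⊖ m) ·q^ e) m) (power-square ∣ toℕ i ⊖ m ∣)) ⟩
    ∑[ i < suc (2 ℕ.* m) ] F m (toℕ i ⊖ m)
      ≡⟨ cong (λ l → ∑[ i < l ] F m (toℕ i ⊖ m)) (trans (cong (λ t → suc (m ℕ.+ t)) (ℕ.+-identityʳ m)) (sym (ℕ.+-suc m m))) ⟩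
    ∑[ i < m ℕ.+ suc m ] F m (toℕ i ⊖ m)
      -- The range -m, ..., m is cut before 0, and its negative part is reversed so that it runs
      -- through -1, -2, ....
      ≡⟨ ∑-++ m (suc m) (λ i → F m (i ⊖ m)) ⟩
    ∑[ i < m ] F m (toℕ i ⊖ m) + ∑[ i < suc m ] F m ((m ℕ.+ toℕ i) ⊖ m)
      ≡⟨ cong₂ _+_
           (trans (∑-permute {n = m} (λ i → F m (toℕ i ⊖ m)) Permutation.reverse) (sum-cong-≗ {m} λ i → cong (F m) (negative m i)))
           (sum-cong-≗ {suc m} λ i → cong (F m) (nonnegative m (toℕ i))) ⟩
    ∑[ i < m ] F m -[1+ toℕ i ] + ∑[ i < suc m ] F m (+ toℕ i)
      ≡⟨ ℤ.+-comm (∑[ i < m ] F m -[1+ toℕ i ]) _ ⟩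
    ∑[ i < suc m ] F m (+ toℕ i) + ∑[ i < m ] F m -[1+ toℕ i ]
      ≡⟨ cong (λ t → ∑[ i < suc m ] F m (+ toℕ i) + t)
           (∑-extend (F m ∘ -[1+_]) (ℕ.n≤1+n m) λ n m≤n → vanishing m -[1+ n ] (s≤s m≤n)) ⟨
    ∑ℤ (suc m) (F m) ∎))
    where
    open ≡-Reasoning
    F : ℕ → ℤ → ℤ
    F m k = (sgn k ·q^ square k) m
    power-square : ∀ n → n ℕ.^ 2 ≡ n ℕ.* n
    power-square n = cong (n ℕ.*_) (ℕ.*-identityʳ n)
    vanishing : ∀ m x → suc m ℕ.≤ ∣ x ∣ → F m x ≡ 0ℤ
    vanishing m x m<x = ·q^-≢ (sgn x) {square x} {m} λ { refl →
      ℕ.<-irrefl refl (ℕ.≤-trans m<x (∣x∣≤square x)) }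
    nonnegative : ∀ m n → (m ℕ.+ n) ⊖ m ≡ + n
    nonnegative m n = trans (ℤ.⊖-≥ (ℕ.m≤m+n m n)) (cong +_ (ℕ.m+n∸m≡n m n))
    negative : ∀ m (i : Fin m) → toℕ (opposite i) ⊖ m ≡ -[1+ toℕ i ]
    negative m i = trans (cong (_⊖ m) (Fin.opposite-prop i)) (trans
      (ℤ.⊖-≤ (ℕ.m∸n≤m m (suc (toℕ i)))) (cong (λ t → - (+ t)) (ℕ.m∸[m∸n]≡n (Fin.toℕ<n i))))

  sgn²≡1 : ∀ x → sgn x * sgn x ≡ 1ℤ
  sgn²≡1 x = trans (sym (ℤ.^-distribˡ-+-* -1ℤ ∣ x ∣ ∣ x ∣)) (-1²ⁿ≡1 ∣ x ∣)

  p-theta : IsTheta one square p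
  p-theta = theta-cong (λ x → trans (cong (_* sgn x) (-1^square x)) (sgn²≡1 x)) (λ _ → refl) (theta-neg P-theta)

  neg-const : ∀ c → neg (const c) ≋ const c
  neg-const c = pointwise λ { zero → ℤ.*-identityˡ c ; (suc n) → ℤ.*-zeroʳ (-1ℤ ^ suc n) }

  Ψ-theta : IsTheta one triangle Ψ
  Ψ-theta = theta-series (theta-cong (λ x → trans (sym (ℤ.^-distribˡ-+-* -1ℤ (triangle x) (triangle x))) (-1²ⁿ≡1 (triangle x)))
                                     (λ _ → refl) (theta-neg doubled))
    (pointwise λ n → trans (neg-⊛ (const (+ 2)) ψ[-q] n) (⊛-cong {g = ψ} {g′ = ψ} (at (neg-const (+ 2))) (λ _ → refl) n))
    where
    open ≡-Reasoning
    F : ℕ → ℤ → ℤ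
    F m x = ((-1ℤ ^ triangle x) ·q^ triangle x) m
    vanishing : ∀ m n → suc m ℕ.≤ n → F m (+ n) ≡ 0ℤ
    vanishing m n m<n = ·q^-≢ (-1ℤ ^ triangular n) {triangular n} {m} λ { refl → ℕ.<-irrefl refl (ℕ.≤-trans m<n (n≤triangular n)) }
    -- The points n and -1 - n have the same exponent, so the negative half repeats the one-sided
    -- series.
    doubled : IsTheta (λ x → -1ℤ ^ triangle x) triangle (const (+ 2) ⊛ ψ[-q])
    doubled = theta-sums λ m → sums-to (suc (suc m))
      (λ { (+ n) m<n → vanishing m n (ℕ.<⇒≤ m<n) ; -[1+ n ] m<n → vanishing m n (ℕ.≤-pred m<n) })
      (begin
        half m + half m             ≡⟨ cong (λ t → t + t) (∑-extend {suc m} {suc (suc m)} (F m ∘ +_) (ℕ.n≤1+n (suc m)) (vanishing m)) ⟩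
        ψ[-q] m + ψ[-q] m           ≡⟨ solve 1 (λ t → t :+ t := con (+ 2) :* t) refl (ψ[-q] m) ⟩
        + 2 * ψ[-q] m               ≡⟨ const-⊛ (+ 2) ψ[-q] m ⟨
        (const (+ 2) ⊛ ψ[-q]) m     ∎)
      where
      open +-*-Solver
      half : ℕ → ℤ
      half m = ∑[ n < suc (suc m) ] F m (+ toℕ n)

  Ψ²-theta : IsTheta one pronic (Ψ ⟨q^ 2 ⟩)
  Ψ²-theta = theta-cong (λ _ → refl) 2triangle (theta-stretch 2 Ψ-theta)

  private
    infixl 6 _⟪+⟫_
    infixl 7 _⟪*⟫_

    _⟪+⟫_ : ∀ {a b A B} → + a ≡ A → + b ≡ B → + (a ℕ.+ b) ≡ A + B
    _⟪+⟫_ {a} {b} refl refl = ℤ.pos-+ a b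

    _⟪*⟫_ : ∀ k {a A} → + a ≡ A → + (k ℕ.* a) ≡ + k * A
    _⟪*⟫_ k {a} refl = ℤ.pos-* k a

    ⟪suc⟫ : ∀ {a A} → + a ≡ A → + suc a ≡ 1ℤ + A
    ⟪suc⟫ refl = refl

    via : ∀ {a b A B} → + a ≡ A → + b ≡ B → A ≡ B → a ≡ b
    via a≡A b≡B A≡B = ℤ.+-injective (trans a≡A (trans A≡B (sym b≡B)))

  opaque
    unfolding _✶_

    -- This is φ(q)² = φ(q²)² + 4qψ(q⁴)². For c = 1 the two cosets are the points with x + y even
    -- and those with x + y odd.
    p²-split : p ✶ p ≋ p ⟨q^ 2 ⟩ ✶ p ⟨q^ 2 ⟩ ⊕ (x ✶ Ψ ⟨q^ 2 ⟩ ⟨q^ 2 ⟩) ✶ Ψ ⟨q^ 2 ⟩ ⟨q^ 2 ⟩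
    p²-split = pointwise λ N → trans
      (theta-product 1 proper-square proper-square p-theta p-theta
        (lookup (theta (theta-stretch 2 p-theta) ∷ theta (theta-x⊛ (theta-stretch 2 Ψ²-theta)) ∷ []))
        (lookup (theta (theta-stretch 2 p-theta) ∷ theta (theta-stretch 2 Ψ²-theta) ∷ []))
        (λ { zero m n → refl ; (suc zero) m n → refl })
        (λ { zero m n → via (+square (+ 1 * n + m + + 0) ⟪+⟫ +square (n - + 1 * m)) (2 ⟪*⟫ +square m ⟪+⟫ 2 ⟪*⟫ +square n)
               (solve 2 (λ m n → (con (+ 1) :* n :+ m :+ con (+ 0)) :* (con (+ 1) :* n :+ m :+ con (+ 0)) :+ (n :- con (+ 1) :* m) :* (n :- con (+ 1) :* m)
                 := con (+ 2) :* (m :* m) :+ con (+ 2) :* (n :* n)) refl m n)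
           ; (suc zero) m n → via (+square (+ 1 * n + m + + 1) ⟪+⟫ +square (n - + 1 * m)) (⟪suc⟫ (2 ⟪*⟫ +pronic m) ⟪+⟫ 2 ⟪*⟫ +pronic n)
               (solve 2 (λ m n → (con (+ 1) :* n :+ m :+ con (+ 1)) :* (con (+ 1) :* n :+ m :+ con (+ 1)) :+ (n :- con (+ 1) :* m) :* (n :- con (+ 1) :* m)
                 := con 1ℤ :+ con (+ 2) :* (m :* (con 1ℤ :+ m)) :+ con (+ 2) :* (n :* (con 1ℤ :+ n))) refl m n) }) N)
      (cong (λ t → (p ⟨q^ 2 ⟩ ⊛ p ⟨q^ 2 ⟩) N + t) (ℤ.+-identityʳ _))
      where open +-*-Solver

  opaque
    unfolding _✶_

    -- This is ψ(q)² = φ(q)ψ(q²), both cosets giving the same product. The exponents are compared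
    -- after doubling, since x(x+1)/2 is not an integer polynomial.
    Ψ²-split : Ψ ✶ Ψ ≋ p ✶ Ψ ⟨q^ 2 ⟩ ⊕ Ψ ⟨q^ 2 ⟩ ✶ p
    Ψ²-split = pointwise λ N → trans
      (theta-product 1 proper-triangle proper-triangle Ψ-theta Ψ-theta
        (lookup (theta p-theta ∷ theta Ψ²-theta ∷ []))
        (lookup (theta Ψ²-theta ∷ theta (theta-suc p-theta) ∷ []))
        (λ { zero m n → refl ; (suc zero) m n → refl })
        (λ { zero m n → halve (+ 1 * n + m + + 0) (n - + 1 * m) (via (+pronic (+ 1 * n + m + + 0) ⟪+⟫ +pronic (n - + 1 * m)) (2 ⟪*⟫ (+square m ⟪+⟫ +pronic n))
               (solve 2 (λ m n → (con (+ 1) :* n :+ m :+ con (+ 0)) :* (con 1ℤ :+ (con (+ 1) :* n :+ m :+ con (+ 0))) :+ (n :- con (+ 1) :* m) :* (con 1ℤ :+ (n :- con (+ 1) :* m))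
                 := con (+ 2) :* (m :* m :+ n :* (con 1ℤ :+ n))) refl m n))
           ; (suc zero) m n → halve (+ 1 * n + m + + 1) (n - + 1 * m) (via (+pronic (+ 1 * n + m + + 1) ⟪+⟫ +pronic (n - + 1 * m)) (2 ⟪*⟫ (+pronic m ⟪+⟫ +square (ℤ.suc n)))
               (solve 2 (λ m n → (con (+ 1) :* n :+ m :+ con (+ 1)) :* (con 1ℤ :+ (con (+ 1) :* n :+ m :+ con (+ 1))) :+ (n :- con (+ 1) :* m) :* (con 1ℤ :+ (n :- con (+ 1) :* m))
                 := con (+ 2) :* (m :* (con 1ℤ :+ m) :+ (con 1ℤ :+ n) :* (con 1ℤ :+ n))) refl m n)) }) N)
      (cong (λ t → (p ⊛ Ψ ⟨q^ 2 ⟩) N + t) (ℤ.+-identityʳ _))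
      where
      open +-*-Solver
      halve : ∀ a b {t} → pronic a ℕ.+ pronic b ≡ 2 ℕ.* t → triangle a ℕ.+ triangle b ≡ t
      halve a b {t} eq = ℕ.*-cancelˡ-≡ (triangle a ℕ.+ triangle b) t 2
        (trans (ℕ.*-distribˡ-+ 2 (triangle a) (triangle b)) (trans (cong₂ ℕ._+_ (2triangle a) (2triangle b)) eq))

  -- Summing along x ↦ -1 - x instead of x shows that each coefficient is its own negative.
  theta-odd : ∀ {w e f} → (∀ x → w (~ x) ≡ -1ℤ * w x) → (∀ x → e (~ x) ≡ e x) → IsTheta w e f → f ≋ 0ˢ
  theta-odd {w} {e} {f} odd even t = pointwise λ n → self-opposite (f n) (sums-unique
    (sums-cong (λ x → trans (cong₂ (λ c d → (c ·q^ d) n) (odd x) (even x)) (sym (^-scale -1ℤ (w x) (e x) n)))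
      (sums-~ (coefficient t n)))
    (sums-scale -1ℤ (coefficient t n)))
    where
    self-opposite : ∀ a → a ≡ -1ℤ * a → a ≡ 0ℤ
    self-opposite (+ zero)   _  = refl
    self-opposite (+ suc n)  ()
    self-opposite -[1+ n ]   ()

  sgn-weights : ∀ m n → sgn (n - + 1 * m) ≡ sgn m * sgn n
  sgn-weights m n = trans (sgn-+ n (- (+ 1 * m))) (trans
    (cong (sgn n *_) (trans (sgn-neg (+ 1 * m)) (cong sgn (ℤ.*-identityˡ m)))) (ℤ.*-comm (sgn n) (sgn m)))

  pronic-sgn : PowerSeries
  pronic-sgn = thetaSeries sgn pronic

  pronic-sgn-theta : IsTheta sgn pronic pronic-sgn
  pronic-sgn-theta = thetaSeries-isTheta sgn pronic proper-pronic

  pronic-sgn≋0 : pronic-sgn ≋ 0ˢ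
  pronic-sgn≋0 = theta-odd sgn-~ pronic-~ pronic-sgn-theta

  stretch-0 : ∀ d .{{_ : NonZero d}} {f} → f ≋ 0ˢ → f ⟨q^ d ⟩ ≋ 0ˢ
  stretch-0 d f≋0 = pointwise λ n → trans (stretch-cong {d} (at f≋0) n) (zeros n)
    where
    zeros : 0ˢ ⟨q^ d ⟩ ≗ 0ˢ
    zeros n = sym (stretch-unique {d} 0ˢ (λ _ → refl) (λ _ → refl) n)

  vanishing-term : ∀ {f g : PowerSeries} (h : PowerSeries) (N : ℕ) → f ≋ 0ˢ → g N + ((f ⊛ h) N + 0ℤ) ≡ g N
  vanishing-term {f} {g} h N f≋0 = trans
    (cong (λ t → g N + (t + 0ℤ)) (trans (⊛-cong {g = h} {g′ = h} (at f≋0) (λ _ → refl) N) (⊛-zeroˡ h N)))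
    (ℤ.+-identityʳ (g N))

  opaque
    unfolding _✶_

    -- The sign of y = n - m is the product of the signs of m and n on both cosets. On the odd coset
    -- this leaves a factor Σ (-1)^m q^(2m(m+1)), which cancels under m ↦ -1 - m.
    pP-split : p ✶ P ≋ P ⟨q^ 2 ⟩ ✶ P ⟨q^ 2 ⟩
    pP-split = pointwise λ N → trans
      (theta-product 1 proper-square proper-square p-theta P-theta
        (lookup (theta (theta-stretch 2 P-theta) ∷ theta (theta-stretch 2 pronic-sgn-theta) ∷ []))
        (lookup (theta (theta-stretch 2 P-theta) ∷ theta (theta-x⊛ (theta-stretch 2 pronic-sgn-theta)) ∷ []))
        (λ { zero m n → trans (ℤ.*-identityˡ (sgn (n - + 1 * m))) (sgn-weights m n) ; (suc zero) m n → trans (ℤ.*-identityˡ (sgn (n - + 1 * m))) (sgn-weights m n) })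
        (λ { zero m n → via (+square (+ 1 * n + m + + 0) ⟪+⟫ +square (n - + 1 * m)) (2 ⟪*⟫ +square m ⟪+⟫ 2 ⟪*⟫ +square n)
               (solve 2 (λ m n → (con (+ 1) :* n :+ m :+ con (+ 0)) :* (con (+ 1) :* n :+ m :+ con (+ 0)) :+ (n :- con (+ 1) :* m) :* (n :- con (+ 1) :* m)
                 := con (+ 2) :* (m :* m) :+ con (+ 2) :* (n :* n)) refl m n)
           ; (suc zero) m n → via (+square (+ 1 * n + m + + 1) ⟪+⟫ +square (n - + 1 * m)) (2 ⟪*⟫ +pronic m ⟪+⟫ ⟪suc⟫ (2 ⟪*⟫ +pronic n))
               (solve 2 (λ m n → (con (+ 1) :* n :+ m :+ con (+ 1)) :* (con (+ 1) :* n :+ m :+ con (+ 1)) :+ (n :- con (+ 1) :* m) :* (n :- con (+ 1) :* m)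
                 := con (+ 2) :* (m :* (con 1ℤ :+ m)) :+ (con 1ℤ :+ con (+ 2) :* (n :* (con 1ℤ :+ n)))) refl m n) }) N)
      (vanishing-term {pronic-sgn ⟨q^ 2 ⟩} {P ⟨q^ 2 ⟩ ⊛ P ⟨q^ 2 ⟩} (x ⊛ pronic-sgn ⟨q^ 2 ⟩) N (stretch-0 2 pronic-sgn≋0))
      where open +-*-Solver

  M N : PowerSeries
  M = thetaSeries one e₄
  N = thetaSeries one e₂

  M-theta : IsTheta one e₄ M
  M-theta = thetaSeries-isTheta one e₄ proper-e₄

  N-theta : IsTheta one e₂ N
  N-theta = thetaSeries-isTheta one e₂ proper-e₂

  negM-theta : IsTheta sgn e₄ (neg M)
  negM-theta = theta-cong (λ x → trans (ℤ.*-identityʳ _) (trans (ℤ.^-distribˡ-+-* -1ℤ (square x) (4 ℕ.* pronic x))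
    (trans (cong₂ _*_ (-1^square x) (trans (cong (-1ℤ ^_) (ℕ.*-distribʳ-+ (pronic x) 2 2)) (-1²ⁿ≡1 (2 ℕ.* pronic x)))) (ℤ.*-identityʳ (sgn x)))))
    (λ _ → refl) (theta-neg M-theta)

  negN-theta : IsTheta sgn e₂ (neg N)
  negN-theta = theta-cong (λ x → trans (ℤ.*-identityʳ _) (trans (cong (-1ℤ ^_) (rearrange x)) (trans
    (ℤ.^-distribˡ-+-* -1ℤ (square x) ((square x ℕ.+ pronic x) ℕ.+ (square x ℕ.+ pronic x)))
    (trans (cong₂ _*_ (-1^square x) (-1²ⁿ≡1 (square x ℕ.+ pronic x))) (ℤ.*-identityʳ (sgn x))))))
    (λ _ → refl) (theta-neg N-theta)
    where
    open ℕ-Solver.+-*-Solver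
    rearrange : ∀ x → e₂ x ≡ square x ℕ.+ ((square x ℕ.+ pronic x) ℕ.+ (square x ℕ.+ pronic x))
    rearrange x = solve 2 (λ s t → con 3 :* s :+ con 2 :* t := s :+ ((s :+ t) :+ (s :+ t))) refl (square x) (pronic x)

  opaque
    unfolding _✶_

    -- Again the odd coset has a vanishing factor, with exponent 10m(m+1). The other factor there is
    -- an auxiliary theta series with exponent `e`, introduced only so that the coset has product
    -- form. `N-split` works in the same way.
    M-split : M ✶ neg M ≋ P ⟨q^ 2 ⟩ ⟨q^ 5 ⟩ ✶ neg M ⟨q^ 2 ⟩
    M-split = pointwise λ N → trans
      (theta-product 1 proper-e₄ proper-e₄ M-theta negM-theta
        (lookup (theta (theta-stretch 5 (theta-stretch 2 P-theta)) ∷ theta (theta-stretch 10 pronic-sgn-theta) ∷ []))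
        (lookup (theta (theta-stretch 2 negM-theta) ∷ theta (thetaSeries-isTheta sgn e proper-e) ∷ []))
        (λ { zero m n → trans (ℤ.*-identityˡ (sgn (n - + 1 * m))) (sgn-weights m n) ; (suc zero) m n → trans (ℤ.*-identityˡ (sgn (n - + 1 * m))) (sgn-weights m n) })
        (λ { zero m n → via (+e₄ (+ 1 * n + m + + 0) ⟪+⟫ +e₄ (n - + 1 * m)) (5 ⟪*⟫ (2 ⟪*⟫ +square m) ⟪+⟫ 2 ⟪*⟫ +e₄ n)
               (solve 2 (λ m n → four (con (+ 1) :* n :+ m :+ con (+ 0)) :+ four (n :- con (+ 1) :* m)
                 := con (+ 5) :* (con (+ 2) :* (m :* m)) :+ con (+ 2) :* four n) refl m n)
           ; (suc zero) m n → via (+e₄ (+ 1 * n + m + + 1) ⟪+⟫ +e₄ (n - + 1 * m)) (10 ⟪*⟫ +pronic m ⟪+⟫ ⟪suc⟫ (2 ⟪*⟫ (4 ⟪*⟫ +square (ℤ.suc n) ⟪+⟫ +pronic n)))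
               (solve 2 (λ m n → four (con (+ 1) :* n :+ m :+ con (+ 1)) :+ four (n :- con (+ 1) :* m)
                 := con (+ 10) :* (m :* (con 1ℤ :+ m)) :+ (con 1ℤ :+ con (+ 2) :* (con (+ 4) :* ((con 1ℤ :+ n) :* (con 1ℤ :+ n)) :+ n :* (con 1ℤ :+ n)))) refl m n) }) N)
      (vanishing-term {pronic-sgn ⟨q^ 10 ⟩} {P ⟨q^ 2 ⟩ ⟨q^ 5 ⟩ ⊛ neg M ⟨q^ 2 ⟩} (thetaSeries sgn e) N (stretch-0 10 pronic-sgn≋0))
      where
      open +-*-Solver
      four : ∀ {n} → Polynomial n → Polynomial n
      four x = x :* x :+ con (+ 4) :* (x :* (con 1ℤ :+ x))
      e : ℤ → ℕ
      e n = suc (2 ℕ.* (4 ℕ.* square (ℤ.suc n) ℕ.+ pronic n))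
      proper-e : Proper e
      proper-e = proper-mono proper-pronic λ n →
        ℕ.m≤n⇒m≤1+n (ℕ.m≤n⇒m≤n+o _ (ℕ.m≤n+m (pronic n) (4 ℕ.* square (ℤ.suc n))))

  opaque
    unfolding _✶_

    N-split : N ✶ neg N ≋ P ⟨q^ 2 ⟩ ⟨q^ 5 ⟩ ✶ neg N ⟨q^ 2 ⟩
    N-split = pointwise λ n → trans
      (theta-product 1 proper-e₂ proper-e₂ N-theta negN-theta
        (lookup (theta (theta-stretch 5 (theta-stretch 2 P-theta)) ∷ theta (theta-stretch 10 pronic-sgn-theta) ∷ []))
        (lookup (theta (theta-stretch 2 negN-theta) ∷ theta (thetaSeries-isTheta sgn e proper-e) ∷ []))
        (λ { zero m n → trans (ℤ.*-identityˡ (sgn (n - + 1 * m))) (sgn-weights m n) ; (suc zero) m n → trans (ℤ.*-identityˡ (sgn (n - + 1 * m))) (sgn-weights m n) })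
        (λ { zero m n → via (+e₂ (+ 1 * n + m + + 0) ⟪+⟫ +e₂ (n - + 1 * m)) (5 ⟪*⟫ (2 ⟪*⟫ +square m) ⟪+⟫ 2 ⟪*⟫ +e₂ n)
               (solve 2 (λ m n → two (con (+ 1) :* n :+ m :+ con (+ 0)) :+ two (n :- con (+ 1) :* m)
                 := con (+ 5) :* (con (+ 2) :* (m :* m)) :+ con (+ 2) :* two n) refl m n)
           ; (suc zero) m n → via (+e₂ (+ 1 * n + m + + 1) ⟪+⟫ +e₂ (n - + 1 * m)) (10 ⟪*⟫ +pronic m ⟪+⟫ (3 ⟪+⟫′ (2 ⟪*⟫ (2 ⟪*⟫ +square (ℤ.suc n) ⟪+⟫ 3 ⟪*⟫ +pronic n))))
               (solve 2 (λ m n → two (con (+ 1) :* n :+ m :+ con (+ 1)) :+ two (n :- con (+ 1) :* m)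
                 := con (+ 10) :* (m :* (con 1ℤ :+ m)) :+ (con (+ 3) :+ con (+ 2) :* (con (+ 2) :* ((con 1ℤ :+ n) :* (con 1ℤ :+ n)) :+ con (+ 3) :* (n :* (con 1ℤ :+ n))))) refl m n) }) n)
      (vanishing-term {pronic-sgn ⟨q^ 10 ⟩} {P ⟨q^ 2 ⟩ ⟨q^ 5 ⟩ ⊛ neg N ⟨q^ 2 ⟩} (thetaSeries sgn e) n (stretch-0 10 pronic-sgn≋0))
      where
      open +-*-Solver
      infixl 6 _⟪+⟫′_
      _⟪+⟫′_ : ∀ k {a A} → + a ≡ A → + (k ℕ.+ a) ≡ + k + A
      k ⟪+⟫′ refl = refl
      two : ∀ {n} → Polynomial n → Polynomial n
      two x = con (+ 3) :* (x :* x) :+ con (+ 2) :* (x :* (con 1ℤ :+ x))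
      e : ℤ → ℕ
      e n = 3 ℕ.+ 2 ℕ.* (2 ℕ.* square (ℤ.suc n) ℕ.+ 3 ℕ.* pronic n)
      proper-e : Proper e
      proper-e = proper-mono proper-pronic λ n → ℕ.m≤n⇒m≤o+n 3 (ℕ.m≤n⇒m≤n+o _ (ℕ.m≤n⇒m≤o+n (2 ℕ.* square (ℤ.suc n)) (ℕ.m≤m+n (pronic n) _)))

  opaque
    unfolding _✶_

    -- On coset k the exponent is 5m² + 5n² + 2km + 4kn + k². For k = 1, ..., 4 a translation or
    -- reflection of m and n brings it to 1 plus one value each of `e₂` and `e₄`, so all four cosets
    -- give the same product qMN.
    quintuple-split : p ✶ p ≋ r ✶ r ⊕ ((x ✶ N) ✶ M ⊕ ((x ✶ M) ✶ N ⊕ ((x ✶ M) ✶ N ⊕ (x ✶ N) ✶ M)))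
    quintuple-split = pointwise λ n → trans
      (theta-product 2 proper-square proper-square p-theta p-theta
        (lookup (theta r-theta ∷ theta (theta-x⊛ N-theta) ∷ theta (theta-x⊛ M-theta)
          ∷ theta (theta-x⊛ (theta-~ M-theta)) ∷ theta (theta-x⊛ (theta-~ N-theta)) ∷ []))
        (lookup (theta r-theta ∷ theta M-theta ∷ theta (theta-~ N-theta)
          ∷ theta (theta-suc N-theta) ∷ theta (theta-suc (theta-~ M-theta)) ∷ []))
        (λ { zero m n → refl ; (suc zero) m n → refl ; (suc (suc zero)) m n → refl
           ; (suc (suc (suc zero))) m n → refl ; (suc (suc (suc (suc zero)))) m n → refl })
        (λ { zero m n → via (squares (+ 0) m n) (5 ⟪*⟫ +square m ⟪+⟫ 5 ⟪*⟫ +square n)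
               (solve 2 (λ m n → form (con (+ 0)) m n := con (+ 5) :* (m :* m) :+ con (+ 5) :* (n :* n)) refl m n)
           ; (suc zero) m n → via (squares (+ 1) m n) (⟪suc⟫ (+e₂ m) ⟪+⟫ +e₄ n)
               (solve 2 (λ m n → form (con (+ 1)) m n := con 1ℤ :+ two m :+ four n) refl m n)
           ; (suc (suc zero)) m n → via (squares (+ 2) m n) (⟪suc⟫ (+e₄ m) ⟪+⟫ +e₂~ n)
               (solve 2 (λ m n → form (con (+ 2)) m n := con 1ℤ :+ four m :+ two (con -1ℤ :- n)) refl m n)
           ; (suc (suc (suc zero))) m n → via (squares (+ 3) m n) (⟪suc⟫ (+e₄~ m) ⟪+⟫ +e₂ (ℤ.suc n))
               (solve 2 (λ m n → form (con (+ 3)) m n := con 1ℤ :+ four (con -1ℤ :- m) :+ two (con 1ℤ :+ n)) refl m n)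
           ; (suc (suc (suc (suc zero)))) m n → via (squares (+ 4) m n) (⟪suc⟫ (+e₂~ m) ⟪+⟫ +e₄~ (ℤ.suc n))
               (solve 2 (λ m n → form (con (+ 4)) m n := con 1ℤ :+ two (con -1ℤ :- m) :+ four (con -1ℤ :- (con 1ℤ :+ n))) refl m n) }) n)
      (cong (λ t → (r ⊛ r) n + (((x ⊛ N) ⊛ M) n + (((x ⊛ M) ⊛ N) n + (((x ⊛ M) ⊛ N) n + t)))) (ℤ.+-identityʳ _))
      where
      open +-*-Solver
      r-theta : IsTheta one (λ x → 5 ℕ.* square x) r
      r-theta = theta-stretch 5 p-theta
      two four : ∀ {n} → Polynomial n → Polynomial n
      two x = con (+ 3) :* (x :* x) :+ con (+ 2) :* (x :* (con 1ℤ :+ x))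
      four x = x :* x :+ con (+ 4) :* (x :* (con 1ℤ :+ x))
      form : ∀ {n} → Polynomial n → Polynomial n → Polynomial n → Polynomial n
      form k m n = (con (+ 2) :* n :+ m :+ k) :* (con (+ 2) :* n :+ m :+ k) :+ (n :- con (+ 2) :* m) :* (n :- con (+ 2) :* m)
      squares : ∀ k m n → + (square (+ 2 * n + m + k) ℕ.+ square (n - + 2 * m))
                          ≡ (+ 2 * n + m + k) * (+ 2 * n + m + k) + (n - + 2 * m) * (n - + 2 * m)
      squares k m n = +square (+ 2 * n + m + k) ⟪+⟫ +square (n - + 2 * m)
      +e₂~ : ∀ x → + e₂ (~ x) ≡ + 3 * ((-1ℤ - x) * (-1ℤ - x)) + + 2 * ((-1ℤ - x) * (1ℤ + (-1ℤ - x)))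
      +e₂~ x = trans (+e₂ (~ x)) (cong (λ y → + 3 * (y * y) + + 2 * (y * (1ℤ + y))) (~≡-1- x))
      +e₄~ : ∀ x → + e₄ (~ x) ≡ (-1ℤ - x) * (-1ℤ - x) + + 4 * ((-1ℤ - x) * (1ℤ + (-1ℤ - x)))
      +e₄~ x = trans (+e₄ (~ x)) (cong (λ y → y * y + + 4 * (y * (1ℤ + y))) (~≡-1- x))

open ThetaIdentities

-- Polynomial expressions, read both in a ring and in the syntax of the ring solver.
module Forms {a} {A : Set a} (_+ᴬ_ _*ᴬ_ : A → A → A) (-ᴬ_ : A → A) (#_ : ℕ → A) where

  infixl 6 _+_ _-_
  infixl 7 _*_
  infixr 8 _^_
  infix  8 -_

  _+_ _*_ _-_ : A → A → A
  _+_ = _+ᴬ_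
  _*_ = _*ᴬ_
  x - y = x +ᴬ (-ᴬ y)

  -_ : A → A
  -_ = -ᴬ_

  _^_ : A → ℕ → A
  x ^ zero        = # 1
  x ^ suc zero    = x
  x ^ suc (suc n) = x *ᴬ (x ^ suc n)

  -- K and L vanish at p, P, r, Q = φ(q), φ(-q), φ(q⁵), φ(-q⁵).  W₁ and W₂ generate,
  -- together with K and L, the part of the ideal quotient (K, L) : E that is needed.
  -- The cofactors in the identities below come from linear algebra in each degree.
  K L W₁ W₂ : A → A → A → A → A
  K p P r Q = p ^ 2 * P ^ 2 + # 5 * r ^ 2 * Q ^ 2 - p ^ 2 * Q ^ 2 - # 4 * p * P * r * Q - P ^ 2 * r ^ 2
  L p P r Q = p ^ 4 + P ^ 4 + # 5 * r ^ 4 + # 5 * Q ^ 4 - # 6 * p ^ 2 * r ^ 2 - # 6 * P ^ 2 * Q ^ 2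
  W₁ p P r Q = # 4 * p ^ 2 * r ^ 3 * Q + p * P ^ 5 + # 5 * p * P * Q ^ 4 + # 14 * P ^ 2 * r * Q ^ 3 + # 5 * r * Q ^ 5
               - # 6 * p * P ^ 3 * Q ^ 2 - # 3 * P ^ 4 * r * Q - # 20 * r ^ 5 * Q
  W₂ p P r Q = # 4 * p ^ 2 * P * r ^ 3 + # 2 * p * P ^ 2 * Q ^ 3 + # 6 * P ^ 3 * r * Q ^ 2
               - p * P ^ 4 * Q - p * Q ^ 5 - P ^ 5 * r - # 4 * P * r ^ 5 - # 5 * P * r * Q ^ 4

  -- Identically `E ^ 2 = G * G₅ - K`, so where `K` vanishes `G * G₅` is a square.
  G G₅ E : A → A → A → A → A
  G  p P r Q = p * P - r * Q
  G₅ p P r Q = p * P - # 5 * r * Q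
  E  p P r Q = P * r - p * Q

  -- The values of 2PΦ and of 8PQA for the series Φ and A of ModularRelations.
  T : A → A → A → A → A
  T p P r Q = # 5 * r ^ 2 * Q - p ^ 2 * Q - # 2 * p * P * r

  W : A → A → A
  W P Q = # 7 * P ^ 4 * Q ^ 2 + # 17 * Q ^ 6 - P ^ 6 - # 15 * P ^ 2 * Q ^ 4

-- Polynomial consequences of the relations, certified by explicit cofactors.

module Relations {c ℓ} (R : CommutativeRing c ℓ)
                 (ι : CommutativeRing.rawRing ℤ.+-*-commutativeRing -Raw-AlmostCommutative⟶ fromCommutativeRing R) where

  open CommutativeRing R using (Carrier; _≈_; 0#; +-cong; +-congˡ; +-identityˡ; +-identityʳ; *-congˡ; *-cong; zeroʳ; -‿inverseʳ; reflexive; +-congʳ; -‿cong)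
    renaming (trans to ≈-trans; sym to ≈-sym; refl to ≈-refl)
  open _-Raw-AlmostCommutative⟶_ ι using (1-homo) renaming (⟦_⟧ to constant)

  module Solver = Algebra.Solver.Ring (CommutativeRing.rawRing ℤ.+-*-commutativeRing) (fromCommutativeRing R) ι
    (λ a b → map (λ a≡b → reflexive (cong constant a≡b)) (dec⇒maybe (a ℤ.≟ b)))
  open Solver using (Polynomial; solve; _:=_; _:+_; _:*_; :-_; con)

  #_ : ℕ → Carrier
  # n = constant (+ n)

  open Forms (CommutativeRing._+_ R) (CommutativeRing._*_ R) (CommutativeRing.-_ R) #_ public

  open module Poly {n} = Forms {A = Polynomial n} _:+_ _:*_ :-_ (λ k → con (+ k)) public
    renaming (_+_ to _⊹_; _*_ to _⊠_; _-_ to _⊟_; -_ to ⊟_; _^_ to _↑_; K to K′; L to L′; W₁ to W₁′; W₂ to W₂′; G to G′; G₅ to G₅′; E to E′; T to T′; W to W′)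

  :#_ : ∀ {n} → ℕ → Polynomial n
  :# k = con (+ k)

  private variable
    a b t : Carrier

  infixr 6 _⊕⁰_
  infix  7 _⊡_ _⊡⁰_

  -- In the lemmas below the ring solver checks that the two sides differ by a combination of
  -- hypotheses with explicit cofactors, and `_⊡_`, `_⊡⁰_`, `_⊕⁰_` make that combination zero. In
  -- `_ ⊡ h` the cofactor is recovered by unification with the solved identity.
  _⊡_ : ∀ c → a ≈ b → c * (a - b) ≈ 0#
  c ⊡ a≈b = ≈-trans (*-congˡ (≈-trans (+-congʳ a≈b) (-‿inverseʳ _))) (zeroʳ c)

  _⊡⁰_ : ∀ c → a ≈ 0# → c * a ≈ 0#
  c ⊡⁰ a≈0 = ≈-trans (*-congˡ a≈0) (zeroʳ c)

  _⊕⁰_ : a ≈ 0# → b ≈ 0# → a + b ≈ 0#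
  a≈0 ⊕⁰ b≈0 = ≈-trans (+-cong a≈0 b≈0) (+-identityˡ 0#)

  linear : a ≈ b + t → t ≈ 0# → a ≈ b
  linear a≈b+t t≈0 = ≈-trans a≈b+t (≈-trans (+-congˡ t≈0) (+-identityʳ _))

  difference≈0 : a ≈ b → a - b ≈ 0#
  difference≈0 a≈b = ≈-trans (+-congʳ a≈b) (-‿inverseʳ _)

  square-difference : a * a ≈ b * b → (a + b) * (a - b) ≈ 0#
  square-difference {a} {b} a²≈b² = ≈-trans
    (solve 2 (λ a b → (a ⊹ b) ⊠ (a ⊟ b) := a ⊠ a ⊟ b ⊠ b) ≈-refl a b) (difference≈0 a²≈b²)

  K≈0 : ∀ p P r Q u v w α γ →
        p * p ≈ r * r + u → P * P ≈ Q * Q - v → p * P ≈ α * α → r * Q ≈ γ * γ → α * α ≈ γ * γ - w → u * v ≈ # 4 * (γ * γ) * w →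
        K p P r Q ≈ 0#
  K≈0 p P r Q u v w α γ h₁ h₂ h₃ h₄ h₅ h₆ = ≈-trans
    (solve 9 (λ p P r Q u v w α γ → K′ p P r Q :=
      (P ↑ 2 ⊟ Q ↑ 2) ⊠ (p ⊠ p ⊟ (r ⊠ r ⊹ u)) ⊹ (u ⊠ (P ⊠ P ⊟ (Q ⊠ Q ⊟ v)) ⊹ ((⊟ (:# 4 ⊠ γ ↑ 2)) ⊠ (p ⊠ P ⊟ α ⊠ α)
      ⊹ ((:# 4 ⊠ γ ↑ 2 ⊟ :# 4 ⊠ (p ⊠ P ⊟ r ⊠ Q)) ⊠ (r ⊠ Q ⊟ γ ⊠ γ) ⊹ ((⊟ (:# 4 ⊠ γ ↑ 2)) ⊠ (α ⊠ α ⊟ (γ ⊠ γ ⊟ w))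
      ⊹ (⊟ (:# 1)) ⊠ (u ⊠ v ⊟ :# 4 ⊠ (γ ⊠ γ) ⊠ w)))))) ≈-refl p P r Q u v w α γ)
    (_ ⊡ h₁ ⊕⁰ _ ⊡ h₂ ⊕⁰ _ ⊡ h₃ ⊕⁰ _ ⊡ h₄ ⊕⁰ _ ⊡ h₅ ⊕⁰ _ ⊡ h₆)

  squares-sum : ∀ p P a t → p * p ≈ a * a + t → P * P ≈ a * a - t → # 2 * a ^ 2 ≈ p ^ 2 + P ^ 2
  squares-sum p P a t h₁ h₂ = linear
    (solve 4 (λ p P a t → :# 2 ⊠ a ↑ 2 := p ↑ 2 ⊹ P ↑ 2
      ⊹ ((⊟ (:# 1)) ⊠ (p ⊠ p ⊟ (a ⊠ a ⊹ t)) ⊹ (⊟ (:# 1)) ⊠ (P ⊠ P ⊟ (a ⊠ a ⊟ t)))) ≈-refl p P a t)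
    (_ ⊡ h₁ ⊕⁰ _ ⊡ h₂)

  -- p⁴ - P⁴ = (p² + P²)(p² - P²) = 2a² · 2xs² = x(2as)², and e² = 2as. In classical form: φ(q)⁴ -
  -- φ(-q)⁴ = 16qψ(q²)⁴.
  fourth-powers : ∀ p P a x s e → p * p ≈ a * a + x * s * s → P * P ≈ a * a - x * s * s → e * e ≈ a * s + s * a →
                  x * e ^ 4 ≈ p ^ 4 - P ^ 4
  fourth-powers p P a x s e h₁ h₂ h₃ = linear
    (solve 6 (λ p P a x s e → x ⊠ e ↑ 4 := p ↑ 4 ⊟ P ↑ 4
      ⊹ (x ⊠ (e ⊠ e ⊹ :# 2 ⊠ a ⊠ s) ⊠ (e ⊠ e ⊟ (a ⊠ s ⊹ s ⊠ a)) ⊹ ((⊟ (p ⊠ p ⊹ a ⊠ a ⊹ x ⊠ s ⊠ s)) ⊠ (p ⊠ p ⊟ (a ⊠ a ⊹ x ⊠ s ⊠ s))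
      ⊹ (P ⊠ P ⊹ a ⊠ a ⊟ x ⊠ s ⊠ s) ⊠ (P ⊠ P ⊟ (a ⊠ a ⊟ x ⊠ s ⊠ s))))) ≈-refl p P a x s e)
    (_ ⊡ h₃ ⊕⁰ _ ⊡ h₁ ⊕⁰ _ ⊡ h₂)

  -- In (pQ + Pr)² the relation `K` trades p²Q² + P²r² for a polynomial in pP and rQ, that is, in α²
  -- and γ².
  Φ⁻₂²≈ : ∀ p P r Q α γ Φ → K p P r Q ≈ 0# → p * P ≈ α * α → r * Q ≈ γ * γ → # 2 * Φ ≈ p * Q + P * r →
          # 4 * Φ ^ 2 ≈ α ^ 4 - # 2 * α ^ 2 * γ ^ 2 + # 5 * γ ^ 4
  Φ⁻₂²≈ p P r Q α γ Φ k h₃ h₄ h₁ = linear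
    (solve 7 (λ p P r Q α γ Φ → :# 4 ⊠ Φ ↑ 2 := α ↑ 4 ⊟ :# 2 ⊠ α ↑ 2 ⊠ γ ↑ 2 ⊹ :# 5 ⊠ γ ↑ 4
      ⊹ ((⊟ (:# 1)) ⊠ K′ p P r Q ⊹ ((:# 2 ⊠ Φ ⊹ p ⊠ Q ⊹ P ⊠ r) ⊠ (:# 2 ⊠ Φ ⊟ (p ⊠ Q ⊹ P ⊠ r))
      ⊹ ((p ⊠ P ⊹ α ↑ 2 ⊟ :# 2 ⊠ r ⊠ Q) ⊠ (p ⊠ P ⊟ α ⊠ α) ⊹ (:# 5 ⊠ (r ⊠ Q ⊹ γ ↑ 2) ⊟ :# 2 ⊠ α ↑ 2) ⊠ (r ⊠ Q ⊟ γ ⊠ γ)))))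
      ≈-refl p P r Q α γ Φ)
    (_ ⊡⁰ k ⊕⁰ _ ⊡ h₁ ⊕⁰ _ ⊡ h₃ ⊕⁰ _ ⊡ h₄)

  -- (pr + PQ)² + (pQ + Pr)² = (p² + P²)(r² + Q²) + 4pPrQ, and every factor on the right is known as
  -- a series in q².
  Φ₂²+Φ⁻₂²≈ : ∀ p P r Q a c α γ Φ Φ⁻ → # 2 * a ^ 2 ≈ p ^ 2 + P ^ 2 → # 2 * c ^ 2 ≈ r ^ 2 + Q ^ 2 →
              p * P ≈ α * α → r * Q ≈ γ * γ → # 2 * Φ ≈ p * r + P * Q → # 2 * Φ⁻ ≈ p * Q + P * r →
              # 4 * (Φ ^ 2 + Φ⁻ ^ 2) ≈ # 4 * (a ^ 2 * c ^ 2 + α ^ 2 * γ ^ 2)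
  Φ₂²+Φ⁻₂²≈ p P r Q a c α γ Φ Φ⁻ h₁ h₂ h₃ h₄ h₅ h₆ = linear
    (solve 10 (λ p P r Q a c α γ Φ Φ⁻ → :# 4 ⊠ (Φ ↑ 2 ⊹ Φ⁻ ↑ 2) := :# 4 ⊠ (a ↑ 2 ⊠ c ↑ 2 ⊹ α ↑ 2 ⊠ γ ↑ 2)
      ⊹ ((⊟ (:# 2 ⊠ c ↑ 2)) ⊠ (:# 2 ⊠ a ↑ 2 ⊟ (p ↑ 2 ⊹ P ↑ 2)) ⊹ ((⊟ (p ↑ 2 ⊹ P ↑ 2)) ⊠ (:# 2 ⊠ c ↑ 2 ⊟ (r ↑ 2 ⊹ Q ↑ 2))
      ⊹ (:# 4 ⊠ r ⊠ Q ⊠ (p ⊠ P ⊟ α ⊠ α) ⊹ (:# 4 ⊠ α ↑ 2 ⊠ (r ⊠ Q ⊟ γ ⊠ γ)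
      ⊹ ((:# 2 ⊠ Φ ⊹ p ⊠ r ⊹ P ⊠ Q) ⊠ (:# 2 ⊠ Φ ⊟ (p ⊠ r ⊹ P ⊠ Q)) ⊹ (:# 2 ⊠ Φ⁻ ⊹ p ⊠ Q ⊹ P ⊠ r) ⊠ (:# 2 ⊠ Φ⁻ ⊟ (p ⊠ Q ⊹ P ⊠ r))))))))
      ≈-refl p P r Q a c α γ Φ Φ⁻)
    (_ ⊡ h₁ ⊕⁰ _ ⊡ h₂ ⊕⁰ _ ⊡ h₃ ⊕⁰ _ ⊡ h₄ ⊕⁰ _ ⊡ h₅ ⊕⁰ _ ⊡ h₆)

  L≈0 : ∀ p P r Q Φ Φ⁻ → # 4 * Φ ^ 2 ≈ p ^ 4 - # 2 * p ^ 2 * r ^ 2 + # 5 * r ^ 4 →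
        # 4 * Φ⁻ ^ 2 ≈ P ^ 4 - # 2 * P ^ 2 * Q ^ 2 + # 5 * Q ^ 4 →
        # 4 * (Φ ^ 2 + Φ⁻ ^ 2) ≈ # 4 * (p ^ 2 * r ^ 2 + P ^ 2 * Q ^ 2) → L p P r Q ≈ 0#
  L≈0 p P r Q Φ Φ⁻ h₁ h₂ h₃ = ≈-trans
    (solve 6 (λ p P r Q Φ Φ⁻ → L′ p P r Q :=
      (⊟ (:# 1)) ⊠ (:# 4 ⊠ Φ ↑ 2 ⊟ (p ↑ 4 ⊟ :# 2 ⊠ p ↑ 2 ⊠ r ↑ 2 ⊹ :# 5 ⊠ r ↑ 4))
      ⊹ ((⊟ (:# 1)) ⊠ (:# 4 ⊠ Φ⁻ ↑ 2 ⊟ (P ↑ 4 ⊟ :# 2 ⊠ P ↑ 2 ⊠ Q ↑ 2 ⊹ :# 5 ⊠ Q ↑ 4))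
      ⊹ :# 1 ⊠ (:# 4 ⊠ (Φ ↑ 2 ⊹ Φ⁻ ↑ 2) ⊟ :# 4 ⊠ (p ↑ 2 ⊠ r ↑ 2 ⊹ P ↑ 2 ⊠ Q ↑ 2)))) ≈-refl p P r Q Φ Φ⁻)
    (_ ⊡ h₁ ⊕⁰ _ ⊡ h₂ ⊕⁰ _ ⊡ h₃)

  [2PΦ]²≈T² : ∀ p P r Q Φ → K p P r Q ≈ 0# → # 4 * Φ ^ 2 ≈ p ^ 4 - # 2 * p ^ 2 * r ^ 2 + # 5 * r ^ 4 →
              (# 2 * P * Φ) * (# 2 * P * Φ) ≈ T p P r Q * T p P r Q
  [2PΦ]²≈T² p P r Q Φ k h = linear
    (solve 5 (λ p P r Q Φ → (:# 2 ⊠ P ⊠ Φ) ⊠ (:# 2 ⊠ P ⊠ Φ) := T′ p P r Q ⊠ T′ p P r Q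
      ⊹ (P ↑ 2 ⊠ (:# 4 ⊠ Φ ↑ 2 ⊟ (p ↑ 4 ⊟ :# 2 ⊠ p ↑ 2 ⊠ r ↑ 2 ⊹ :# 5 ⊠ r ↑ 4)) ⊹ (p ↑ 2 ⊟ :# 5 ⊠ r ↑ 2) ⊠ K′ p P r Q))
      ≈-refl p P r Q Φ)
    (_ ⊡ h ⊕⁰ _ ⊡⁰ k)

  -- The factor `E` cannot be dropped: at p = r, P = Q both `K` and `L` vanish, while `W₁` is
  -- -16rQ(r⁴ - Q⁴).
  EW₁≈0 : ∀ p P r Q → K p P r Q ≈ 0# → L p P r Q ≈ 0# → E p P r Q * W₁ p P r Q ≈ 0#
  EW₁≈0 p P r Q k l = ≈-trans
    (solve 4 (λ p P r Q → E′ p P r Q ⊠ W₁′ p P r Q :=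
      (:# 5 ⊠ p ⊠ r ↑ 3 ⊹ :# 5 ⊠ P ⊠ Q ↑ 3 ⊟ p ↑ 3 ⊠ r ⊟ P ↑ 3 ⊠ Q) ⊠ K′ p P r Q
      ⊹ (p ⊠ P ↑ 2 ⊠ r ⊟ p ⊠ r ⊠ Q ↑ 2 ⊟ :# 4 ⊠ P ⊠ r ↑ 2 ⊠ Q) ⊠ L′ p P r Q) ≈-refl p P r Q)
    (_ ⊡⁰ k ⊕⁰ _ ⊡⁰ l)

  EW₂≈0 : ∀ p P r Q → K p P r Q ≈ 0# → L p P r Q ≈ 0# → E p P r Q * W₂ p P r Q ≈ 0#
  EW₂≈0 p P r Q k l = ≈-trans
    (solve 4 (λ p P r Q → E′ p P r Q ⊠ W₂′ p P r Q :=
      (p ↑ 2 ⊠ r ↑ 2 ⊹ P ↑ 2 ⊠ Q ↑ 2 ⊟ r ↑ 4 ⊟ Q ↑ 4) ⊠ K′ p P r Q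
      ⊹ (r ↑ 2 ⊠ Q ↑ 2 ⊟ P ↑ 2 ⊠ r ↑ 2) ⊠ L′ p P r Q) ≈-refl p P r Q)
    (_ ⊡⁰ k ⊕⁰ _ ⊡⁰ l)

  -- Multiplying F + F⁻ by α² = pP gives pQ⁵ + Pr⁵. This is a combination of pQ + Pr and pr + PQ
  -- with coefficients in r² + Q² = 2c² and rQ = γ², hence a series in q² throughout.
  even-part : ∀ p P r Q c α γ Φ Φ⁻ A F F⁻ → # 2 * c ^ 2 ≈ r ^ 2 + Q ^ 2 → p * P ≈ α * α → r * Q ≈ γ * γ →
              # 2 * Φ ≈ p * r + P * Q → # 2 * Φ⁻ ≈ p * Q + P * r → P * F ≈ Q ^ 5 → p * F⁻ ≈ r ^ 5 → # 2 * A ≈ F + F⁻ →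
              # 2 * (α ^ 2 * A) ≈ # 2 * ((# 4 * c ^ 4 - γ ^ 4) * Φ⁻ - # 2 * c ^ 2 * γ ^ 2 * Φ)
  even-part p P r Q c α γ Φ Φ⁻ A F F⁻ h₂ h₃ h₄ h₅ h₆ h₇ h₈ h₉ = linear
    (solve 12 (λ p P r Q c α γ Φ Φ⁻ A F F⁻ → :# 2 ⊠ (α ↑ 2 ⊠ A) := :# 2 ⊠ ((:# 4 ⊠ c ↑ 4 ⊟ γ ↑ 4) ⊠ Φ⁻ ⊟ :# 2 ⊠ c ↑ 2 ⊠ γ ↑ 2 ⊠ Φ)
      ⊹ (α ↑ 2 ⊠ (:# 2 ⊠ A ⊟ (F ⊹ F⁻)) ⊹ ((⊟ (F ⊹ F⁻)) ⊠ (p ⊠ P ⊟ α ⊠ α) ⊹ (p ⊠ (P ⊠ F ⊟ Q ↑ 5) ⊹ (P ⊠ (p ⊠ F⁻ ⊟ r ↑ 5)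
      ⊹ ((⊟ (:# 4 ⊠ c ↑ 4 ⊟ γ ↑ 4)) ⊠ (:# 2 ⊠ Φ⁻ ⊟ (p ⊠ Q ⊹ P ⊠ r)) ⊹ (:# 2 ⊠ c ↑ 2 ⊠ γ ↑ 2 ⊠ (:# 2 ⊠ Φ ⊟ (p ⊠ r ⊹ P ⊠ Q))
      ⊹ (((p ⊠ r ⊹ P ⊠ Q) ⊠ γ ↑ 2 ⊟ (p ⊠ Q ⊹ P ⊠ r) ⊠ (:# 2 ⊠ c ↑ 2 ⊹ r ↑ 2 ⊹ Q ↑ 2)) ⊠ (:# 2 ⊠ c ↑ 2 ⊟ (r ↑ 2 ⊹ Q ↑ 2))
      ⊹ (⊟ ((p ⊠ Q ⊹ P ⊠ r) ⊠ (r ⊠ Q ⊹ γ ↑ 2) ⊹ (p ⊠ r ⊹ P ⊠ Q) ⊠ (r ↑ 2 ⊹ Q ↑ 2))) ⊠ (r ⊠ Q ⊟ γ ⊠ γ)))))))))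
      ≈-refl p P r Q c α γ Φ Φ⁻ A F F⁻)
    (_ ⊡ h₉ ⊕⁰ _ ⊡ h₃ ⊕⁰ _ ⊡ h₇ ⊕⁰ _ ⊡ h₈ ⊕⁰ _ ⊡ h₆ ⊕⁰ _ ⊡ h₅ ⊕⁰ _ ⊡ h₂ ⊕⁰ _ ⊡ h₄)

  module _ p P r Q (k : K p P r Q ≈ 0#) (l : L p P r Q ≈ 0#) (w₁ : W₁ p P r Q ≈ 0#) (w₂ : W₂ p P r Q ≈ 0#) where

    -- Eliminates `Φ` and `Φ⁻`; the common factor `p * P ^ 2` collects the denominators P, p and P²
    -- of the three hypotheses.
    A≈W : ∀ A Φ Φ⁻ → # 2 * P * Φ ≈ T p P r Q → # 2 * p * Φ⁻ ≈ T P p Q r →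
          P ^ 2 * A ≈ (# 4 * r ^ 4 - Q ^ 4) * Φ⁻ - # 2 * r ^ 2 * Q ^ 2 * Φ →
          (p * P ^ 2) * (# 8 * P * Q * A) ≈ (p * P ^ 2) * W P Q
    A≈W A Φ Φ⁻ h₁ h₂ h₃ = linear
      (solve 7 (λ p P r Q A Φ Φ⁻ → (p ⊠ P ↑ 2) ⊠ (:# 8 ⊠ P ⊠ Q ⊠ A) := (p ⊠ P ↑ 2) ⊠ W′ P Q
        ⊹ (:# 8 ⊠ p ⊠ P ⊠ Q ⊠ (P ↑ 2 ⊠ A ⊟ ((:# 4 ⊠ r ↑ 4 ⊟ Q ↑ 4) ⊠ Φ⁻ ⊟ :# 2 ⊠ r ↑ 2 ⊠ Q ↑ 2 ⊠ Φ))
        ⊹ (:# 4 ⊠ Q ⊠ P ⊠ (:# 4 ⊠ r ↑ 4 ⊟ Q ↑ 4) ⊠ (:# 2 ⊠ p ⊠ Φ⁻ ⊟ T′ P p Q r)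
        ⊹ ((⊟ (:# 8 ⊠ p ⊠ Q ⊠ r ↑ 2 ⊠ Q ↑ 2)) ⊠ (:# 2 ⊠ P ⊠ Φ ⊟ T′ p P r Q)
        ⊹ ((:# 5 ⊠ p ⊠ P ↑ 2 ⊠ r ↑ 2 ⊹ :# 16 ⊠ P ⊠ r ↑ 3 ⊠ Q ⊟ p ↑ 3 ⊠ P ↑ 2 ⊟ p ↑ 3 ⊠ Q ↑ 2 ⊟ :# 4 ⊠ p ↑ 2 ⊠ P ⊠ r ⊠ Q ⊟ :# 7 ⊠ p ⊠ r ↑ 2 ⊠ Q ↑ 2) ⊠ K′ p P r Q
        ⊹ ((p ⊠ P ↑ 4 ⊟ p ⊠ Q ↑ 4 ⊟ :# 8 ⊠ P ⊠ r ⊠ Q ↑ 3) ⊠ L′ p P r Q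
        ⊹ ((⊟ (P ⊠ Q ↑ 2)) ⊠ W₁′ p P r Q ⊹ (⊟ (:# 5 ⊠ Q ↑ 3)) ⊠ W₂′ p P r Q))))))) ≈-refl p P r Q A Φ Φ⁻)
      (_ ⊡ h₃ ⊕⁰ _ ⊡ h₂ ⊕⁰ _ ⊡ h₁ ⊕⁰ _ ⊡⁰ k ⊕⁰ _ ⊡⁰ l ⊕⁰ _ ⊡⁰ w₁ ⊕⁰ _ ⊡⁰ w₂)

    A-difference : ∀ A A⁻ → # 8 * P * Q * A ≈ W P Q → # 8 * p * r * A⁻ ≈ W p r →
      (# 4 * p * P * r * Q) * (# 2 * (A - A⁻)) ≈ (# 4 * p * P * r * Q) * (# 5 * (p ^ 3 * r - P ^ 3 * Q) - # 11 * (p * r ^ 3 - P * Q ^ 3))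
    A-difference A A⁻ h₁ h₂ = linear
      (solve 6 (λ p P r Q A A⁻ → (:# 4 ⊠ p ⊠ P ⊠ r ⊠ Q) ⊠ (:# 2 ⊠ (A ⊟ A⁻)) :=
        (:# 4 ⊠ p ⊠ P ⊠ r ⊠ Q) ⊠ (:# 5 ⊠ (p ↑ 3 ⊠ r ⊟ P ↑ 3 ⊠ Q) ⊟ :# 11 ⊠ (p ⊠ r ↑ 3 ⊟ P ⊠ Q ↑ 3))
        ⊹ (p ⊠ r ⊠ (:# 8 ⊠ P ⊠ Q ⊠ A ⊟ W′ P Q) ⊹ ((⊟ (P ⊠ Q)) ⊠ (:# 8 ⊠ p ⊠ r ⊠ A⁻ ⊟ W′ p r)
        ⊹ ((:# 5 ⊠ P ⊠ Q ↑ 3 ⊟ P ↑ 3 ⊠ Q) ⊠ K′ p P r Q ⊹ ((p ↑ 2 ⊠ P ⊠ Q ⊟ :# 21 ⊠ P ⊠ r ↑ 2 ⊠ Q) ⊠ L′ p P r Q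
        ⊹ ((⊟ (P ⊠ r)) ⊠ W₁′ p P r Q ⊹ (⊟ (:# 17 ⊠ r ⊠ Q)) ⊠ W₂′ p P r Q)))))) ≈-refl p P r Q A A⁻)
      (_ ⊡ h₁ ⊕⁰ _ ⊡ h₂ ⊕⁰ _ ⊡⁰ k ⊕⁰ _ ⊡⁰ l ⊕⁰ _ ⊡⁰ w₁ ⊕⁰ _ ⊡⁰ w₂)

    -- After the fourth powers are replaced, what has to hold is (r⁴ - Q⁴)G₅² = (p⁴ - P⁴)G², a
    -- consequence of the four relations. It is the link between the ψ-type series `e`, `g` and the
    -- φ-type series.
    [g²G₅]²≈[e²G]² : ∀ x e g → x * e ^ 4 ≈ p ^ 4 - P ^ 4 → x * g ^ 4 ≈ r ^ 4 - Q ^ 4 →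
      x * ((g ^ 2 * G₅ p P r Q) * (g ^ 2 * G₅ p P r Q)) ≈ x * ((e ^ 2 * G p P r Q) * (e ^ 2 * G p P r Q))
    [g²G₅]²≈[e²G]² x e g h₁ h₂ = linear
      (solve 7 (λ p P r Q x e g → x ⊠ ((g ↑ 2 ⊠ G₅′ p P r Q) ⊠ (g ↑ 2 ⊠ G₅′ p P r Q)) := x ⊠ ((e ↑ 2 ⊠ G′ p P r Q) ⊠ (e ↑ 2 ⊠ G′ p P r Q))
        ⊹ (G₅′ p P r Q ↑ 2 ⊠ (x ⊠ g ↑ 4 ⊟ (r ↑ 4 ⊟ Q ↑ 4)) ⊹ ((⊟ (G′ p P r Q ↑ 2)) ⊠ (x ⊠ e ↑ 4 ⊟ (p ↑ 4 ⊟ P ↑ 4))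
        ⊹ ((:# 3 ⊠ p ↑ 2 ⊠ r ↑ 2 ⊹ P ↑ 4 ⊹ :# 2 ⊠ P ↑ 2 ⊠ Q ↑ 2 ⊟ p ↑ 4 ⊟ :# 5 ⊠ Q ↑ 4) ⊠ K′ p P r Q
        ⊹ ((r ↑ 2 ⊠ Q ↑ 2 ⊟ p ↑ 2 ⊠ Q ↑ 2 ⊟ :# 2 ⊠ p ⊠ P ⊠ r ⊠ Q ⊟ :# 4 ⊠ P ↑ 2 ⊠ r ↑ 2) ⊠ L′ p P r Q
        ⊹ ((⊟ (r ⊠ Q)) ⊠ W₁′ p P r Q ⊹ (⊟ (:# 5 ⊠ P ⊠ r)) ⊠ W₂′ p P r Q)))))) ≈-refl p P r Q x e g)
      (_ ⊡ h₂ ⊕⁰ _ ⊡ h₁ ⊕⁰ _ ⊡⁰ k ⊕⁰ _ ⊡⁰ l ⊕⁰ _ ⊡⁰ w₁ ⊕⁰ _ ⊡⁰ w₂)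

    -- Multiply the hypothesis by `G` and replace `G * G₅` by `E ^ 2`. A second square root then
    -- makes g/e equal to G/E, rational in p, P, r, Q.
    [gE]²≈[eG]² : ∀ e g → g ^ 2 * G₅ p P r Q ≈ e ^ 2 * G p P r Q →
      (g * E p P r Q) * (g * E p P r Q) ≈ (e * G p P r Q) * (e * G p P r Q)
    [gE]²≈[eG]² e g h = linear
      (solve 6 (λ p P r Q e g → (g ⊠ E′ p P r Q) ⊠ (g ⊠ E′ p P r Q) := (e ⊠ G′ p P r Q) ⊠ (e ⊠ G′ p P r Q)
        ⊹ ((⊟ (g ↑ 2)) ⊠ K′ p P r Q ⊹ G′ p P r Q ⊠ (g ↑ 2 ⊠ G₅′ p P r Q ⊟ e ↑ 2 ⊠ G′ p P r Q))) ≈-refl p P r Q e g)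
      (_ ⊡⁰ k ⊕⁰ _ ⊡ h)

    -- With g/e = G/E, the square of 16PrB becomes 16Pr²Q⁵(r⁴ - Q⁴)G/E; this identity turns that
    -- into the perfect square of Q²G(P² - Q²).
    star : # 16 * P * Q * r ^ 2 * (r ^ 4 - Q ^ 4) ≈ G p P r Q * E p P r Q * (P ^ 2 - Q ^ 2) ^ 2
    star = linear
      (solve 4 (λ p P r Q → :# 16 ⊠ P ⊠ Q ⊠ r ↑ 2 ⊠ (r ↑ 4 ⊟ Q ↑ 4) := G′ p P r Q ⊠ E′ p P r Q ⊠ (P ↑ 2 ⊟ Q ↑ 2) ↑ 2
        ⊹ ((P ↑ 3 ⊠ Q ⊟ P ⊠ Q ↑ 3) ⊠ K′ p P r Q ⊹ ((⊟ (P ⊠ r)) ⊠ W₁′ p P r Q ⊹ r ⊠ Q ⊠ W₂′ p P r Q))) ≈-refl p P r Q)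
      (_ ⊡⁰ k ⊕⁰ _ ⊡⁰ w₁ ⊕⁰ _ ⊡⁰ w₂)

    B-difference : ∀ B B⁻ → # 16 * P * r * B ≈ Q ^ 2 * G p P r Q * (P ^ 2 - Q ^ 2) → # 16 * p * Q * B⁻ ≈ r ^ 2 * G P p Q r * (p ^ 2 - r ^ 2) →
      (# 8 * p * P * r * Q) * (# 8 * (B - B⁻)) ≈ (# 8 * p * P * r * Q) * (p ^ 3 * r - P ^ 3 * Q - # 3 * (p * r ^ 3 - P * Q ^ 3))
    B-difference B B⁻ h₁ h₂ = linear
      (solve 6 (λ p P r Q B B⁻ → (:# 8 ⊠ p ⊠ P ⊠ r ⊠ Q) ⊠ (:# 8 ⊠ (B ⊟ B⁻)) :=
        (:# 8 ⊠ p ⊠ P ⊠ r ⊠ Q) ⊠ (p ↑ 3 ⊠ r ⊟ P ↑ 3 ⊠ Q ⊟ :# 3 ⊠ (p ⊠ r ↑ 3 ⊟ P ⊠ Q ↑ 3))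
        ⊹ (:# 4 ⊠ p ⊠ Q ⊠ (:# 16 ⊠ P ⊠ r ⊠ B ⊟ Q ↑ 2 ⊠ G′ p P r Q ⊠ (P ↑ 2 ⊟ Q ↑ 2))
        ⊹ ((⊟ (:# 4 ⊠ P ⊠ r)) ⊠ (:# 16 ⊠ p ⊠ Q ⊠ B⁻ ⊟ r ↑ 2 ⊠ G′ P p Q r ⊠ (p ↑ 2 ⊟ r ↑ 2))
        ⊹ ((p ⊠ r ↑ 3 ⊹ :# 4 ⊠ P ⊠ Q ↑ 3 ⊟ p ↑ 3 ⊠ r) ⊠ K′ p P r Q ⊹ ((p ⊠ P ↑ 2 ⊠ r ⊟ p ⊠ r ⊠ Q ↑ 2 ⊟ :# 12 ⊠ P ⊠ r ↑ 2 ⊠ Q) ⊠ L′ p P r Q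
        ⊹ ((⊟ (P ⊠ r)) ⊠ W₁′ p P r Q ⊹ (⊟ (:# 9 ⊠ r ⊠ Q)) ⊠ W₂′ p P r Q)))))) ≈-refl p P r Q B B⁻)
      (_ ⊡ h₁ ⊕⁰ _ ⊡ h₂ ⊕⁰ _ ⊡⁰ k ⊕⁰ _ ⊡⁰ l ⊕⁰ _ ⊡⁰ w₁ ⊕⁰ _ ⊡⁰ w₂)

  -- ψ(-q) enters the relations only through its square Pe/2, so its defining equation for `b` is
  -- squared: 32y²b² = 32z¹⁰ = (Qe₅)⁵.
  b²≈ : ∀ P Q e e₅ y z b → # 2 * (y * y) ≈ P * e → # 2 * (z * z) ≈ Q * e₅ → y * b ≈ z ^ 5 → # 16 * P * e * b ^ 2 ≈ Q ^ 5 * e₅ ^ 5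
  b²≈ P Q e e₅ y z b h₁ h₂ h₃ = linear
    (solve 7 (λ P Q e e₅ y z b → :# 16 ⊠ P ⊠ e ⊠ b ↑ 2 := Q ↑ 5 ⊠ e₅ ↑ 5
      ⊹ ((⊟ (:# 16 ⊠ b ↑ 2)) ⊠ (:# 2 ⊠ (y ⊠ y) ⊟ P ⊠ e) ⊹ (:# 32 ⊠ (y ⊠ b ⊹ z ↑ 5) ⊠ (y ⊠ b ⊟ z ↑ 5)
      ⊹ (:# 16 ⊠ z ↑ 8 ⊹ :# 8 ⊠ z ↑ 6 ⊠ Q ⊠ e₅ ⊹ :# 4 ⊠ z ↑ 4 ⊠ Q ↑ 2 ⊠ e₅ ↑ 2 ⊹ :# 2 ⊠ z ↑ 2 ⊠ Q ↑ 3 ⊠ e₅ ↑ 3 ⊹ Q ↑ 4 ⊠ e₅ ↑ 4)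
        ⊠ (:# 2 ⊠ (z ⊠ z) ⊟ Q ⊠ e₅)))) ≈-refl P Q e e₅ y z b)
    (_ ⊡ h₁ ⊕⁰ _ ⊡ h₃ ⊕⁰ _ ⊡ h₂)

  B²≈ : ∀ P r Q x e e₅ b G E A S → # 16 * P * e * b ^ 2 ≈ Q ^ 5 * e₅ ^ 5 → x * (x * e₅) ^ 4 ≈ S → (x * e₅) * E ≈ e * G →
        # 16 * P * Q * r ^ 2 * S ≈ G * E * A ^ 2 →
        (E * P * e) * ((# 16 * P * r * (x ^ 3 * b)) * (# 16 * P * r * (x ^ 3 * b))) ≈ (E * P * e) * ((Q ^ 2 * G * A) * (Q ^ 2 * G * A))
  B²≈ P r Q x e e₅ b G E A S h₁ h₂ h₃ h₄ = linear
    (solve 11 (λ P r Q x e e₅ b G E A S →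
      (E ⊠ P ⊠ e) ⊠ ((:# 16 ⊠ P ⊠ r ⊠ (x ↑ 3 ⊠ b)) ⊠ (:# 16 ⊠ P ⊠ r ⊠ (x ↑ 3 ⊠ b))) := (E ⊠ P ⊠ e) ⊠ ((Q ↑ 2 ⊠ G ⊠ A) ⊠ (Q ↑ 2 ⊠ G ⊠ A))
      ⊹ (:# 16 ⊠ P ↑ 2 ⊠ r ↑ 2 ⊠ x ↑ 6 ⊠ E ⊠ (:# 16 ⊠ P ⊠ e ⊠ b ↑ 2 ⊟ Q ↑ 5 ⊠ e₅ ↑ 5)
      ⊹ (:# 16 ⊠ P ↑ 2 ⊠ r ↑ 2 ⊠ Q ↑ 5 ⊠ E ⊠ x ⊠ e₅ ⊠ (x ⊠ (x ⊠ e₅) ↑ 4 ⊟ S)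
      ⊹ (:# 16 ⊠ P ↑ 2 ⊠ r ↑ 2 ⊠ Q ↑ 5 ⊠ S ⊠ ((x ⊠ e₅) ⊠ E ⊟ e ⊠ G)
      ⊹ P ⊠ Q ↑ 4 ⊠ e ⊠ G ⊠ (:# 16 ⊠ P ⊠ Q ⊠ r ↑ 2 ⊠ S ⊟ G ⊠ E ⊠ A ↑ 2))))) ≈-refl P r Q x e e₅ b G E A S)
    (_ ⊡ h₁ ⊕⁰ _ ⊡ h₂ ⊕⁰ _ ⊡ h₃ ⊕⁰ _ ⊡ h₄)

  -- Covers q ↦ -q, q ↦ q² and q ↦ q⁵. A polynomial identity is carried along one of them by giving
  -- its two sides as syntax together with the images of its variables.
  record IsEndomorphism (h : Carrier → Carrier) : Set (c Level.⊔ ℓ) where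
    field
      h-cong  : a ≈ b → h a ≈ h b
      h-+     : ∀ a b → h (a + b) ≈ h a + h b
      h-*     : ∀ a b → h (a * b) ≈ h a * h b
      h--     : ∀ a → h (- a) ≈ - h a
      h-const : ∀ k → h (constant k) ≈ constant k

    evaluate : ∀ {n} {ρ ρ′ : Vec Carrier n} → Pointwise (λ a a′ → h a ≈ a′) ρ ρ′ →
               ∀ (e : Polynomial n) → h (Solver.⟦ e ⟧ ρ) ≈ Solver.⟦ e ⟧ ρ′
    evaluate ρ∼ρ′ (Solver.op Solver.[+] e₁ e₂) = ≈-trans (h-+ _ _) (+-cong (evaluate ρ∼ρ′ e₁) (evaluate ρ∼ρ′ e₂))
    evaluate ρ∼ρ′ (Solver.op Solver.[*] e₁ e₂) = ≈-trans (h-* _ _) (*-cong (evaluate ρ∼ρ′ e₁) (evaluate ρ∼ρ′ e₂))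
    evaluate ρ∼ρ′ (con k)                      = h-const k
    evaluate ρ∼ρ′ (Solver.var i)               = Pointwise.lookup ρ∼ρ′ i
    evaluate ρ∼ρ′ (e Solver.:^ zero)           = ≈-trans (h-cong (≈-sym 1-homo)) (≈-trans (h-const 1ℤ) 1-homo)
    evaluate ρ∼ρ′ (e Solver.:^ suc k)          = ≈-trans (h-* _ _) (*-cong (evaluate ρ∼ρ′ e) (evaluate ρ∼ρ′ (e Solver.:^ k)))
    evaluate ρ∼ρ′ (:- e)                       = ≈-trans (h-- _) (-‿cong (evaluate ρ∼ρ′ e))

    transport : ∀ {n} {ρ ρ′ : Vec Carrier n} → Pointwise (λ a a′ → h a ≈ a′) ρ ρ′ →
                ∀ (e₁ e₂ : Polynomial n) → Solver.⟦ e₁ ⟧ ρ ≈ Solver.⟦ e₂ ⟧ ρ → Solver.⟦ e₁ ⟧ ρ′ ≈ Solver.⟦ e₂ ⟧ ρ′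
    transport ρ∼ρ′ e₁ e₂ eq = ≈-trans (≈-sym (evaluate ρ∼ρ′ e₁)) (≈-trans (h-cong eq) (evaluate ρ∼ρ′ e₂))

    -- The descent step: an identity between images under an injective substitution already holds
    -- before the substitution.
    reflect : (∀ {a b} → h a ≈ h b → a ≈ b) → ∀ {n} {ρ ρ′ : Vec Carrier n} → Pointwise (λ a a′ → h a ≈ a′) ρ ρ′ →
              ∀ (e₁ e₂ : Polynomial n) → Solver.⟦ e₁ ⟧ ρ′ ≈ Solver.⟦ e₂ ⟧ ρ′ → Solver.⟦ e₁ ⟧ ρ ≈ Solver.⟦ e₂ ⟧ ρ
    reflect injective ρ∼ρ′ e₁ e₂ eq = injective (≈-trans (evaluate ρ∼ρ′ e₁) (≈-trans eq (≈-sym (evaluate ρ∼ρ′ e₂))))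

-- Specialisation to power series, and the relation `K`.

module ModularRelations where

  open _sums_
  open _sums₂_
  open IsTheta

  a α s e e₅ γ c : PowerSeries
  a = p ⟨q^ 2 ⟩
  α = P ⟨q^ 2 ⟩
  e = Ψ ⟨q^ 2 ⟩
  s = Ψ ⟨q^ 2 ⟩ ⟨q^ 2 ⟩
  e₅ = e ⟨q^ 5 ⟩
  γ = α ⟨q^ 5 ⟩
  c = a ⟨q^ 5 ⟩

  opaque
    unfolding _✶_

    const-✶ : ∀ c f n → (const c ✶ f) n ≡ c ℤ.* f n
    const-✶ = const-⊛

    neg-✶ : ∀ f g → neg (f ✶ g) ≋ neg f ✶ neg g
    neg-✶ f g = pointwise (neg-⊛ f g)

    ✶-cancelˡ-0 : ∀ k f g → (∀ i → i ℕ.< k → f i ≡ 0ℤ) → f k ≢ 0ℤ → f ✶ g ≋ 0ˢ → g ≋ 0ˢ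
    ✶-cancelˡ-0 k f g low lead fg≋0 = pointwise (⊛-cancelˡ-0 k f g low lead (at fg≋0))

    stretch-x : ∀ d .{{_ : NonZero d}} → x ⟨q^ d ⟩ ≋ 1ℤ ·q^ d
    stretch-x d = pointwise λ n → trans (sym (stretch-cong {d} (λ m → trans (⊛-comm x (const 1ℤ) m) (⊛-identityˡ x m)) n))
      (trans (stretch-x⊛ {d} (const 1ℤ) n)
      (trans (⊛-cong {f = 1ℤ ·q^ d} {f′ = 1ℤ ·q^ d} (λ _ → refl) (stretch-const {d} 1ℤ) n)
      (trans (⊛-comm (1ℤ ·q^ d) (const 1ℤ) n) (⊛-identityˡ (1ℤ ·q^ d) n))))

    x✶x^ : ∀ d → x ✶ (1ℤ ·q^ d) ≋ 1ℤ ·q^ suc d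
    x✶x^ d = pointwise (^-⊛-^ 1ℤ 1 1ℤ d)

  const-morphism : CommutativeRing.rawRing ℤ.+-*-commutativeRing -Raw-AlmostCommutative⟶ fromCommutativeRing powerSeriesRing
  const-morphism = record
    { ⟦_⟧    = const
    ; +-homo = λ a b → pointwise λ { zero → refl ; (suc _) → refl }
    ; *-homo = λ a b → pointwise λ n → sym (trans (const-✶ a (const b) n) (^-scale a b 0 n))
    ; -‿homo = λ a → pointwise λ { zero → refl ; (suc _) → refl }
    ; 0-homo = pointwise λ { zero → refl ; (suc _) → refl }
    ; 1-homo = Ring.refl
    }

  open Relations powerSeriesRing const-morphism
  neg-endo : IsEndomorphism neg
  neg-endo = record
    { h-cong  = λ f≋g → pointwise (neg-cong (at f≋g))
    ; h-+     = λ f g → pointwise (neg-⊕ f g)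
    ; h-*     = neg-✶
    ; h--     = λ f → pointwise (neg-⊖ f)
    ; h-const = neg-const
    }

  stretch-endo : ∀ d .{{_ : NonZero d}} → IsEndomorphism _⟨q^ d ⟩
  stretch-endo d = record
    { h-cong  = λ f≋g → pointwise (stretch-cong {d} (at f≋g))
    ; h-+     = λ f g → pointwise (stretch-⊕ {d} f g)
    ; h-*     = stretch-✶ {d}
    ; h--     = λ f → pointwise (stretch-⊖ {d} f)
    ; h-const = λ c → pointwise (stretch-const {d} c)
    }

  module neg = IsEndomorphism neg-endo
  module V₂ = IsEndomorphism (stretch-endo 2)
  module V₅ = IsEndomorphism (stretch-endo 5)

  V₂-injective : ∀ {f g} → f ⟨q^ 2 ⟩ ≋ g ⟨q^ 2 ⟩ → f ≋ g
  V₂-injective eq = pointwise (stretch-injective {2} (at eq))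

  ✶-cancelˡ : ∀ k f {g h} → (∀ i → i ℕ.< k → f i ≡ 0ℤ) → f k ≢ 0ℤ → f * g ≋ f * h → g ≋ h
  ✶-cancelˡ k f {g} {h} low lead fg≋fh = pointwise λ n → ℤ.i-j≡0⇒i≡j (g n) (h n) (at difference n)
    where
    difference : g - h ≋ 0ˢ
    difference = ✶-cancelˡ-0 k f (g - h) low lead (Ring.trans
      (Solver.solve 3 (λ f g h → f ⊠ (g ⊟ h) Solver.:= f ⊠ g ⊟ f ⊠ h) Ring.refl f g h) (difference≈0 fg≋fh))

  -- Of the two roots ±g the one with the minus sign is excluded by the nonzero coefficient of f + g
  -- at its order `k`, which makes f + g cancellable in (f + g)(f - g) = 0.
  square-injective : ∀ k f g → (∀ i → i ℕ.< k → (f + g) i ≡ 0ℤ) → (f + g) k ≢ 0ℤ → f * f ≋ g * g → f ≋ g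
  square-injective k f g low lead f²≋g² = pointwise λ n → ℤ.i-j≡0⇒i≡j (f n) (g n)
    (at (✶-cancelˡ-0 k (f + g) (f - g) low lead (square-difference f²≋g²)) n)

  v₀ : ∀ {n} → Solver.Polynomial (1 ℕ.+ n)
  v₀ = Solver.var zero
  v₁ : ∀ {n} → Solver.Polynomial (2 ℕ.+ n)
  v₁ = Solver.var (suc zero)
  v₂ : ∀ {n} → Solver.Polynomial (3 ℕ.+ n)
  v₂ = Solver.var (suc (suc zero))
  v₃ : ∀ {n} → Solver.Polynomial (4 ℕ.+ n)
  v₃ = Solver.var (suc (suc (suc zero)))
  v₄ : ∀ {n} → Solver.Polynomial (5 ℕ.+ n)
  v₄ = Solver.var (suc (suc (suc (suc zero))))
  v₅ : ∀ {n} → Solver.Polynomial (6 ℕ.+ n)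
  v₅ = Solver.var (suc (suc (suc (suc (suc zero)))))

  x^ : ∀ d → 1ℤ ·q^ suc d ≋ x ^ suc d
  x^ zero    = Ring.refl
  x^ (suc d) = Ring.trans (Ring.sym (x✶x^ (suc d)))
                         (Ring.*-cong {x} {x} {1ℤ ·q^ suc d} {x ^ suc d} Ring.refl (x^ d))

  stretch²-x : x ⟨q^ 2 ⟩ ≋ x ^ 2
  stretch²-x = Ring.trans {x ⟨q^ 2 ⟩} (stretch-x 2) (x^ 1)

  stretch⁵-x : x ⟨q^ 5 ⟩ ≋ x ^ 5
  stretch⁵-x = Ring.trans {x ⟨q^ 5 ⟩} (stretch-x 5) (x^ 4)

  neg-x : neg x ≋ - x
  neg-x = pointwise λ { zero → refl ; (suc zero) → refl ; (suc (suc n)) → ℤ.*-zeroʳ (-1ℤ ℤ.^ suc (suc n)) }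

  neg-p : neg p ≋ P
  neg-p = pointwise (neg-involutive P)

  neg-a : neg a ≋ a
  neg-a = pointwise (neg-stretch² p)

  P²-split : P * P ≋ a * a - x * s * s
  P²-split = Ring.trans (neg.transport (neg-p ∷ neg-a ∷ neg-x ∷ neg-s ∷ []) (v₀ ⊠ v₀) (v₁ ⊠ v₁ ⊹ v₂ ⊠ v₃ ⊠ v₃) p²-split)
    (solve 3 (λ a x s → a ⊠ a ⊹ (⊟ x) ⊠ s ⊠ s := a ⊠ a ⊟ x ⊠ s ⊠ s) Ring.refl a x s)
    where
    open Solver
    neg-s : neg s ≋ s
    neg-s = pointwise (neg-stretch² (Ψ ⟨q^ 2 ⟩))

  neg-stretch⁵ : ∀ f → neg (f ⟨q^ 5 ⟩) ≋ neg f ⟨q^ 5 ⟩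
  neg-stretch⁵ f = pointwise (stretch-unique {5} (neg f)
    (λ k → cong₂ ℤ._*_ (power k) (stretch-* {5} f k))
    λ {n} 5∤n → trans (cong (-1ℤ ℤ.^ n ℤ.*_) (stretch-∤ {5} f 5∤n)) (ℤ.*-zeroʳ (-1ℤ ℤ.^ n)))
    where
    power : ∀ k → -1ℤ ℤ.^ (k ℕ.* 5) ≡ -1ℤ ℤ.^ k
    power k = trans (cong (-1ℤ ℤ.^_) (ℕ-Solver.+-*-Solver.solve 1 (λ k → k :* con 5 := (k :+ k) :+ (k :+ k) :+ k) refl k))
      (trans (ℤ.^-distribˡ-+-* -1ℤ ((k ℕ.+ k) ℕ.+ (k ℕ.+ k)) k)
      (trans (cong (ℤ._* -1ℤ ℤ.^ k) (-1²ⁿ≡1 (k ℕ.+ k))) (ℤ.*-identityˡ (-1ℤ ℤ.^ k))))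
      where open ℕ-Solver.+-*-Solver using (_:*_; con; _:=_; _:+_)

  neg-r : neg r ≋ Q
  neg-r = Ring.trans (neg-stretch⁵ p) (V₅.h-cong neg-p)

  neg-Q : neg Q ≋ r
  neg-Q = neg-stretch⁵ P

  stretch-commutes : ∀ {w f} → IsTheta w square f → f ⟨q^ 5 ⟩ ⟨q^ 2 ⟩ ≋ f ⟨q^ 2 ⟩ ⟨q^ 5 ⟩
  stretch-commutes f-theta = theta-unique (λ _ → refl)
    (λ x → solve 1 (λ t → con 2 :* (con 5 :* t) := con 5 :* (con 2 :* t)) refl (square x))
    (theta-stretch 2 (theta-stretch 5 f-theta)) (theta-stretch 5 (theta-stretch 2 f-theta))
    where open ℕ-Solver.+-*-Solver

  stretch²-r : r ⟨q^ 2 ⟩ ≋ c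
  stretch²-r = stretch-commutes p-theta

  stretch²-Q : Q ⟨q^ 2 ⟩ ≋ γ
  stretch²-Q = stretch-commutes P-theta

  rQ≋γ² : r * Q ≋ γ * γ
  rQ≋γ² = V₅.transport {ρ = p ∷ P ∷ α ∷ []} {ρ′ = r ∷ Q ∷ γ ∷ []} (Ring.refl ∷ Ring.refl ∷ Ring.refl ∷ []) (v₀ ⊠ v₁) (v₂ ⊠ v₂) pP-split

  2a²≋ : # 2 * a ^ 2 ≋ p ^ 2 + P ^ 2
  2a²≋ = squares-sum p P a (x * s * s) p²-split P²-split

  2c²≋ : # 2 * c ^ 2 ≋ r ^ 2 + Q ^ 2
  2c²≋ = V₅.transport {ρ = a ∷ p ∷ P ∷ []} {ρ′ = c ∷ r ∷ Q ∷ []} (Ring.refl ∷ Ring.refl ∷ Ring.refl ∷ []) (:# 2 ⊠ v₀ ↑ 2) (v₁ ↑ 2 ⊹ v₂ ↑ 2) 2a²≋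

  xe⁴≋ : x * e ^ 4 ≋ p ^ 4 - P ^ 4
  xe⁴≋ = fourth-powers p P a x s e p²-split P²-split
    (V₂.transport {ρ = Ψ ∷ p ∷ e ∷ []} {ρ′ = e ∷ a ∷ s ∷ []} (Ring.refl ∷ Ring.refl ∷ Ring.refl ∷ []) (v₀ ⊠ v₀) (v₁ ⊠ v₂ ⊹ v₂ ⊠ v₁) Ψ²-split)

  xg⁴≋ : x * (x * e₅) ^ 4 ≋ r ^ 4 - Q ^ 4
  xg⁴≋ = Ring.trans (Solver.solve 2 (λ x e₅ → x ⊠ (x ⊠ e₅) ↑ 4 Solver.:= x ↑ 5 ⊠ e₅ ↑ 4) Ring.refl x e₅)
    (V₅.transport {ρ = x ∷ e ∷ p ∷ P ∷ []} {ρ′ = x ^ 5 ∷ e₅ ∷ r ∷ Q ∷ []} (stretch⁵-x ∷ Ring.refl ∷ Ring.refl ∷ Ring.refl ∷ []) (v₀ ⊠ v₁ ↑ 4) (v₂ ↑ 4 ⊟ v₃ ↑ 4) xe⁴≋)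

  -- K = (p² - r²)(P² - Q²) - 4rQ(pP - rQ), and by M-split and N-split both terms
  -- are -16q²φ(-q¹⁰)²M(-q²)N(-q²).
  K-p : K p P r Q ≋ 0ˢ
  K-p = K≈0 p P r Q (u x N M) (u x (neg N) (neg M)) (u (x ^ 2) N₂ M₂) α γ
    (Ring.trans quintuple-split (solve 4 (λ r x N M → r ⊠ r ⊹ sum x N M := r ⊠ r ⊹ u′ x N M) Ring.refl r x N M))
    (Ring.trans P²≋ (solve 4 (λ Q x N M → Q ⊠ Q ⊹ sum (⊟ x) N M := Q ⊠ Q ⊟ u′ x N M) Ring.refl Q x (neg N) (neg M)))
    pP-split rQ≋γ²
    (Ring.trans (V₂.transport {ρ = P ∷ Q ∷ - x ∷ neg N ∷ neg M ∷ []} {ρ′ = α ∷ γ ∷ - (x ^ 2) ∷ N₂ ∷ M₂ ∷ []}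
        (Ring.refl ∷ stretch²-Q ∷ Ring.trans (V₂.h-- x) (Ring.-‿cong {x ⟨q^ 2 ⟩} stretch²-x) ∷ Ring.refl ∷ Ring.refl ∷ [])
        (v₀ ⊠ v₀) (v₁ ⊠ v₁ ⊹ sum v₂ v₃ v₄) P²≋)
      (solve 4 (λ Q x N M → Q ⊠ Q ⊹ sum (⊟ x) N M := Q ⊠ Q ⊟ u′ x N M) Ring.refl γ (x ^ 2) N₂ M₂))
    (linear (solve 8 (λ x N M N⁻ M⁻ N₂ M₂ γ → u′ x N M ⊠ u′ x N⁻ M⁻ := :# 4 ⊠ (γ ⊠ γ) ⊠ u′ (x ↑ 2) N₂ M₂
          ⊹ (:# 16 ⊠ x ↑ 2 ⊠ M ⊠ M⁻ ⊠ (N ⊠ N⁻ ⊟ γ ⊠ N₂) ⊹ :# 16 ⊠ x ↑ 2 ⊠ γ ⊠ N₂ ⊠ (M ⊠ M⁻ ⊟ γ ⊠ M₂)))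
        Ring.refl x N M (neg N) (neg M) N₂ M₂ γ)
      (_ ⊡ N-split ⊕⁰ _ ⊡ M-split))
    where
    open Solver using (solve; _:=_)
    M₂ N₂ : PowerSeries
    M₂ = neg M ⟨q^ 2 ⟩
    N₂ = neg N ⟨q^ 2 ⟩
    u : PowerSeries → PowerSeries → PowerSeries → PowerSeries
    u x N M = # 4 * x * N * M
    u′ sum : ∀ {n} → Solver.Polynomial n → Solver.Polynomial n → Solver.Polynomial n → Solver.Polynomial n
    u′ x N M = :# 4 ⊠ x ⊠ N ⊠ M
    sum x N M = (x ⊠ N) ⊠ M ⊹ ((x ⊠ M) ⊠ N ⊹ ((x ⊠ M) ⊠ N ⊹ (x ⊠ N) ⊠ M))
    P²≋ : P * P ≋ Q * Q + (((- x) * neg N) * neg M + (((- x) * neg M) * neg N + (((- x) * neg M) * neg N + ((- x) * neg N) * neg M)))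
    P²≋ = neg.transport {ρ = p ∷ r ∷ x ∷ N ∷ M ∷ []} {ρ′ = P ∷ Q ∷ - x ∷ neg N ∷ neg M ∷ []} (neg-p ∷ neg-r ∷ neg-x ∷ Ring.refl ∷ Ring.refl ∷ [])
      (v₀ ⊠ v₀) (v₁ ⊠ v₁ ⊹ sum v₂ v₃ v₄) quintuple-split

  -- If 2n = u² + 5v² then n ≡ v (mod 2).
  parity : ∀ u v n → n ℕ.* 2 ≡ u ℕ.* u ℕ.+ 5 ℕ.* (v ℕ.* v) → -1ℤ ℤ.^ n ≡ -1ℤ ℤ.^ v
  parity u v n eq with halve u | halve v
    where
    halve : ∀ n → ∃ λ k → n ≡ k ℕ.+ k ⊎ n ≡ suc (k ℕ.+ k)
    halve zero    = 0 , inj₁ refl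
    halve (suc n) with halve n
    ... | k , inj₁ refl = k , inj₂ refl
    ... | k , inj₂ refl = suc k , inj₁ (cong suc (sym (ℕ.+-suc k k)))
  ... | i , inj₁ refl | j , inj₁ refl = trans (cong (-1ℤ ℤ.^_) (ℕ.*-cancelʳ-≡ n (w ℕ.+ w) 2 (trans eq
      (solve 2 (λ i j → let w = i :* i :+ con 5 :* (j :* j) in
        (i :+ i) :* (i :+ i) :+ con 5 :* ((j :+ j) :* (j :+ j)) := (w :+ w) :* con 2) refl i j))))
      (trans (-1²ⁿ≡1 w) (sym (-1²ⁿ≡1 j)))
    where
    open ℕ-Solver.+-*-Solver
    w : ℕ
    w = i ℕ.* i ℕ.+ 5 ℕ.* (j ℕ.* j)
  ... | i , inj₂ refl | j , inj₂ refl = trans (cong (-1ℤ ℤ.^_) (ℕ.*-cancelʳ-≡ n (suc (w ℕ.+ w)) 2 (trans eq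
      (solve 2 (λ i j → let w = i :* i :+ i :+ con 5 :* (j :* j :+ j) :+ con 1 in
        (con 1 :+ (i :+ i)) :* (con 1 :+ (i :+ i)) :+ con 5 :* ((con 1 :+ (j :+ j)) :* (con 1 :+ (j :+ j))) := (con 1 :+ (w :+ w)) :* con 2) refl i j))))
      (cong (-1ℤ ℤ.*_) (trans (-1²ⁿ≡1 w) (sym (-1²ⁿ≡1 j))))
    where
    open ℕ-Solver.+-*-Solver
    w : ℕ
    w = i ℕ.* i ℕ.+ i ℕ.+ 5 ℕ.* (j ℕ.* j ℕ.+ j) ℕ.+ 1
  ... | i , inj₁ refl | j , inj₂ refl = ⊥-elim (ℕ.even≢odd n (2 ℕ.* (i ℕ.* i) ℕ.+ 10 ℕ.* (j ℕ.* j) ℕ.+ 10 ℕ.* j ℕ.+ 2)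
      (trans (ℕ.*-comm 2 n) (trans eq (solve 2 (λ i j →
        (i :+ i) :* (i :+ i) :+ con 5 :* ((con 1 :+ (j :+ j)) :* (con 1 :+ (j :+ j)))
        := con 1 :+ con 2 :* (con 2 :* (i :* i) :+ con 10 :* (j :* j) :+ con 10 :* j :+ con 2)) refl i j))))
    where open ℕ-Solver.+-*-Solver
  ... | i , inj₂ refl | j , inj₁ refl = ⊥-elim (ℕ.even≢odd n (2 ℕ.* (i ℕ.* i) ℕ.+ 2 ℕ.* i ℕ.+ 10 ℕ.* (j ℕ.* j))
      (trans (ℕ.*-comm 2 n) (trans eq (solve 2 (λ i j →
        (con 1 :+ (i :+ i)) :* (con 1 :+ (i :+ i)) :+ con 5 :* ((j :+ j) :* (j :+ j))
        := con 1 :+ con 2 :* (con 2 :* (i :* i) :+ con 2 :* i :+ con 10 :* (j :* j))) refl i j))))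
    where open ℕ-Solver.+-*-Solver

  -- The even parts of φ(q)φ(q⁵) and φ(q)φ(-q⁵), and the relation `L`.

  Φ Φ⁻ : PowerSeries
  Φ  = even (p * r)
  Φ⁻ = even (p * Q)

  opaque
    unfolding _✶_

    -- Both series sum over the pairs with y² + 5z² = 2n, with signs (-1)^n and (-1)^z, and these
    -- agree by `parity`.
    neg-Φ : neg Φ ≋ Φ⁻
    neg-Φ = pointwise λ n → sums₂-unique (same n)
      (sums₂-scale (-1ℤ ℤ.^ n) (theta-⊛ p-theta (theta-stretch 5 p-theta) (n ℕ.* 2)))
      (theta-⊛ p-theta (theta-stretch 5 P-theta) (n ℕ.* 2))
      where
      same : ∀ n y z → -1ℤ ℤ.^ n ℤ.* ((1ℤ ℤ.* 1ℤ) ·q^ (square y ℕ.+ 5 ℕ.* square z)) (n ℕ.* 2)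
                       ≡ ((1ℤ ℤ.* sgn z) ·q^ (square y ℕ.+ 5 ℕ.* square z)) (n ℕ.* 2)
      same n y z with n ℕ.* 2 ℕ.≟ square y ℕ.+ 5 ℕ.* square z
      ... | no  ≢e = trans (cong (-1ℤ ℤ.^ n ℤ.*_) (·q^-≢ 1ℤ {square y ℕ.+ 5 ℕ.* square z} {n ℕ.* 2} ≢e))
                       (trans (ℤ.*-zeroʳ (-1ℤ ℤ.^ n)) (sym (·q^-≢ (1ℤ ℤ.* sgn z) {square y ℕ.+ 5 ℕ.* square z} {n ℕ.* 2} ≢e)))
      ... | yes ≡e = trans (^-scale (-1ℤ ℤ.^ n) 1ℤ (square y ℕ.+ 5 ℕ.* square z) (n ℕ.* 2))
                       (cong (λ c → (c ·q^ (square y ℕ.+ 5 ℕ.* square z)) (n ℕ.* 2))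
                         (trans (ℤ.*-identityʳ (-1ℤ ℤ.^ n)) (trans (parity ∣ y ∣ ∣ z ∣ n ≡e) (sym (ℤ.*-identityˡ (sgn z))))))

    2even≋ : ∀ f → # 2 ✶ even f ⟨q^ 2 ⟩ ≋ f ⊕ neg f
    2even≋ f = pointwise (stretch²-even f)

  Φ₂ Φ⁻₂ : PowerSeries
  Φ₂  = Φ ⟨q^ 2 ⟩
  Φ⁻₂ = Φ⁻ ⟨q^ 2 ⟩

  2Φ₂≋ : # 2 * Φ₂ ≋ p * r + P * Q
  2Φ₂≋ = Ring.trans (2even≋ (p * r)) (Ring.+-congˡ {p * r} (Ring.trans (neg-✶ p r) (Ring.*-cong neg-p neg-r)))

  2Φ⁻₂≋ : # 2 * Φ⁻₂ ≋ p * Q + P * r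
  2Φ⁻₂≋ = Ring.trans (2even≋ (p * Q)) (Ring.+-congˡ {p * Q} (Ring.trans (neg-✶ p Q) (Ring.*-cong neg-p neg-Q)))

  -- In `Φ⁻₂²≈` the three series that remain are the images of `Φ⁻`, `P` and `Q` under q ↦ q², so
  -- the substitution can be undone.
  4Φ⁻²≋ : # 4 * Φ⁻ ^ 2 ≋ P ^ 4 - # 2 * P ^ 2 * Q ^ 2 + # 5 * Q ^ 4
  4Φ⁻²≋ = V₂.reflect V₂-injective {ρ = Φ⁻ ∷ P ∷ Q ∷ []} {ρ′ = Φ⁻₂ ∷ α ∷ γ ∷ []} (Ring.refl ∷ Ring.refl ∷ stretch²-Q ∷ [])
    (:# 4 ⊠ v₀ ↑ 2) (v₁ ↑ 4 ⊟ :# 2 ⊠ v₁ ↑ 2 ⊠ v₂ ↑ 2 ⊹ :# 5 ⊠ v₂ ↑ 4)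
    (Φ⁻₂²≈ p P r Q α γ Φ⁻₂ K-p pP-split rQ≋γ² 2Φ⁻₂≋)

  neg-Φ⁻ : neg Φ⁻ ≋ Φ
  neg-Φ⁻ = Ring.trans (neg.h-cong (Ring.sym neg-Φ)) (pointwise (neg-involutive Φ))

  4Φ²≋ : # 4 * Φ ^ 2 ≋ p ^ 4 - # 2 * p ^ 2 * r ^ 2 + # 5 * r ^ 4
  4Φ²≋ = neg.transport {ρ = Φ⁻ ∷ P ∷ Q ∷ []} {ρ′ = Φ ∷ p ∷ r ∷ []} (neg-Φ⁻ ∷ Ring.refl ∷ neg-Q ∷ [])
    (:# 4 ⊠ v₀ ↑ 2) (v₁ ↑ 4 ⊟ :# 2 ⊠ v₁ ↑ 2 ⊠ v₂ ↑ 2 ⊹ :# 5 ⊠ v₂ ↑ 4) 4Φ⁻²≋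

  L-p : L p P r Q ≋ 0ˢ
  L-p = L≈0 p P r Q Φ Φ⁻ 4Φ²≋ 4Φ⁻²≋
    (V₂.reflect V₂-injective {ρ = Φ ∷ Φ⁻ ∷ p ∷ r ∷ P ∷ Q ∷ []} {ρ′ = Φ₂ ∷ Φ⁻₂ ∷ a ∷ c ∷ α ∷ γ ∷ []}
      (Ring.refl ∷ Ring.refl ∷ Ring.refl ∷ stretch²-r ∷ Ring.refl ∷ stretch²-Q ∷ [])
      (:# 4 ⊠ (v₀ ↑ 2 ⊹ v₁ ↑ 2)) (:# 4 ⊠ (v₂ ↑ 2 ⊠ v₃ ↑ 2 ⊹ v₄ ↑ 2 ⊠ v₅ ↑ 2))
      (Φ₂²+Φ⁻₂²≈ p P r Q a c α γ Φ₂ Φ⁻₂ 2a²≋ 2c²≋ pP-split rQ≋γ² 2Φ₂≋ 2Φ⁻₂≋))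

  opaque
    unfolding _✶_

    -- Both summands have constant term 2.
    lead-2PΦ : (# 2 * P * Φ + T p P r Q) 0 ≢ 0ℤ
    lead-2PΦ ()

    lead-E₀ : ∀ i → i ℕ.< 1 → E p P r Q i ≡ 0ℤ
    lead-E₀ zero _ = refl
    lead-E₀ (suc _) (s≤s ())

    lead-E : E p P r Q 1 ≢ 0ℤ
    lead-E ()

  2PΦ≋T : # 2 * P * Φ ≋ T p P r Q
  2PΦ≋T = square-injective 0 (# 2 * P * Φ) (T p P r Q) (λ _ ()) lead-2PΦ ([2PΦ]²≈T² p P r Q Φ K-p 4Φ²≋)

  2pΦ⁻≋T : # 2 * p * Φ⁻ ≋ T P p Q r
  2pΦ⁻≋T = neg.transport {ρ = p ∷ P ∷ r ∷ Q ∷ Φ ∷ []} {ρ′ = P ∷ p ∷ Q ∷ r ∷ Φ⁻ ∷ []} (neg-p ∷ Ring.refl ∷ neg-r ∷ neg-Q ∷ neg-Φ ∷ [])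
    (:# 2 ⊠ v₁ ⊠ v₄) (T′ v₀ v₁ v₂ v₃) 2PΦ≋T

  W₁-p : W₁ p P r Q ≋ 0ˢ
  W₁-p = ✶-cancelˡ-0 1 (E p P r Q) (W₁ p P r Q) lead-E₀ lead-E (EW₁≈0 p P r Q K-p L-p)

  W₂-p : W₂ p P r Q ≋ 0ˢ
  W₂-p = ✶-cancelˡ-0 1 (E p P r Q) (W₂ p P r Q) lead-E₀ lead-E (EW₂≈0 p P r Q K-p L-p)

  -- The generating functions of `a̅₅` and `b̅₅` in terms of p, P, r, Q.

  A B : PowerSeries
  A = even a̅₅
  -- The modular normalisation of ψ carries the factor q^(1/8), and 5 · 5/8 - 1/8 = 3.
  B = x ^ 3 * b̅₅

  opaque
    unfolding _✶_

    P*a̅₅ : P * a̅₅ ≋ Q * (Q * (Q * (Q * (Q * # 1))))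
    P*a̅₅ = pointwise (÷-correct (Q ^ˢ 5) P refl)

    ψ₅ : PowerSeries
    ψ₅ = ψ[-q] ⟨q^ 5 ⟩

    ψ*b̅₅ : ψ[-q] * b̅₅ ≋ ψ₅ * (ψ₅ * (ψ₅ * (ψ₅ * (ψ₅ * # 1))))
    ψ*b̅₅ = pointwise (÷-correct (ψ₅ ^ˢ 5) ψ[-q] refl)

    stretch⁵-ψ : ψ[-q] ⟨q^ 5 ⟩ ≋ ψ₅
    stretch⁵-ψ = Ring.refl

    Ψ≋2ψ : Ψ ≋ # 2 * ψ
    Ψ≋2ψ = Ring.refl

    lead-2 : (# 2) 0 ≢ 0ℤ
    lead-2 ()

    lead-pP² : (p * P ^ 2) 0 ≢ 0ℤ
    lead-pP² ()

    lead-4pPrQ : (# 4 * p * P * r * Q) 0 ≢ 0ℤ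
    lead-4pPrQ ()

    lead-8pPrQ : (# 8 * p * P * r * Q) 0 ≢ 0ℤ
    lead-8pPrQ ()

  fifth-power : ∀ f → f * (f * (f * (f * (f * # 1)))) ≋ f ^ 5
  fifth-power = Solver.solve 1 (λ f → f ⊠ (f ⊠ (f ⊠ (f ⊠ (f ⊠ :# 1)))) Solver.:= f ↑ 5) Ring.refl

  P*a̅₅≋Q⁵ : P * a̅₅ ≋ Q ^ 5
  P*a̅₅≋Q⁵ = Ring.trans P*a̅₅ (fifth-power Q)

  p*a̅₅⁻≋r⁵ : p * neg a̅₅ ≋ r ^ 5
  p*a̅₅⁻≋r⁵ = neg.transport {ρ = P ∷ a̅₅ ∷ Q ∷ []} {ρ′ = p ∷ neg a̅₅ ∷ r ∷ []} (Ring.refl ∷ Ring.refl ∷ neg-Q ∷ [])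
    (v₀ ⊠ v₁) (v₂ ↑ 5) P*a̅₅≋Q⁵

  P²A≋ : P ^ 2 * A ≋ (# 4 * r ^ 4 - Q ^ 4) * Φ⁻ - # 2 * r ^ 2 * Q ^ 2 * Φ
  P²A≋ = V₂.reflect V₂-injective {ρ = P ∷ A ∷ r ∷ Q ∷ Φ⁻ ∷ Φ ∷ []} {ρ′ = α ∷ A ⟨q^ 2 ⟩ ∷ c ∷ γ ∷ Φ⁻₂ ∷ Φ₂ ∷ []}
    (Ring.refl ∷ Ring.refl ∷ stretch²-r ∷ stretch²-Q ∷ Ring.refl ∷ Ring.refl ∷ [])
    (v₀ ↑ 2 ⊠ v₁) ((:# 4 ⊠ v₂ ↑ 4 ⊟ v₃ ↑ 4) ⊠ v₄ ⊟ :# 2 ⊠ v₂ ↑ 2 ⊠ v₃ ↑ 2 ⊠ v₅)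
    (✶-cancelˡ 0 (# 2) (λ _ ()) lead-2 (even-part p P r Q c α γ Φ₂ Φ⁻₂ (A ⟨q^ 2 ⟩) a̅₅ (neg a̅₅)
      2c²≋ pP-split rQ≋γ² 2Φ₂≋ 2Φ⁻₂≋ P*a̅₅≋Q⁵ p*a̅₅⁻≋r⁵ (2even≋ a̅₅)))

  8PQA≋W : # 8 * P * Q * A ≋ W P Q
  8PQA≋W = ✶-cancelˡ 0 (p * P ^ 2) (λ _ ()) lead-pP² (A≈W p P r Q K-p L-p W₁-p W₂-p A Φ Φ⁻ 2PΦ≋T 2pΦ⁻≋T P²A≋)

  A-neg-A : # 2 * (A - neg A) ≋ # 5 * (p ^ 3 * r - P ^ 3 * Q) - # 11 * (p * r ^ 3 - P * Q ^ 3)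
  A-neg-A = ✶-cancelˡ 0 (# 4 * p * P * r * Q) (λ _ ()) lead-4pPrQ (A-difference p P r Q K-p L-p W₁-p W₂-p A (neg A) 8PQA≋W
    (neg.transport {ρ = P ∷ Q ∷ A ∷ []} {ρ′ = p ∷ r ∷ neg A ∷ []} (Ring.refl ∷ neg-Q ∷ Ring.refl ∷ [])
      (:# 8 ⊠ v₀ ⊠ v₁ ⊠ v₂) (W′ v₀ v₁) 8PQA≋W))

  -- With the extra factor q, x · g⁴ = x⁵e₅⁴ is exactly the image of x · e⁴ under q ↦ q⁵.
  g : PowerSeries
  g = x * e₅

  opaque
    unfolding _✶_

    lead-x₀ : ∀ i → i ℕ.< 1 → x i ≡ 0ℤ
    lead-x₀ zero _ = refl
    lead-x₀ (suc _) (s≤s ())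

    lead-x : x 1 ≢ 0ℤ
    lead-x ()

    -- The series begin as e = 2 + ..., g = 2q + ..., G = -4q² + ..., G₅ = -4 + ..., so both
    -- summands begin with -16q². Since E = -4q + ..., both summands in `lead-gE` begin with -8q².
    lead-g²G₅₀ : ∀ i → i ℕ.< 2 → (g ^ 2 * G₅ p P r Q + e ^ 2 * G p P r Q) i ≡ 0ℤ
    lead-g²G₅₀ zero _ = refl
    lead-g²G₅₀ (suc zero) _ = refl
    lead-g²G₅₀ (suc (suc _)) (s≤s (s≤s ()))

    lead-g²G₅ : (g ^ 2 * G₅ p P r Q + e ^ 2 * G p P r Q) 2 ≢ 0ℤ
    lead-g²G₅ ()

    lead-gE₀ : ∀ i → i ℕ.< 2 → (g * E p P r Q + e * G p P r Q) i ≡ 0ℤ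
    lead-gE₀ zero _ = refl
    lead-gE₀ (suc zero) _ = refl
    lead-gE₀ (suc (suc _)) (s≤s (s≤s ()))

    lead-gE : (g * E p P r Q + e * G p P r Q) 2 ≢ 0ℤ
    lead-gE ()

    lead-EPe₀ : ∀ i → i ℕ.< 1 → (E p P r Q * P * e) i ≡ 0ℤ
    lead-EPe₀ zero _ = refl
    lead-EPe₀ (suc _) (s≤s ())

    lead-EPe : (E p P r Q * P * e) 1 ≢ 0ℤ
    lead-EPe ()

    -- B begins with q³, G with -4q² and P² - Q² with -4q, so both summands begin with 16q³.
    lead-B₀ : ∀ i → i ℕ.< 3 → (# 16 * P * r * B + Q ^ 2 * G p P r Q * (P ^ 2 - Q ^ 2)) i ≡ 0ℤ
    lead-B₀ zero _ = refl
    lead-B₀ (suc zero) _ = refl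
    lead-B₀ (suc (suc zero)) _ = refl
    lead-B₀ (suc (suc (suc _))) (s≤s (s≤s (s≤s ())))

    lead-B : (# 16 * P * r * B + Q ^ 2 * G p P r Q * (P ^ 2 - Q ^ 2)) 3 ≢ 0ℤ
    lead-B ()

  gE≋eG : g * E p P r Q ≋ e * G p P r Q
  gE≋eG = square-injective 2 (g * E p P r Q) (e * G p P r Q) lead-gE₀ lead-gE
    ([gE]²≈[eG]² p P r Q K-p L-p W₁-p W₂-p e g
      (square-injective 2 (g ^ 2 * G₅ p P r Q) (e ^ 2 * G p P r Q) lead-g²G₅₀ lead-g²G₅
        (✶-cancelˡ 1 x lead-x₀ lead-x ([g²G₅]²≈[e²G]² p P r Q K-p L-p W₁-p W₂-p x e g xe⁴≋ xg⁴≋))))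

  -- This is ψ(-q)² = φ(-q)ψ(q²), obtained from `Ψ²-split` by q ↦ -q, which fixes `e` as a series in
  -- q².
  2ψ²≋ : # 2 * (ψ[-q] * ψ[-q]) ≋ P * e
  2ψ²≋ = ✶-cancelˡ 0 (# 2) (λ _ ()) lead-2 (Ring.trans
    (Solver.solve 1 (λ ψ → :# 2 ⊠ (:# 2 ⊠ (ψ ⊠ ψ)) Solver.:= (:# 2 ⊠ ψ) ⊠ (:# 2 ⊠ ψ)) Ring.refl ψ[-q])
    (Ring.trans
      (neg.transport {ρ = ψ ∷ p ∷ e ∷ []} {ρ′ = ψ[-q] ∷ P ∷ e ∷ []}
        (pointwise (neg-involutive ψ[-q]) ∷ neg-p ∷ pointwise (neg-stretch² Ψ) ∷ [])
        ((:# 2 ⊠ v₀) ⊠ (:# 2 ⊠ v₀)) (v₁ ⊠ v₂ ⊹ v₂ ⊠ v₁)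
        (Ring.trans (Ring.*-cong (Ring.sym Ψ≋2ψ) (Ring.sym Ψ≋2ψ)) Ψ²-split))
      (Solver.solve 2 (λ P e → P ⊠ e ⊹ e ⊠ P Solver.:= :# 2 ⊠ (P ⊠ e)) Ring.refl P e)))

  2ψ₅²≋ : # 2 * (ψ₅ * ψ₅) ≋ Q * e₅
  2ψ₅²≋ = V₅.transport {ρ = ψ[-q] ∷ P ∷ e ∷ []} {ρ′ = ψ₅ ∷ Q ∷ e₅ ∷ []} (stretch⁵-ψ ∷ Ring.refl ∷ Ring.refl ∷ [])
    (:# 2 ⊠ (v₀ ⊠ v₀)) (v₁ ⊠ v₂) 2ψ²≋

  16PrB≋ : # 16 * P * r * B ≋ Q ^ 2 * G p P r Q * (P ^ 2 - Q ^ 2)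
  16PrB≋ = square-injective 3 (# 16 * P * r * B) (Q ^ 2 * G p P r Q * (P ^ 2 - Q ^ 2)) lead-B₀ lead-B
    (✶-cancelˡ 1 (E p P r Q * P * e) lead-EPe₀ lead-EPe
      (B²≈ P r Q x e e₅ b̅₅ (G p P r Q) (E p P r Q) (P ^ 2 - Q ^ 2) (r ^ 4 - Q ^ 4)
        (b²≈ P Q e e₅ ψ[-q] ψ₅ b̅₅ 2ψ²≋ 2ψ₅²≋ (Ring.trans ψ*b̅₅ (fifth-power ψ₅)))
        xg⁴≋ gE≋eG (star p P r Q K-p L-p W₁-p W₂-p)))

  B-neg-B : # 8 * (B - neg B) ≋ p ^ 3 * r - P ^ 3 * Q - # 3 * (p * r ^ 3 - P * Q ^ 3)
  B-neg-B = ✶-cancelˡ 0 (# 8 * p * P * r * Q) (λ _ ()) lead-8pPrQ (B-difference p P r Q K-p L-p W₁-p W₂-p B (neg B) 16PrB≋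
    (neg.transport {ρ = p ∷ P ∷ r ∷ Q ∷ B ∷ []} {ρ′ = P ∷ p ∷ Q ∷ r ∷ neg B ∷ []} (neg-p ∷ Ring.refl ∷ neg-r ∷ neg-Q ∷ Ring.refl ∷ [])
      (:# 16 ⊠ v₁ ⊠ v₂ ⊠ v₄) (v₃ ↑ 2 ⊠ G′ v₀ v₁ v₂ v₃ ⊠ (v₁ ↑ 2 ⊟ v₃ ↑ 2)) 16PrB≋))

  -- Vanishing at non-residues modulo 5, and the comparison of coefficients.

  square-mod-5 : ∀ v → (v ℕ.* v) ℕ.% 5 ≢ 2 × (v ℕ.* v) ℕ.% 5 ≢ 3
  square-mod-5 v = subst (λ t → t ≢ 2 × t ≢ 3) (sym (%-distribˡ-* v v 5)) (squares (v ℕ.% 5) (m%n<n v 5))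
    where
    squares : ∀ u → u ℕ.< 5 → (u ℕ.* u) ℕ.% 5 ≢ 2 × (u ℕ.* u) ℕ.% 5 ≢ 3
    squares 0 _ = (λ ()) , λ ()
    squares 1 _ = (λ ()) , λ ()
    squares 2 _ = (λ ()) , λ ()
    squares 3 _ = (λ ()) , λ ()
    squares 4 _ = (λ ()) , λ ()
    squares (suc (suc (suc (suc (suc _))))) (s≤s (s≤s (s≤s (s≤s (s≤s ())))))

  NonResidue : ℕ → Set
  NonResidue n = n ℕ.% 5 ≡ 2 ⊎ n ℕ.% 5 ≡ 3

  nonResidue≢square : ∀ {n} → NonResidue n → ∀ y → n ≢ square y
  nonResidue≢square (inj₁ n≡2) y refl = proj₁ (square-mod-5 ∣ y ∣) n≡2
  nonResidue≢square (inj₂ n≡3) y refl = proj₂ (square-mod-5 ∣ y ∣) n≡3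

  p-nonResidue : ∀ {n} → NonResidue n → p n ≡ 0ℤ
  p-nonResidue {n} nr = sums-unique (coefficient p-theta n)
    (sums-zero λ y → ·q^-≢ 1ℤ {square y} {n} (nonResidue≢square nr y))

  opaque
    unfolding _✶_

    -- A nonzero term pairs an exponent divisible by 5 with an exponent i ≡ n (mod 5) of `p`, and
    -- `p` has no such exponent when n is a non-residue.
    p*stretch-nonResidue : ∀ f {n} → NonResidue n → (p * f ⟨q^ 5 ⟩) n ≡ 0ℤ
    p*stretch-nonResidue f {n} nr = trans (∑-cong (suc n) {g = λ _ → 0ℤ} λ i i≤n → term i (ℕ.≤-pred i≤n) (5 ∣? n ℕ.∸ i))
      (∑-zero (suc n) λ _ → refl)
      where
      term : ∀ i → i ℕ.≤ n → Dec (5 ∣ n ℕ.∸ i) → p i ℤ.* (f ⟨q^ 5 ⟩) (n ℕ.∸ i) ≡ 0ℤ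
      term i i≤n (yes (divides k n∸i≡5k)) = trans (cong (ℤ._* (f ⟨q^ 5 ⟩) (n ℕ.∸ i)) (p-nonResidue {i} nr′)) (ℤ.*-zeroˡ ((f ⟨q^ 5 ⟩) (n ℕ.∸ i)))
        where
        n%5≡i%5 : n ℕ.% 5 ≡ i ℕ.% 5
        n%5≡i%5 = trans (cong (ℕ._% 5) (trans (sym (ℕ.m+[n∸m]≡n i≤n)) (cong (i ℕ.+_) n∸i≡5k))) ([m+kn]%n≡m%n i k 5)
        nr′ : NonResidue i
        nr′ = subst (λ t → t ≡ 2 ⊎ t ≡ 3) n%5≡i%5 nr
      term i i≤n (no 5∤) = trans (cong (p i ℤ.*_) (stretch-∤ {5} f 5∤)) (ℤ.*-zeroʳ (p i))

    x✶-suc : ∀ f n → (x * f) (suc n) ≡ f n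
    x✶-suc = x⊛-suc

  pr³-nonResidue : ∀ {n} → NonResidue n → (p * r ^ 3) n ≡ 0ℤ
  pr³-nonResidue {n} nr = trans (at (Ring.*-congˡ {p} (Ring.sym (V₅.evaluate {ρ = p ∷ []} {ρ′ = r ∷ []} (Ring.refl ∷ []) (v₀ ↑ 3)))) n)
    (p*stretch-nonResidue (p ^ 3) nr)

  B-coefficient : ∀ m → B (3 ℕ.+ m) ≡ b̅₅ m
  B-coefficient m = trans (at (Solver.solve 2 (λ x b → x ↑ 3 ⊠ b Solver.:= x ⊠ (x ⊠ (x ⊠ b))) Ring.refl x b̅₅) (3 ℕ.+ m))
    (trans (x✶-suc (x * (x * b̅₅)) (2 ℕ.+ m)) (trans (x✶-suc (x * b̅₅) (1 ℕ.+ m)) (x✶-suc b̅₅ m)))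

  P³Q≋ : P ^ 3 * Q ≋ neg (p ^ 3 * r)
  P³Q≋ = Ring.sym (neg.evaluate {ρ = p ∷ r ∷ []} {ρ′ = P ∷ Q ∷ []} (neg-p ∷ neg-r ∷ []) (v₀ ↑ 3 ⊠ v₁))

  PQ³≋ : P * Q ^ 3 ≋ neg (p * r ^ 3)
  PQ³≋ = Ring.sym (neg.evaluate {ρ = p ∷ r ∷ []} {ρ′ = P ∷ Q ∷ []} (neg-p ∷ neg-r ∷ []) (v₀ ⊠ v₁ ↑ 3))

  -- At odd n a difference f(q) - f(-q) has coefficient twice that of f. With D gone, the hypotheses
  -- read 4A = 10C and 16B = 2C at n, whence the factor 20.
  odd-coefficients : ∀ A B C C⁻ D D⁻ → C⁻ ≋ neg C → D⁻ ≋ neg D →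
    # 2 * (A - neg A) ≋ # 5 * (C - C⁻) - # 11 * (D - D⁻) → # 8 * (B - neg B) ≋ C - C⁻ - # 3 * (D - D⁻) →
    ∀ n → -1ℤ ℤ.^ n ≡ -1ℤ → D n ≡ 0ℤ → A n ≡ + 20 ℤ.* B n
  odd-coefficients A B C C⁻ D D⁻ C⁻≋ D⁻≋ hA hB n odd Dn≡0 = ℤ.*-cancelˡ-≡ (+ 4) (A n) (+ 20 ℤ.* B n) (begin
    + 4 ℤ.* A n
      ≡⟨ solve 1 (λ a → con (+ 4) :* a := con (+ 2) :* (con (+ 2) :* a)) refl (A n) ⟩
    + 2 ℤ.* (+ 2 ℤ.* A n)
      ≡⟨ trans (const-✶ (+ 2) (A - neg A) n) (cong (+ 2 ℤ.*_) (odd-part A (neg A) Ring.refl)) ⟨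
    (# 2 * (A - neg A)) n
      ≡⟨ at hA n ⟩
    (# 5 * (C - C⁻) - # 11 * (D - D⁻)) n
      ≡⟨ cong₂ ℤ._-_ (trans (const-✶ (+ 5) (C - C⁻) n) (cong (+ 5 ℤ.*_) (odd-part C C⁻ C⁻≋)))
                     (trans (const-✶ (+ 11) (D - D⁻) n) (cong (+ 11 ℤ.*_) D-D⁻≡0)) ⟩
    + 5 ℤ.* (+ 2 ℤ.* C n) ℤ.- + 11 ℤ.* 0ℤ
      ≡⟨ solve 1 (λ c → con (+ 5) :* (con (+ 2) :* c) :- con (+ 11) :* con 0ℤ := con (+ 5) :* (con (+ 2) :* c :- con (+ 3) :* con 0ℤ)) refl (C n) ⟩
    + 5 ℤ.* (+ 2 ℤ.* C n ℤ.- + 3 ℤ.* 0ℤ)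
      ≡⟨ cong (+ 5 ℤ.*_) (cong₂ ℤ._-_ (odd-part C C⁻ C⁻≋) (trans (const-✶ (+ 3) (D - D⁻) n) (cong (+ 3 ℤ.*_) D-D⁻≡0))) ⟨
    + 5 ℤ.* (C - C⁻ - # 3 * (D - D⁻)) n
      ≡⟨ cong (+ 5 ℤ.*_) (at hB n) ⟨
    + 5 ℤ.* (# 8 * (B - neg B)) n
      ≡⟨ cong (+ 5 ℤ.*_) (trans (const-✶ (+ 8) (B - neg B) n) (cong (+ 8 ℤ.*_) (odd-part B (neg B) Ring.refl))) ⟩
    + 5 ℤ.* (+ 8 ℤ.* (+ 2 ℤ.* B n))
      ≡⟨ solve 1 (λ b → con (+ 5) :* (con (+ 8) :* (con (+ 2) :* b)) := con (+ 4) :* (con (+ 20) :* b)) refl (B n) ⟩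
    + 4 ℤ.* (+ 20 ℤ.* B n) ∎)
    where
    open ≡-Reasoning
    open +-*-Solver
    odd-part : ∀ f f⁻ → f⁻ ≋ neg f → (f - f⁻) n ≡ + 2 ℤ.* f n
    odd-part f f⁻ f⁻≋ = trans (cong (λ t → f n ℤ.- t) (trans (at f⁻≋ n) (cong (ℤ._* f n) odd)))
      (solve 1 (λ t → t :- con -1ℤ :* t := con (+ 2) :* t) refl (f n))
    D-D⁻≡0 : (D - D⁻) n ≡ 0ℤ
    D-D⁻≡0 = trans (odd-part D D⁻ D⁻≋) (cong (+ 2 ℤ.*_) Dn≡0)

  A≡20B : ∀ n → -1ℤ ℤ.^ n ≡ -1ℤ → NonResidue n → A n ≡ + 20 ℤ.* B n
  A≡20B n odd nr = odd-coefficients A B (p ^ 3 * r) (P ^ 3 * Q) (p * r ^ 3) (P * Q ^ 3) P³Q≋ PQ³≋ A-neg-A B-neg-B n odd (pr³-nonResidue nr)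

  a̅₅≡20b̅₅ : ∀ N m w → N ≡ 3 ℕ.+ m → N ≡ suc (w ℕ.+ w) → NonResidue N → a̅₅ (N ℕ.* 2) ≡ + 20 ℤ.* b̅₅ m
  a̅₅≡20b̅₅ N m w N≡3+m N≡1+2w nr = trans
    (A≡20B N (trans (cong (-1ℤ ℤ.^_) N≡1+2w) (cong (-1ℤ ℤ.*_) (-1²ⁿ≡1 w))) nr)
    (cong (+ 20 ℤ.*_) (trans (cong B N≡3+m) (B-coefficient m)))

  coefficient-relation : ∀ i N m w → i ≡ N ℕ.* 2 → N ≡ 3 ℕ.+ m → N ≡ suc (w ℕ.+ w) → NonResidue N → a̅₅ i ≡ + 20 ℤ.* b̅₅ m
  coefficient-relation i N m w refl = a̅₅≡20b̅₅ N m w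

open ModularRelations using (coefficient-relation)
open import Data.Integer using (_*_)

corollary7 : (n : ℕ) →
    (a̅₅ (20 ℕ.* n ℕ.+ 6) ≡ + 20 * b̅₅ (10 ℕ.* n)) ×
    (a̅₅ (20 ℕ.* n ℕ.+ 14) ≡ + 20 * b̅₅ (10 ℕ.* n ℕ.+ 4))
corollary7 n =
    -- `A` and `B` are compared at index 10n + 3, which is odd and ≡ 3 (mod 5); in the second case
    -- the index is 10n + 7, odd and ≡ 2 (mod 5).
    coefficient-relation (20 ℕ.* n ℕ.+ 6) (10 ℕ.* n ℕ.+ 3) (10 ℕ.* n) (5 ℕ.* n ℕ.+ 1)
        (solve 1 (λ n → con 20 :* n :+ con 6 := (con 10 :* n :+ con 3) :* con 2) refl n)
        (ℕ.+-comm (10 ℕ.* n) 3)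
        (solve 1 (λ n → con 10 :* n :+ con 3 := con 1 :+ ((con 5 :* n :+ con 1) :+ (con 5 :* n :+ con 1))) refl n)
        (inj₂ (trans (cong (ℕ._% 5) (solve 1 (λ n → con 10 :* n :+ con 3 := con 3 :+ (con 2 :* n) :* con 5) refl n))
                       ([m+kn]%n≡m%n 3 (2 ℕ.* n) 5)))
  , coefficient-relation (20 ℕ.* n ℕ.+ 14) (10 ℕ.* n ℕ.+ 7) (10 ℕ.* n ℕ.+ 4) (5 ℕ.* n ℕ.+ 3)
        (solve 1 (λ n → con 20 :* n :+ con 14 := (con 10 :* n :+ con 7) :* con 2) refl n)
        (solve 1 (λ n → con 10 :* n :+ con 7 := con 3 :+ (con 10 :* n :+ con 4)) refl n)
        (solve 1 (λ n → con 10 :* n :+ con 7 := con 1 :+ ((con 5 :* n :+ con 3) :+ (con 5 :* n :+ con 3))) refl n)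
        (inj₁ (trans (cong (ℕ._% 5) (solve 1 (λ n → con 10 :* n :+ con 7 := con 2 :+ (con 2 :* n :+ con 1) :* con 5) refl n))
                       ([m+kn]%n≡m%n 2 (2 ℕ.* n ℕ.+ 1) 5)))
  where open ℕ-Solver.+-*-Solver
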